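{- Let $\Pi\subseteq\mathfrak{S}_3$ be a set of permutations of length $3$ such that $\{123,321\}\not\subseteq\Pi$. Then the following are equivalent: (1) $Q_n(\Pi)$ is symmetric for all $n$. (2) $Q_n(\Pi)$ is Schur nonnegative for all $n$. (3) $\Pi$ is one of the following sets: $\emptyset$; $\{123\}$; $\{321\}$; $\{132,213\}$; $\{132,312\}$; $\{213,231\}$; $\{231,312\}$; $\{123,132,312\}$; $\{123,213,231\}$; $\{123,231,312\}$; $\{132,213,321\}$; $\{132,312,321\}$; $\{213,231,321\}$; $\{132,213,231,312\}$; $\{123,132,213,231,312\}$; $\{132,213,231,312,321\}$.
   Context: $\mathfrak{S}_n$ is the set of permutations $\pi=\pi_1\cdots\pi_n$ of $[n]=\{1,\dots,n\}$ in one-line notation. A permutation $\sigma$ contains a permutation $\pi$ as a pattern if some (not necessarily consecutive) subsequence of $\sigma$ is order-isomorphic to $\pi$; otherwise $\sigma$ avoids $\pi$. $\mathfrak{S}_n(\Pi)$ is the set of $\sigma\in\mathfrak{S}_n$ avoiding every $\pi\in\Pi$. The descent set of $\sigma$ is $\mathrm{Des}\,\sigma=\{i\mid\sigma_i>\sigma_{i+1}\}\subseteq[n-1]$. For $S\subseteq[n-1]$ the fundamental quasisymmetric function (of degree $n$, in variables $x_1,x_2,\dots$) is $F_S=\sum x_{i_1}x_{i_2}\cdots x_{i_n}$, summed over all $i_1\le i_2\le\dots\le i_n$ with $i_s<i_{s+1}$ whenever $s\in S$. Define $Q_n(\Pi)=\sum_{\sigma\in\mathfrak{S}_n(\Pi)}F_{\mathrm{Des}\,\sigma}$.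 A power series of bounded degree is symmetric if it is invariant under all permutations of the variables. Schur nonnegative means: symmetric, with all coefficients nonnegative in the expansion in the Schur basis $s_\lambda$. -}

module Defs where

open import Data.Bool using (true) renaming (_≟_ to _≟ᵇ_)
open import Data.Fin.Properties using (all?)
open import Data.Fin.Subset using (Subset)
open import Data.Integer as ℤ using (ℤ; +_; 0ℤ)
open import Data.List
  using (List; []; _∷_; [_]; map; foldr; filter; length; concat; concatMap; zip; upTo; applyUpTo;
         deduplicate; cartesianProductWith; _++_)
open import Data.List.Membership.DecPropositional using (_∈?_)
open import Data.List.Membership.Propositional.Properties using (∈-∃++)
open import Data.List.Relation.Binary.Permutation.Propositional
  using (_↭_; ↭-refl; ↭-sym; ↭-trans; prep)
open import Data.List.Relation.Binary.Permutation.Propositional.Properties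
  using (∈-resp-↭; ¬x∷xs↭[]; drop-mid; shift)
open import Data.List.Relation.Binary.Sublist.Propositional using (_⊆_; []; _∷_; _∷ʳ_; minimum)
open import Data.List.Relation.Unary.All as All using (All)
open import Data.List.Relation.Unary.Any using (here)
open import Data.List.Relation.Unary.Linked as Linked using (Linked)
open import Data.List.Relation.Unary.AllPairs using (allPairs?)
open import Data.Nat
  using (ℕ; zero; suc; _∸_; _≤_; _<_; _≤?_; _<?_; _≥?_; _≟_)
open import Data.Nat.ListAction using (sum)
open import Data.Product using (Σ; ∃-syntax; _×_; _,_; uncurry)
open import Data.Sum using (inj₁; inj₂; [_,_]′)
open import Data.Unit using (⊤; tt)
open import Data.Vec using (Vec; []; _∷_; lookup; toList)
open import Function using (_⇔_; mk⇔; _↔_; Equivalence; Inverse)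
open import Relation.Binary.PropositionalEquality using (_≡_; refl)
open import Relation.Nullary using (¬_; Dec; yes; no; does)
open import Relation.Nullary.Decidable using (map′; ¬?; _×-dec_; _⊎-dec_; _→-dec_)
open import Relation.Unary using (Decidable)

words : List ℕ → (n : ℕ) → List (Vec ℕ n)
words A zero    = [ [] ]
words A (suc n) = cartesianProductWith _∷_ A (words A n)

------------------------------------------------------------------------
-- Permutations and patterns

[1⋯_] : ℕ → List ℕ
[1⋯ n ] = applyUpTo suc n

-- Permutations are in one-line notation, with the values 1, …, n.
𝔖 : (n : ℕ) → List (Vec ℕ n)
𝔖 n = filter (λ σ → allPairs? (λ a b → ¬? (a ≟ b)) (toList σ)) (words [1⋯ n ] n)

OrderIsomorphic : ∀ {k} → Vec ℕ k → Vec ℕ k → Set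
OrderIsomorphic τ π = ∀ i j → lookup τ i < lookup τ j ⇔ lookup π i < lookup π j

Contains : ∀ {n k} → Vec ℕ n → Vec ℕ k → Set
Contains {k = k} σ π = ∃[ τ ] toList {n = k} τ ⊆ toList σ × OrderIsomorphic τ π

orderIsomorphic? : ∀ {k} (τ π : Vec ℕ k) → Dec (OrderIsomorphic τ π)
orderIsomorphic? τ π = all? λ i → all? λ j →
  let p = lookup τ i <? lookup τ j
      q = lookup π i <? lookup π j
  in map′ (uncurry mk⇔) (λ e → Equivalence.to e , Equivalence.from e)
          ((p →-dec q) ×-dec (q →-dec p))

anySublist? : ∀ {k} {P : Vec ℕ k → Set} → Decidable P →
              (xs : List ℕ) → Dec (∃[ τ ] toList τ ⊆ xs × P τ)
anySublist? {zero} P? xs =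
  map′ (λ p → [] , minimum xs , p) (λ { ([] , _ , p) → p }) (P? [])
anySublist? {suc k} P? [] = no λ { (_ ∷ _ , () , _) }
anySublist? {suc k} P? (x ∷ xs) =
  map′ [ (λ { (τ , s , p) → x ∷ τ , refl ∷ s , p })
       , (λ { (τ , s , p) → τ , x ∷ʳ s , p }) ]′
       (λ { (_ ∷ τ , refl ∷ s , p) → inj₁ (τ , s , p)
          ; (τ , _ ∷ʳ s , p) → inj₂ (τ , s , p) })
       (anySublist? (λ τ → P? (x ∷ τ)) xs ⊎-dec anySublist? P? xs)

contains? : ∀ {n k} (σ : Vec ℕ n) (π : Vec ℕ k) → Dec (Contains σ π)
contains? σ π = anySublist? (λ τ → orderIsomorphic? τ π) (toList σ)

Avoids : ∀ {n k} → List (Vec ℕ k) → Vec ℕ n → Set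
Avoids Π σ = All (λ π → ¬ Contains σ π) Π

avoids? : ∀ {n k} (Π : List (Vec ℕ k)) (σ : Vec ℕ n) → Dec (Avoids Π σ)
avoids? Π σ = All.all? (λ π → ¬? (contains? σ π)) Π

𝔖-avoiding : ∀ (n : ℕ) {k} → List (Vec ℕ k) → List (Vec ℕ n)
𝔖-avoiding n Π = filter (avoids? Π) (𝔖 n)

-- A subset of [n-1] is a Subset (n ∸ 1): the position with index i : Fin (n ∸ 1)
-- stands for the element i + 1 of [n-1].
Des : ∀ {n} → Vec ℕ n → Subset (n ∸ 1)
Des []          = []
Des (_ ∷ [])    = []
Des (a ∷ b ∷ w) = does (b <? a) ∷ Des (b ∷ w)

------------------------------------------------------------------------
-- Power series in countably many variables

-- The variables are indexed by ℕ (so they start at x₀).  A monomial is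
-- represented by a list of the indices of its variables, with multiplicity and
-- in any order: x₀²x₂ is 0 ∷ 0 ∷ 2 ∷ [] as well as 0 ∷ 2 ∷ 0 ∷ [].  Two lists
-- represent the same monomial exactly when they are related by _↭_.  A power
-- series is given by its coefficient function.
Monomial : Set
Monomial = List ℕ

PowerSeries : Set
PowerSeries = Monomial → ℤ

_↭?_ : (u v : Monomial) → Dec (u ↭ v)
[]      ↭? []      = yes ↭-refl
[]      ↭? (y ∷ v) = no λ p → ¬x∷xs↭[] (↭-sym p)
(x ∷ u) ↭? v with _∈?_ _≟_ x v
... | no x∉v = no λ p → x∉v (∈-resp-↭ p (here refl))
... | yes x∈v with ∈-∃++ x∈v
...   | v₁ , v₂ , refl =
        map′ (λ p → ↭-trans (prep x p) (↭-sym (shift x v₁ v₂)))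
             (drop-mid [] v₁)
             (u ↭? (v₁ ++ v₂))

variables : Monomial → List ℕ
variables = deduplicate _≟_

Σ[_] : ∀ {A : Set} → List A → (A → PowerSeries) → PowerSeries
Σ[ xs ] f m = foldr ℤ._+_ 0ℤ (map (λ x → f x m) xs)

_·_ : ℤ → PowerSeries → PowerSeries
(c · f) m = c ℤ.* f m

Symmetric : PowerSeries → Set
Symmetric f = ∀ (φ : ℕ ↔ ℕ) (m : Monomial) → f (map (Inverse.to φ) m) ≡ f m

------------------------------------------------------------------------
-- Fundamental quasisymmetric functions

-- i₁ ≤ i₂ ≤ ⋯ ≤ iₙ, with iₛ < iₛ₊₁ for s ∈ S
Compatible : ∀ {n} → Subset (n ∸ 1) → Vec ℕ n → Set
Compatible []      []          = ⊤
Compatible []      (_ ∷ [])    = ⊤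
Compatible (s ∷ S) (a ∷ b ∷ w) = a ≤ b × (s ≡ true → a < b) × Compatible S (b ∷ w)

compatible? : ∀ {n} (S : Subset (n ∸ 1)) (i : Vec ℕ n) → Dec (Compatible S i)
compatible? []      []          = yes tt
compatible? []      (_ ∷ [])    = yes tt
compatible? (s ∷ S) (a ∷ b ∷ w) =
  a ≤? b ×-dec (s ≟ᵇ true →-dec a <? b) ×-dec compatible? S (b ∷ w)

-- The coefficient of m is the number of summands x_{i₁}⋯x_{iₙ} equal to m.
-- These only involve variables occurring in m.
F : (n : ℕ) → Subset (n ∸ 1) → PowerSeries
F n S m = + length (filter (λ i → compatible? S i ×-dec (toList i ↭? m)) (words (variables m) n))

Q : (n : ℕ) {k : ℕ} → List (Vec ℕ k) → PowerSeries
Q n Π = Σ[ 𝔖-avoiding n Π ] (λ σ → F n (Des σ))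

------------------------------------------------------------------------
-- Schur functions

-- Weakly decreasing lists of positive integers with sum n; there are at most n
-- parts, each at most n.
partitions : ℕ → List (List ℕ)
partitions n =
  filter (λ μ → Linked.linked? _≥?_ μ ×-dec (sum μ ≟ n))
         (concatMap (λ l → map toList (words [1⋯ n ] l)) (upTo (suc n)))

-- A tableau is the list of its rows, from the longest to the shortest.
Tableau : Set
Tableau = List (List ℕ)

fillings : List ℕ → List ℕ → List Tableau
fillings A []      = [ [] ]
fillings A (l ∷ μ) = cartesianProductWith _∷_ (map toList (words A l)) (fillings A μ)

-- zip truncates the upper row to the length of the one below it.
ColumnStrict : List ℕ → List ℕ → Set
ColumnStrict upper lower = All (uncurry _<_) (zip upper lower)

Semistandard : Tableau → Set
Semistandard T = All (Linked _≤_) T × Linked ColumnStrict T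

semistandard? : (T : Tableau) → Dec (Semistandard T)
semistandard? T =
  All.all? (Linked.linked? _≤?_) T ×-dec
  Linked.linked? (λ u l → All.all? (uncurry _<?_) (zip u l)) T

-- The Schur function, as the generating function of the semistandard Young
-- tableaux of shape μ.
s : List ℕ → PowerSeries
s μ m = + length (filter (λ T → semistandard? T ×-dec (concat T ↭? m)) (fillings (variables m) μ))

-- For a power series f which is homogeneous of degree n, where only the Schur
-- functions of degree n occur in the expansion.
SchurNonnegative : ℕ → PowerSeries → Set
SchurNonnegative n f =
  Symmetric f ×
  Σ (List ℕ → ℤ) λ c →
    All (λ μ → 0ℤ ℤ.≤ c μ) (partitions n) ×
    (∀ m → f m ≡ Σ[ partitions n ] (λ μ → c μ · s μ) m)

------------------------------------------------------------------------

p123 p132 p213 p231 p312 p321 : Vec ℕ 3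
p123 = 1 ∷ 2 ∷ 3 ∷ []
p132 = 1 ∷ 3 ∷ 2 ∷ []
p213 = 2 ∷ 1 ∷ 3 ∷ []
p231 = 2 ∷ 3 ∷ 1 ∷ []
p312 = 3 ∷ 1 ∷ 2 ∷ []
p321 = 3 ∷ 2 ∷ 1 ∷ []

listedSets : List (List (Vec ℕ 3))
listedSets =
  [] ∷
  (p123 ∷ []) ∷
  (p321 ∷ []) ∷
  (p132 ∷ p213 ∷ []) ∷
  (p132 ∷ p312 ∷ []) ∷
  (p213 ∷ p231 ∷ []) ∷
  (p231 ∷ p312 ∷ []) ∷
  (p123 ∷ p132 ∷ p312 ∷ []) ∷
  (p123 ∷ p213 ∷ p231 ∷ []) ∷
  (p123 ∷ p231 ∷ p312 ∷ []) ∷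
  (p132 ∷ p213 ∷ p321 ∷ []) ∷
  (p132 ∷ p312 ∷ p321 ∷ []) ∷
  (p213 ∷ p231 ∷ p321 ∷ []) ∷
  (p132 ∷ p213 ∷ p231 ∷ p312 ∷ []) ∷
  (p123 ∷ p132 ∷ p213 ∷ p231 ∷ p312 ∷ []) ∷
  (p132 ∷ p213 ∷ p231 ∷ p312 ∷ p321 ∷ []) ∷
  []

{-# OPTIONS --safe #-}

-- The listed sets give Schur nonnegative functions for two different reasons.
--
-- A permutation σ with a sequence i compatible with Des σ is the same as a word w: sort the pairs
-- (σⱼ , iⱼ) by their first entry.  Row insertion turns w into a semistandard tableau and a lattice
-- word, and σ avoids 321 (or 123) exactly if the tableau has at most two rows (or columns).  This
-- settles ∅, {123} and {321}.  In the other cases Des is a bijection from the permutations avoiding Π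
-- onto the sets S whose size lies in some set K, and a pair of S and a sequence compatible with S is
-- the same as a tableau of hook shape: the entries at the positions after S form the leg.
--
-- Symmetry of the Schur functions is the Bender–Knuth involution.  Conversely, for the sets that are
-- not listed the coefficients in degree 3 or 4 are not invariant under exchanging two variables.
module Submission where

open import Defs
open import Data.Bool using (Bool; true; false; not; if_then_else_)
open import Data.Empty using (⊥; ⊥-elim)
open import Data.Fin using (Fin; zero; suc)
open import Data.Fin.Subset using (Subset)
open import Data.Integer as ℤ using (ℤ; +_; 0ℤ)
import Data.Integer.Properties as ℤ
open import Data.List
  using (List; []; _∷_; [_]; map; foldr; filter; length; concat; concatMap; zip; upTo;
         cartesianProduct; replicate; _++_)
import Data.List.Properties as List
open import Data.List.Membership.Propositional using (_∈_; _∉_; find)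
open import Data.List.Membership.Propositional.Properties
open import Data.List.Relation.Binary.BagAndSetEquality using (_∼[_]_; set)
open import Data.List.Relation.Binary.Permutation.Propositional
  using (_↭_; ↭-refl; ↭-reflexive; ↭-sym; ↭-trans; prep; swap; trans; refl; module PermutationReasoning)
import Data.List.Relation.Binary.Permutation.Propositional.Properties as ↭
open import Data.List.Relation.Binary.Sublist.Propositional using ([]; _∷_; _∷ʳ_; minimum)
  renaming (_⊆_ to _⊑_; ⊆-trans to ⊑-trans)
import Data.List.Relation.Binary.Sublist.Propositional.Properties as ⊑
open import Data.List.Relation.Binary.Subset.Propositional using (_⊆_)
open import Data.List.Relation.Unary.All as All using (All; []; _∷_)
import Data.List.Relation.Unary.All.Properties as All
open import Data.List.Relation.Unary.AllPairs as AllPairs using (AllPairs; []; _∷_)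
import Data.List.Relation.Unary.AllPairs.Properties as AllPairs
open import Data.List.Relation.Unary.Any as Any using (Any; here; there)
open import Data.List.Relation.Unary.Linked as Linked using (Linked; []; [-]; _∷_)
import Data.List.Relation.Unary.Linked.Properties as Linked
open import Data.List.Relation.Unary.Unique.Propositional using (Unique)
open import Data.List.Relation.Unary.Unique.DecPropositional.Properties using (deduplicate-!)
import Data.List.Relation.Unary.Unique.Propositional.Properties as Unique
open import Data.Nat
open import Data.Nat.ListAction using (sum)
open import Data.Nat.Properties
open import Data.Nat.Tactic.RingSolver using (solve-∀)
open import Data.Product using (∃; ∃₂; ∃-syntax; _×_; _,_; proj₁; proj₂; uncurry)
open import Data.Sum using (_⊎_; inj₁; inj₂; [_,_]′)
open import Data.Unit using (⊤; tt)
open import Data.Vec as Vec using (Vec; []; _∷_; lookup; toList)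
import Data.Vec.Properties as Vec
open import Function using (_⇔_; mk⇔; _↔_; mk↔ₛ′; Equivalence; Inverse; _∘_; id)
open import Relation.Binary.Definitions using (tri<; tri≈; tri>)
open import Relation.Binary.PropositionalEquality
  using (_≡_; _≢_; refl; sym; cong; cong₂; subst; subst₂; module ≡-Reasoning)
  renaming (trans to ≡-trans)
open import Relation.Nullary using (¬_; Dec; yes; no; does)
open import Relation.Nullary.Decidable using (from-yes; map′; _×-dec_; _⊎-dec_; ¬?; dec-true; dec-false)

-- Coefficients are lengths of explicit lists, so every identity of power series becomes, at a fixed
-- monomial, a bijection between duplicate-free lists.
--
-- The letters are sorted by decreasing entry of σ and `RSK` inserts from the right end, so they
-- enter in the order of the entries 1, ..., n. In the word as listed, a 321 is then a strictly
-- increasing triple and a 123 a weakly decreasing one, and these are the subsequences that force a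
-- third row or a third column. Lattice words replace recording tableaux: each letter is the row of
-- a new box, so reversing the insertion needs shapes only.
--
-- In the hook cases Q is the sum of the Schur functions of (n - d, 1, ..., 1), with d ones, over d
-- in K. The pairs {132,213}, {132,312}, {213,231}, {231,312} realize every descent set once. Adding
-- 123 or 321, where the result is listed, allows at most one ascent or at most one descent; adding
-- the two other nonmonotone patterns leaves the monotone permutations.
--
-- The Bender-Knuth involution is phrased by counts of entries below a bound. A row is determined by
-- these counts, and no matching of entries has to be followed through the tableau.

private
  variable
    A B : Set

-- Finite lists and counting by bijections

remove-mid : ∀ {x : A} us {vs} → Unique (us ++ x ∷ vs) → x ∉ us ++ vs × Unique (us ++ vs)
remove-mid []       (p ∷ u) = All.All¬⇒¬Any p , u
remove-mid {x = x} (y ∷ us) {vs} (p ∷ u) with remove-mid us u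
... | x∉ , u′ = x∉′ , All.++⁺ (All.++⁻ˡ us p) (All.tail (All.++⁻ʳ us p)) ∷ u′
  where
  x∉′ : x ∉ y ∷ us ++ vs
  x∉′ (here refl) = All.head (All.++⁻ʳ us p) refl
  x∉′ (there q)   = x∉ q

unique-↭ : {xs ys : List A} → Unique xs → Unique ys → (∀ {x} → x ∈ xs → x ∈ ys) →
           (∀ {x} → x ∈ ys → x ∈ xs) → xs ↭ ys
unique-↭ {xs = []} {[]}     _ _ _ _ = ↭-refl
unique-↭ {xs = []} {y ∷ ys} _ _ _ g with () ← g (here refl)
unique-↭ {xs = x ∷ xs} (p ∷ u) v f g with ∈-∃++ (f (here refl))
... | us , vs , refl with remove-mid us v
... | x∉ , v′ = ↭-trans (prep x (unique-↭ u v′ f′ g′)) (↭-sym (↭.shift x us vs))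
  where
  f′ : ∀ {z} → z ∈ xs → z ∈ us ++ vs
  f′ {z} z∈ with ∈-++⁻ us (f (there z∈))
  ... | inj₁ q           = ∈-++⁺ˡ q
  ... | inj₂ (here refl) = ⊥-elim (All.All¬⇒¬Any p z∈)
  ... | inj₂ (there q)   = ∈-++⁺ʳ us q
  g′ : ∀ {z} → z ∈ us ++ vs → z ∈ xs
  g′ {z} z∈ with g ([ ∈-++⁺ˡ , (λ q → ∈-++⁺ʳ us (there q)) ]′ (∈-++⁻ us z∈))
  ... | here refl = ⊥-elim (x∉ z∈)
  ... | there q   = q

map-unique : (f : A → B) {xs : List A} → (∀ {x y} → x ∈ xs → y ∈ xs → f x ≡ f y → x ≡ y) →
             Unique xs → Unique (map f xs)
map-unique f inj []      = []
map-unique f inj (p ∷ u) =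
  All.map⁺ (All.tabulate λ q e → All.lookup p q (inj (here refl) (there q) e))
  ∷ map-unique f (λ q r → inj (there q) (there r)) u

-- The hypotheses concern members of the lists only, because the maps used later are total functions
-- that are meaningful only there.
length-bijection : {xs : List A} {ys : List B} → Unique xs → Unique ys → (f : A → B) →
  (∀ {x} → x ∈ xs → f x ∈ ys) →
  (∀ {x y} → x ∈ xs → y ∈ xs → f x ≡ f y → x ≡ y) →
  (∀ {y} → y ∈ ys → ∃[ x ] x ∈ xs × f x ≡ y) → length xs ≡ length ys
length-bijection {xs = xs} {ys} u v f into inj surj =
  ≡-trans (sym (List.length-map f xs)) (↭.↭-length (unique-↭ (map-unique f inj u) v to from))
  where
  to : ∀ {y} → y ∈ map f xs → y ∈ ys
  to q with ∈-map⁻ f q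
  ... | _ , r , refl = into r
  from : ∀ {y} → y ∈ ys → y ∈ map f xs
  from q with surj q
  ... | _ , r , refl = ∈-map⁺ f r

-- Makes a sum of lengths the length of one list, so that a sum over permutations and a sum over
-- shapes can be compared by a single bijection.
sum-length : (g : A → ℤ) (h : A → List B) (xs : List A) → (∀ x → g x ≡ + length (h x)) →
             foldr ℤ._+_ 0ℤ (map g xs) ≡ + length (concatMap h xs)
sum-length g h []       e = refl
sum-length g h (x ∷ xs) e = begin
  g x ℤ.+ foldr ℤ._+_ 0ℤ (map g xs)       ≡⟨ cong₂ ℤ._+_ (e x) (sum-length g h xs e) ⟩
  + (length (h x) + length (concatMap h xs)) ≡⟨ cong +_ (sym (List.length-++ (h x))) ⟩
  + length (h x ++ concatMap h xs)           ∎
  where open ≡-Reasoning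

concatMap-unique : (h : A → List B) {xs : List A} → Unique xs → (∀ x → Unique (h x)) →
                   (∀ {x y b} → b ∈ h x → b ∈ h y → x ≡ y) → Unique (concatMap h xs)
concatMap-unique h []      u disj = []
concatMap-unique h {x ∷ xs} (p ∷ q) u disj =
  Unique.++⁺ (u x) (concatMap-unique h q u disj) λ (b∈ , b∈′) →
    let y , y∈ , b∈y = find (∈-concatMap⁻ h b∈′) in All.lookup p y∈ (disj b∈ b∈y)

∈-concatMap : (h : A → List B) {xs : List A} {x : A} {b : B} → x ∈ xs → b ∈ h x → b ∈ concatMap h xs
∈-concatMap h x∈ b∈ = ∈-concatMap⁺ h (Any.map (λ { refl → b∈ }) x∈)

∈-concatMap-witness : (h : A → List B) (xs : List A) {b : B} → b ∈ concatMap h xs →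
                      ∃[ x ] x ∈ xs × b ∈ h x
∈-concatMap-witness h xs b∈ = find (∈-concatMap⁻ h b∈)

-- Membership in the lists of words, fillings, permutations, partitions and tableaux

∈-words⁺ : ∀ {C n} {v : Vec ℕ n} → All (_∈ C) (toList v) → v ∈ words C n
∈-words⁺ {v = []}    []      = here refl
∈-words⁺ {v = x ∷ v} (p ∷ q) = ∈-cartesianProductWith⁺ _∷_ p (∈-words⁺ q)

∈-words⁻ : ∀ {C n} {v : Vec ℕ n} → v ∈ words C n → All (_∈ C) (toList v)
∈-words⁻ {n = zero} {v = []} _ = []
∈-words⁻ {C} {suc n} p with ∈-cartesianProductWith⁻ _∷_ C (words C n) p
... | _ , _ , q , r , refl = q ∷ ∈-words⁻ r

words-unique : ∀ {C} n → Unique C → Unique (words C n)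
words-unique zero    u = [] ∷ []
words-unique (suc n) u = Unique.cartesianProductWith⁺ _∷_ Vec.∷-injective u (words-unique n u)

∈-listWords : ∀ {C} {xs : List ℕ} → All (_∈ C) xs → xs ∈ map toList (words C (length xs))
∈-listWords {C} {xs} p = subst (_∈ map toList (words C (length xs))) (Vec.toList∘fromList xs)
  (∈-map⁺ toList (∈-words⁺ (subst (All (_∈ C)) (sym (Vec.toList∘fromList xs)) p)))

∈-fillings⁺ : ∀ {C} {T : Tableau} → All (All (_∈ C)) T → T ∈ fillings C (map length T)
∈-fillings⁺ []                  = here refl
∈-fillings⁺ {T = r ∷ T} (p ∷ q) =
  ∈-cartesianProductWith⁺ _∷_
    (∈-listWords p) (∈-fillings⁺ q)

∈-fillings⁻ : ∀ {C} μ {T : Tableau} → T ∈ fillings C μ → All (All (_∈ C)) T × map length T ≡ μ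
∈-fillings⁻ []      (here refl) = [] , refl
∈-fillings⁻ {C} (l ∷ μ) p with ∈-cartesianProductWith⁻ _∷_ (map toList (words C l)) (fillings C μ) p
... | _ , _ , q , r , refl with ∈-map⁻ toList q | ∈-fillings⁻ μ r
... | v , v∈ , refl | p′ , e = ∈-words⁻ v∈ ∷ p′ , cong₂ _∷_ (Vec.length-toList v) e

toList-inj : ∀ {n} {u v : Vec A n} → toList u ≡ toList v → u ≡ v
toList-inj {u = []}    {[]}    _ = refl
toList-inj {u = _ ∷ _} {_ ∷ _} e = cong₂ _∷_ (List.∷-injectiveˡ e) (toList-inj (List.∷-injectiveʳ e))

fillings-unique : ∀ {C} μ → Unique C → Unique (fillings C μ)
fillings-unique []      u = [] ∷ []
fillings-unique (l ∷ μ) u =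
  Unique.cartesianProductWith⁺ _∷_ List.∷-injective
    (map-unique toList (λ _ _ → toList-inj) (words-unique l u)) (fillings-unique μ u)

distinct? : ∀ {n} (σ : Vec ℕ n) → Dec (Unique (toList σ))
distinct? σ = AllPairs.allPairs? (λ a b → ¬? (a ≟ b)) (toList σ)

∈-𝔖⁺ : ∀ {n} {σ : Vec ℕ n} → All (_∈ [1⋯ n ]) (toList σ) → Unique (toList σ) → σ ∈ 𝔖 n
∈-𝔖⁺ p u = ∈-filter⁺ distinct? (∈-words⁺ p) u

∈-𝔖⁻ : ∀ {n} {σ : Vec ℕ n} → σ ∈ 𝔖 n → All (_∈ [1⋯ n ]) (toList σ) × Unique (toList σ)
∈-𝔖⁻ {n} p = let q , u = ∈-filter⁻ distinct? {xs = words [1⋯ n ] n} p in ∈-words⁻ q , u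

[1⋯]-unique : ∀ n → Unique [1⋯ n ]
[1⋯]-unique n = Unique.applyUpTo⁺₁ suc n λ i<j _ e → <⇒≢ i<j (suc-injective e)

𝔖-unique : ∀ n → Unique (𝔖 n)
𝔖-unique n = Unique.filter⁺ distinct? (words-unique n ([1⋯]-unique n))

∈-[1⋯]⁺ : ∀ {n x} → 1 ≤ x → x ≤ n → x ∈ [1⋯ n ]
∈-[1⋯]⁺ {x = suc x} _ x<n = ∈-applyUpTo⁺ suc x<n

∈-[1⋯]⁻ : ∀ {n x} → x ∈ [1⋯ n ] → 1 ≤ x × x ≤ n
∈-[1⋯]⁻ p with ∈-applyUpTo⁻ suc p
... | _ , q , refl = s≤s z≤n , q

∈-variables⁺ : ∀ {m x} → x ∈ m → x ∈ variables m
∈-variables⁺ = ∈-deduplicate⁺ _≟_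

record Partition (n : ℕ) (μ : List ℕ) : Set where
  constructor partition
  field
    decreasing : Linked _≥_ μ
    size       : sum μ ≡ n
    positive   : All (1 ≤_) μ

sum-length≤ : ∀ {μ} → All (1 ≤_) μ → length μ ≤ sum μ
sum-length≤ []      = z≤n
sum-length≤ (p ∷ q) = +-mono-≤ p (sum-length≤ q)

part≤sum : ∀ μ → All (_≤ sum μ) μ
part≤sum []      = []
part≤sum (x ∷ μ) = m≤m+n x (sum μ) ∷ All.map (λ p → ≤-trans p (m≤n+m _ x)) (part≤sum μ)

isPartition? : ∀ n μ → Dec (Linked _≥_ μ × sum μ ≡ n)
isPartition? n μ = Linked.linked? _≥?_ μ ×-dec (sum μ ≟ n)

∈-partitions⁺ : ∀ {n μ} → Partition n μ → μ ∈ partitions n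
∈-partitions⁺ {n} {μ} (partition d refl p) = ∈-filter⁺ (isPartition? n)
  (∈-concatMap (λ l → map toList (words [1⋯ n ] l)) (∈-upTo⁺ (s≤s (sum-length≤ p)))
    (∈-listWords (All.zipWith (uncurry ∈-[1⋯]⁺) (p , part≤sum μ))))
  (d , refl)

∈-partitions⁻ : ∀ {n μ} → μ ∈ partitions n → Partition n μ
∈-partitions⁻ {n} q
  with ∈-filter⁻ (isPartition? n) {xs = concatMap (λ l → map toList (words [1⋯ n ] l)) (upTo (suc n))} q
... | r , d , e with ∈-concatMap-witness (λ l → map toList (words [1⋯ n ] l)) (upTo (suc n)) r
... | l , _ , t with ∈-map⁻ toList t
... | v , v∈ , refl = partition d e (All.map (proj₁ ∘ ∈-[1⋯]⁻) (∈-words⁻ v∈))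

partitions-unique : ∀ n → Unique (partitions n)
partitions-unique n = Unique.filter⁺ (isPartition? n)
  (concatMap-unique (λ l → map toList (words [1⋯ n ] l)) (Unique.upTo⁺ (suc n))
    (λ l → map-unique toList (λ _ _ → toList-inj) (words-unique l ([1⋯]-unique n)))
    disj)
  where
  disj : ∀ {k l b} → b ∈ map toList (words [1⋯ n ] k) → b ∈ map toList (words [1⋯ n ] l) → k ≡ l
  disj p q with ∈-map⁻ toList p | ∈-map⁻ toList q
  ... | u , _ , e | v , _ , e′ =
    ≡-trans (sym (Vec.length-toList u)) (≡-trans (cong length (≡-trans (sym e) e′)) (Vec.length-toList v))

isTableau? : ∀ m T → Dec (Semistandard T × concat T ↭ m)
isTableau? m T = semistandard? T ×-dec (concat T ↭? m)

tableaux : List ℕ → Monomial → List Tableau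
tableaux μ m = filter (isTableau? m) (fillings (variables m) μ)

∈-tableaux⁺ : ∀ {m T} → Semistandard T → concat T ↭ m → T ∈ tableaux (map length T) m
∈-tableaux⁺ {m} {T} ss c = ∈-filter⁺ (isTableau? m)
  (∈-fillings⁺ (All.concat⁻ (All.tabulate λ x∈ → ∈-variables⁺ (↭.∈-resp-↭ c x∈)))) (ss , c)

∈-tableaux⁻ : ∀ {μ m T} → T ∈ tableaux μ m → Semistandard T × concat T ↭ m × map length T ≡ μ
∈-tableaux⁻ {μ} {m} p with ∈-filter⁻ (isTableau? m) {xs = fillings (variables m) μ} p
... | q , ss , c = ss , c , proj₂ (∈-fillings⁻ μ q)

variables-unique : ∀ m → Unique (variables m)
variables-unique = deduplicate-! _≟_

tableaux-unique : ∀ μ m → Unique (tableaux μ m)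
tableaux-unique μ m = Unique.filter⁺ (isTableau? m) (fillings-unique μ (variables-unique m))

-- Schur expansions from bijections

length-product : (xs : List A) (ys : List B) → length (cartesianProduct xs ys) ≡ length ys * length xs
length-product []       ys = sym (*-zeroʳ (length ys))
length-product (x ∷ xs) ys = begin
  length (map (x ,_) ys ++ cartesianProduct xs ys)          ≡⟨ List.length-++ (map (x ,_) ys) ⟩
  length (map (x ,_) ys) + length (cartesianProduct xs ys)  ≡⟨ cong₂ _+_ (List.length-map _ ys) (length-product xs ys) ⟩
  length ys + length ys * length xs                         ≡⟨ *-suc (length ys) (length xs) ⟨
  length ys * suc (length xs)                               ∎
  where open ≡-Reasoning

Biword : ∀ n → List (Vec ℕ 3) → Vec ℕ n × Vec ℕ n → Set
Biword n Π (σ , i) = σ ∈ 𝔖-avoiding n Π × Compatible (Des σ) i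

-- A content preserving bijection from the biwords (σ, i) to the pairs of a semistandard tableau
-- of some shape μ and an element of R μ expands Q n Π with coefficients |R μ|.
schurExpansion : ∀ n Π (R : List ℕ → List B) → (∀ μ → Unique (R μ)) →
  (φ : Vec ℕ n × Vec ℕ n → Tableau × B) →
  (∀ {σ i} → Biword n Π (σ , i) → let (T , b) = φ (σ , i) in
     Semistandard T × Partition n (map length T) × b ∈ R (map length T) × concat T ↭ toList i) →
  (∀ {x y} → Biword n Π x → Biword n Π y → φ x ≡ φ y → x ≡ y) →
  (∀ {T b} → Semistandard T → Partition n (map length T) → b ∈ R (map length T) →
     ∃[ x ] Biword n Π x × φ x ≡ (T , b)) →
  ∀ m → Q n Π m ≡ Σ[ partitions n ] (λ μ → (+ length (R μ)) · s μ) m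
schurExpansion {B = B} n Π R R! φ into inj surj m = begin
  Q n Π m                          ≡⟨ sum-length _ row (𝔖-avoiding n Π) (λ σ → cong +_ (sym (List.length-map (σ ,_) (seqs σ)))) ⟩
  + length (concatMap row (𝔖-avoiding n Π)) ≡⟨ cong +_ (length-bijection lhs! rhs! φ to inj′ from) ⟩
  + length (concatMap pairs (partitions n)) ≡⟨ sum-length _ pairs (partitions n) lemma ⟨
  Σ[ partitions n ] (λ μ → (+ length (R μ)) · s μ) m ∎
  where
  open ≡-Reasoning

  fits? : ∀ σ i → Dec (Compatible (Des σ) i × toList i ↭ m)
  fits? σ i = compatible? (Des σ) i ×-dec (toList i ↭? m)

  seqs : Vec ℕ n → List (Vec ℕ n)
  seqs σ = filter (fits? σ) (words (variables m) n)

  -- Pairing each sequence with its permutation keeps the blocks of different permutations disjoint.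
  row : Vec ℕ n → List (Vec ℕ n × Vec ℕ n)
  row σ = map (σ ,_) (seqs σ)

  pairs : List ℕ → List (Tableau × B)
  pairs μ = cartesianProduct (tableaux μ m) (R μ)

  lemma : ∀ μ → ((+ length (R μ)) · s μ) m ≡ + length (pairs μ)
  lemma μ = ≡-trans (sym (ℤ.pos-* (length (R μ)) (length (tableaux μ m))))
                    (cong +_ (sym (length-product (tableaux μ m) (R μ))))

  row⁻ : ∀ {σ x} → x ∈ row σ → proj₁ x ≡ σ × Compatible (Des σ) (proj₂ x) × toList (proj₂ x) ↭ m
  row⁻ {σ} p with ∈-map⁻ (σ ,_) p
  ... | i , q , refl = refl , proj₂ (∈-filter⁻ (fits? σ) {xs = words (variables m) n} q)

  biword⁻ : ∀ {x} → x ∈ concatMap row (𝔖-avoiding n Π) → Biword n Π x × toList (proj₂ x) ↭ m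
  biword⁻ p = let σ , σ∈ , q = ∈-concatMap-witness row (𝔖-avoiding n Π) p in helper σ∈ (row⁻ q)
    where
    helper : ∀ {σ x} → σ ∈ 𝔖-avoiding n Π →
             proj₁ x ≡ σ × Compatible (Des σ) (proj₂ x) × toList (proj₂ x) ↭ m →
             Biword n Π x × toList (proj₂ x) ↭ m
    helper σ∈ (refl , c , e) = (σ∈ , c) , e

  biword⁺ : ∀ {x} → Biword n Π x → toList (proj₂ x) ↭ m → x ∈ concatMap row (𝔖-avoiding n Π)
  biword⁺ {σ , i} (σ∈ , c) e = ∈-concatMap row σ∈ (∈-map⁺ (σ ,_)
    (∈-filter⁺ (fits? σ) (∈-words⁺ (All.tabulate λ x∈ → ∈-variables⁺ (↭.∈-resp-↭ e x∈))) (c , e)))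

  lhs! : Unique (concatMap row (𝔖-avoiding n Π))
  lhs! = concatMap-unique row (Unique.filter⁺ (avoids? Π) (𝔖-unique n))
    (λ σ → map-unique (σ ,_) (λ _ _ e → cong proj₂ e) (Unique.filter⁺ (fits? σ) (words-unique n (variables-unique m))))
    (λ p q → ≡-trans (sym (proj₁ (row⁻ p))) (proj₁ (row⁻ q)))

  pairs⁻ : ∀ {μ T b} → (T , b) ∈ pairs μ →
           Semistandard T × concat T ↭ m × map length T ≡ μ × b ∈ R μ
  pairs⁻ {μ} p =
    let q , r = ∈-cartesianProduct⁻ (tableaux μ m) (R μ) p
        ss , c , e = ∈-tableaux⁻ {μ} q
    in ss , c , e , r

  rhs! : Unique (concatMap pairs (partitions n))
  rhs! = concatMap-unique pairs (partitions-unique n)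
    (λ μ → Unique.cartesianProduct⁺ (tableaux-unique μ m) (R! μ)) disj
    where
    disj : ∀ {μ ν x} → x ∈ pairs μ → x ∈ pairs ν → μ ≡ ν
    disj {μ} {ν} p q with pairs⁻ {μ} p | pairs⁻ {ν} q
    ... | _ , _ , e , _ | _ , _ , e′ , _ = ≡-trans (sym e) e′

  to : ∀ {x} → x ∈ concatMap row (𝔖-avoiding n Π) → φ x ∈ concatMap pairs (partitions n)
  to p =
    let bw , e = biword⁻ p
        ss , pt , b∈ , c = into bw
    in ∈-concatMap pairs (∈-partitions⁺ pt) (∈-cartesianProduct⁺ (∈-tableaux⁺ ss (↭-trans c e)) b∈)

  inj′ : ∀ {x y} → x ∈ concatMap row (𝔖-avoiding n Π) → y ∈ concatMap row (𝔖-avoiding n Π) →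
         φ x ≡ φ y → x ≡ y
  inj′ p q = inj (proj₁ (biword⁻ p)) (proj₁ (biword⁻ q))

  from : ∀ {y} → y ∈ concatMap pairs (partitions n) → ∃[ x ] x ∈ concatMap row (𝔖-avoiding n Π) × φ x ≡ y
  from p =
    let μ , μ∈ , q = ∈-concatMap-witness pairs (partitions n) p
    in helper (∈-partitions⁻ μ∈) (pairs⁻ {μ} q)
    where
    helper : ∀ {μ T b} → Partition n μ → Semistandard T × concat T ↭ m × map length T ≡ μ × b ∈ R μ →
             ∃[ x ] x ∈ concatMap row (𝔖-avoiding n Π) × φ x ≡ (T , b)
    helper pt (ss , c , refl , b∈) =
      let x , bw , e = surj ss pt b∈
          -- The preimage has content m because φ keeps the content.
          _ , _ , _ , c′ = into bw
      in x , biword⁺ bw (↭-trans (↭-sym c′) (subst (λ y → concat (proj₁ y) ↭ m) (sym e) c)) , e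

-- Semistandard tableaux and row insertion

Sorted : List ℕ → Set
Sorted = AllPairs _≤_

-- Unlike `ColumnStrict`, whose `zip` truncates, this also makes the lower row no longer than the
-- upper one. The shape condition is thus part of the tableau and survives insertion together with
-- it.
data Dominates : List ℕ → List ℕ → Set where
  []  : ∀ {r} → Dominates r []
  _∷_ : ∀ {a b r l} → a < b → Dominates r l → Dominates (a ∷ r) (b ∷ l)

record SSYT (T : Tableau) : Set where
  constructor ssyt
  field
    rows     : All Sorted T
    columns  : Linked Dominates T
    nonempty : All (λ r → 1 ≤ length r) T

open SSYT

dominates⇒columnStrict : ∀ {r l} → Dominates r l → ColumnStrict r l
dominates⇒columnStrict {[]}    []      = []
dominates⇒columnStrict {_ ∷ _} []      = []
dominates⇒columnStrict         (p ∷ d) = p ∷ dominates⇒columnStrict d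

dominates⇒length : ∀ {r l} → Dominates r l → length l ≤ length r
dominates⇒length []      = z≤n
dominates⇒length (p ∷ d) = s≤s (dominates⇒length d)

columnStrict⇒dominates : ∀ {r l} → length l ≤ length r → ColumnStrict r l → Dominates r l
columnStrict⇒dominates {l = []}           _       _       = []
columnStrict⇒dominates {_ ∷ _} {_ ∷ _} (s≤s p) (q ∷ c) = q ∷ columnStrict⇒dominates p c

length-concat : (T : List (List A)) → length (concat T) ≡ sum (map length T)
length-concat []      = refl
length-concat (r ∷ T) = ≡-trans (List.length-++ r) (cong (λ k → length r + k) (length-concat T))

ssyt⇒semistandard : ∀ {T} → SSYT T → Semistandard T
ssyt⇒semistandard t =
  All.map Linked.AllPairs⇒Linked (rows t) , Linked.map dominates⇒columnStrict (columns t)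

ssyt⇒partition : ∀ {T} → SSYT T → Partition (length (concat T)) (map length T)
ssyt⇒partition {T} t = partition
  (Linked.map⁺ (Linked.map dominates⇒length (columns t))) (sym (length-concat T)) (All.map⁺ (nonempty t))

semistandard⇒ssyt : ∀ {n T} → Semistandard T → Partition n (map length T) → SSYT T
semistandard⇒ssyt {n} (r , c) (partition d _ p) =
  ssyt (All.map (Linked.Linked⇒AllPairs ≤-trans) r) (columns′ d c) (All.map⁻ p)
  where
  columns′ : ∀ {T} → Linked _≥_ (map length T) → Linked ColumnStrict T → Linked Dominates T
  columns′ {[]}        _       _       = []
  columns′ {_ ∷ []}    _       _       = [-]
  columns′ {_ ∷ _ ∷ _} (g ∷ d) (x ∷ c) = columnStrict⇒dominates g x ∷ columns′ d c

-- Insertion is given by relations, so that reversing it means producing a derivation; uniqueness of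
-- the result is proved separately.
data Append (x : ℕ) : List ℕ → List ℕ → Set where
  []  : Append x [] [ x ]
  _∷_ : ∀ {a r r′} → a ≤ x → Append x r r′ → Append x (a ∷ r) (a ∷ r′)

data Bump (x : ℕ) : List ℕ → ℕ → List ℕ → Set where
  here  : ∀ {y r} → x < y → Bump x (y ∷ r) y (x ∷ r)
  there : ∀ {a r y r′} → a ≤ x → Bump x r y r′ → Bump x (a ∷ r) y (a ∷ r′)

-- Insert x T k T′: row insertion of x into T gives T′, with the new box in row k.
data Insert : ℕ → Tableau → ℕ → Tableau → Set where
  new    : ∀ {x} → Insert x [] 0 [ [ x ] ]
  append : ∀ {x r r′ T} → Append x r r′ → Insert x (r ∷ T) 0 (r′ ∷ T)
  bump   : ∀ {x r y r′ T k T′} → Bump x r y r′ → Insert y T k T′ → Insert x (r ∷ T) (suc k) (r′ ∷ T′)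

-- The tail is inserted before the head, so the word is read from right to left. The last index
-- lists the rows of the new boxes, the most recent first.
data RSK : List ℕ → Tableau → List ℕ → Set where
  []  : RSK [] [] []
  _∷_ : ∀ {w T q x k T′} → Insert x T k T′ → RSK w T q → RSK (x ∷ w) T′ (k ∷ q)

rowInsert : ∀ x r → ∃ (Append x r) ⊎ ∃₂ (Bump x r)
rowInsert x []      = inj₁ (_ , [])
rowInsert x (a ∷ r) with x <? a | rowInsert x r
... | yes x<a | _                    = inj₂ (_ , _ , here x<a)
... | no x≮a  | inj₁ (_ , p)         = inj₁ (_ , ≮⇒≥ x≮a ∷ p)
... | no x≮a  | inj₂ (_ , _ , p)     = inj₂ (_ , _ , there (≮⇒≥ x≮a) p)

insert : ∀ x T → ∃₂ (Insert x T)
insert x []      = _ , _ , new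
insert x (r ∷ T) with rowInsert x r
... | inj₁ (_ , p)     = _ , _ , append p
... | inj₂ (y , _ , p) = let _ , _ , i = insert y T in _ , _ , bump p i

rsk : ∀ w → ∃₂ (RSK w)
rsk []      = _ , _ , []
rsk (x ∷ w) = let T , _ , p = rsk w ; _ , _ , i = insert x T in _ , _ , i ∷ p

append-functional : ∀ {x r r′ r″} → Append x r r′ → Append x r r″ → r′ ≡ r″
append-functional []      []      = refl
append-functional (_ ∷ p) (_ ∷ q) = cong (_ ∷_) (append-functional p q)

bump-functional : ∀ {x r y r′ z r″} → Bump x r y r′ → Bump x r z r″ → y ≡ z × r′ ≡ r″
bump-functional (here _)    (here _)    = refl , refl
bump-functional (here p)    (there q _) = ⊥-elim (<⇒≱ p q)
bump-functional (there q _) (here p)    = ⊥-elim (<⇒≱ p q)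
bump-functional (there _ p) (there _ q) = let e , e′ = bump-functional p q in e , cong (_ ∷_) e′

append-bump-⊥ : ∀ {x r r′ y r″} → Append x r r′ → ¬ Bump x r y r″
append-bump-⊥ (p ∷ _) (here q)    = <⇒≱ q p
append-bump-⊥ (_ ∷ p) (there _ q) = append-bump-⊥ p q

insert-functional : ∀ {x T k T′ l T″} → Insert x T k T′ → Insert x T l T″ → k ≡ l × T′ ≡ T″
insert-functional new        new        = refl , refl
insert-functional (append p) (append q) = refl , cong (_∷ _) (append-functional p q)
insert-functional (append p) (bump q _) = ⊥-elim (append-bump-⊥ p q)
insert-functional (bump q _) (append p) = ⊥-elim (append-bump-⊥ p q)
insert-functional (bump p i) (bump q j) with bump-functional p q
... | refl , refl with insert-functional i j
... | refl , refl = refl , refl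

rsk-functional : ∀ {w T q T′ q′} → RSK w T q → RSK w T′ q′ → T ≡ T′ × q ≡ q′
rsk-functional []      []      = refl , refl
rsk-functional (i ∷ p) (j ∷ q) with rsk-functional p q
... | refl , refl with insert-functional i j
... | refl , refl = refl , refl

-- The common effect of `Append` and `Bump` on the row, for arguments that do not ask whether an
-- entry was expelled.
data RowInsert (y : ℕ) : List ℕ → List ℕ → Set where
  end   : RowInsert y [] [ y ]
  here  : ∀ {b l} → y < b → RowInsert y (b ∷ l) (y ∷ l)
  there : ∀ {b l l′} → b ≤ y → RowInsert y l l′ → RowInsert y (b ∷ l) (b ∷ l′)

append⇒row : ∀ {x r r′} → Append x r r′ → RowInsert x r r′
append⇒row []      = end
append⇒row (p ∷ a) = there p (append⇒row a)

bump⇒row : ∀ {x r y r′} → Bump x r y r′ → RowInsert x r r′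
bump⇒row (here p)    = here p
bump⇒row (there p b) = there p (bump⇒row b)

row-All : ∀ {P : ℕ → Set} {x r r′} → RowInsert x r r′ → P x → All P r → All P r′
row-All end         px []       = px ∷ []
row-All (here _)    px (_ ∷ ps) = px ∷ ps
row-All (there _ i) px (p ∷ ps) = p ∷ row-All i px ps

row-sorted : ∀ {x r r′} → RowInsert x r r′ → Sorted r → Sorted r′
row-sorted end         []      = [] ∷ []
row-sorted (here p)    (q ∷ s) = All.map (≤-trans (<⇒≤ p)) q ∷ s
row-sorted (there p i) (q ∷ s) = row-All i p q ∷ row-sorted i s

row-nonempty : ∀ {x r r′} → RowInsert x r r′ → 1 ≤ length r′
row-nonempty end         = s≤s z≤n
row-nonempty (here _)    = s≤s z≤n
row-nonempty (there _ _) = s≤s z≤n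

bump< : ∀ {x r y r′} → Bump x r y r′ → x < y
bump< (here p)    = p
bump< (there _ b) = bump< b

append-dominates : ∀ {x r r′ l} → Append x r r′ → Dominates r l → Dominates r′ l
append-dominates _       []      = []
append-dominates (_ ∷ a) (q ∷ d) = q ∷ append-dominates a d

bump-dominatesʳ : ∀ {x r y r′ l} → Bump x r y r′ → Dominates r l → Dominates r′ l
bump-dominatesʳ _           []      = []
bump-dominatesʳ (here p)    (q ∷ d) = <-trans p q ∷ d
bump-dominatesʳ (there _ b) (q ∷ d) = q ∷ bump-dominatesʳ b d

-- The bumping path moves weakly to the left: below the old place of y there is a larger entry or
-- none, so y stops in that column or before it, where the upper row has an entry below y.
bump-dominates : ∀ {x r y r′ l l′} → Bump x r y r′ → RowInsert y l l′ → Dominates r l → Dominates r′ l′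
bump-dominates (here p)    end         []      = p ∷ []
bump-dominates (there p b) end         []      = ≤-<-trans p (bump< b) ∷ []
bump-dominates (here p)    (here q)    (_ ∷ d) = p ∷ d
bump-dominates (here p)    (there q _) (r ∷ d) = ⊥-elim (<⇒≱ r q)
bump-dominates (there p b) (here q)    (_ ∷ d) = ≤-<-trans p (bump< b) ∷ bump-dominatesʳ b d
bump-dominates (there p b) (there q i) (r ∷ d) = r ∷ bump-dominates b i d

insert-ssyt : ∀ {x T k T′} → SSYT T → Insert x T k T′ → SSYT T′
insert-ssyt _ new = ssyt (([] ∷ []) ∷ []) [-] (s≤s z≤n ∷ [])
insert-ssyt (ssyt (s ∷ ss) c (_ ∷ ne)) (append a) =
  ssyt (row-sorted (append⇒row a) s ∷ ss) (replace c) (row-nonempty (append⇒row a) ∷ ne)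
  where
  replace : ∀ {T} → Linked Dominates (_ ∷ T) → Linked Dominates (_ ∷ T)
  replace [-]     = [-]
  replace (d ∷ c) = append-dominates a d ∷ c
insert-ssyt (ssyt (s ∷ ss) c (_ ∷ ne)) (bump b i) =
  let ssyt ss′ c′ ne′ = insert-ssyt (ssyt ss (Linked.tail c) ne) i
  in ssyt (row-sorted (bump⇒row b) s ∷ ss′) (replace c i c′) (row-nonempty (bump⇒row b) ∷ ne′)
  where
  replace : ∀ {T k T′} → Linked Dominates (_ ∷ T) → Insert _ T k T′ → Linked Dominates T′ →
            Linked Dominates (_ ∷ T′)
  replace _       new        c′ = bump-dominates b end [] ∷ c′
  replace (d ∷ _) (append a) c′ = bump-dominates b (append⇒row a) d ∷ c′
  replace (d ∷ _) (bump b′ _) c′ = bump-dominates b (bump⇒row b′) d ∷ c′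

append-↭ : ∀ {x r r′} → Append x r r′ → r′ ↭ x ∷ r
append-↭ []      = ↭-refl
append-↭ (_ ∷ a) = ↭-trans (prep _ (append-↭ a)) (swap _ _ ↭-refl)

bump-↭ : ∀ {x r y r′} → Bump x r y r′ → y ∷ r′ ↭ x ∷ r
bump-↭ (here _)    = swap _ _ ↭-refl
bump-↭ (there _ b) = ↭-trans (swap _ _ ↭-refl) (↭-trans (prep _ (bump-↭ b)) (swap _ _ ↭-refl))

insert-↭ : ∀ {x T k T′} → Insert x T k T′ → concat T′ ↭ x ∷ concat T
insert-↭ new = ↭-refl
insert-↭ (append {T = T} a) = ↭.++⁺ʳ (concat T) (append-↭ a)
insert-↭ (bump {x} {r} {y} {r′} {T} {T′ = T′} b i) = begin
  r′ ++ concat T′      ↭⟨ ↭.++⁺ˡ r′ (insert-↭ i) ⟩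
  r′ ++ y ∷ concat T   ↭⟨ ↭.shift y r′ (concat T) ⟩
  (y ∷ r′) ++ concat T ↭⟨ ↭.++⁺ʳ (concat T) (bump-↭ b) ⟩
  (x ∷ r) ++ concat T  ∎
  where open PermutationReasoning

rsk-↭ : ∀ {w T q} → RSK w T q → concat T ↭ w
rsk-↭ []      = ↭-refl
rsk-↭ (i ∷ p) = ↭-trans (insert-↭ i) (prep _ (rsk-↭ p))

rsk-ssyt : ∀ {w T q} → RSK w T q → SSYT T
rsk-ssyt []      = ssyt [] [] []
rsk-ssyt (i ∷ p) = insert-ssyt (rsk-ssyt p) i

-- Out of range, addBox leaves the shape unchanged.
addBox : ℕ → List ℕ → List ℕ
addBox zero    []      = [ 1 ]
addBox zero    (l ∷ μ) = suc l ∷ μ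
addBox (suc k) []      = []
addBox (suc k) (l ∷ μ) = l ∷ addBox k μ

shape : List ℕ → List ℕ
shape = foldr addBox []

-- The row indices of a standard tableau, built box by box: every suffix has a partition as its
-- shape. The prescribed size excludes letters for which `addBox` is out of range.
data Lattice : List ℕ → Set where
  []  : Lattice []
  _∷_ : ∀ {k q} → Partition (suc (length q)) (shape (k ∷ q)) → Lattice q → Lattice (k ∷ q)

append-length : ∀ {x r r′} → Append x r r′ → length r′ ≡ suc (length r)
append-length a = ↭.↭-length (append-↭ a)

bump-length : ∀ {x r y r′} → Bump x r y r′ → length r′ ≡ length r
bump-length b = suc-injective (↭.↭-length (bump-↭ b))

insert-shape : ∀ {x T k T′} → Insert x T k T′ → map length T′ ≡ addBox k (map length T)
insert-shape new        = refl
insert-shape (append a) = cong (_∷ _) (append-length a)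
insert-shape (bump b i) = cong₂ _∷_ (bump-length b) (insert-shape i)

rsk-shape : ∀ {w T q} → RSK w T q → map length T ≡ shape q
rsk-shape []                = refl
rsk-shape (_∷_ {k = k} i p) = ≡-trans (insert-shape i) (cong (addBox k) (rsk-shape p))

rsk-length : ∀ {w T q} → RSK w T q → length q ≡ length w
rsk-length []      = refl
rsk-length (_ ∷ p) = cong suc (rsk-length p)

rsk-partition : ∀ {w T q} → RSK w T q → Partition (length q) (shape q)
rsk-partition p = subst₂ Partition
  (≡-trans (↭.↭-length (rsk-↭ p)) (sym (rsk-length p))) (rsk-shape p) (ssyt⇒partition (rsk-ssyt p))

rsk-lattice : ∀ {w T q} → RSK w T q → Lattice q
rsk-lattice []      = []
rsk-lattice (i ∷ p) = rsk-partition (i ∷ p) ∷ rsk-lattice p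

-- Reverse row insertion

append-injective : ∀ {x y r s t} → Append x r t → Append y s t → x ≡ y × r ≡ s
append-injective []        []        = refl , refl
append-injective []        (_ ∷ ())
append-injective (_ ∷ ())  []
append-injective (_ ∷ p)   (_ ∷ q)   = let e , e′ = append-injective p q in e , cong (_ ∷_) e′

bump-∈ : ∀ {x r y r′} → Bump x r y r′ → x ∈ r′
bump-∈ (here _)    = here refl
bump-∈ (there _ b) = there (bump-∈ b)

-- In the old row everything behind y is at least y, so the bump happened at the last entry of the
-- new row below y; the new row and y determine this place.
bump-injective : ∀ {x x′ r r′ y t} → Sorted r → Sorted r′ → Bump x r y t → Bump x′ r′ y t →
                 x ≡ x′ × r ≡ r′
bump-injective _       _       (here _)    (here _)    = refl , refl
bump-injective (p ∷ _) _       (here _)    (there _ b) = ⊥-elim (<⇒≱ (bump< b) (All.lookup p (bump-∈ b)))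
bump-injective _       (p ∷ _) (there _ b) (here _)    = ⊥-elim (<⇒≱ (bump< b) (All.lookup p (bump-∈ b)))
bump-injective (_ ∷ s) (_ ∷ t) (there _ b) (there _ c) =
  let e , e′ = bump-injective s t b c in e , cong (_ ∷_) e′

insert-injective : ∀ {x x′ T U k V} → SSYT T → SSYT U → Insert x T k V → Insert x′ U k V →
                   x ≡ x′ × T ≡ U
insert-injective _ _ new new = refl , refl
-- Without nonempty rows, opening a row could not be told apart from appending to an empty one.
insert-injective _ (ssyt _ _ (() ∷ _)) new (append [])
insert-injective (ssyt _ _ (() ∷ _)) _ (append []) new
insert-injective _ _ (append p) (append q) with append-injective p q
... | refl , refl = refl , refl
insert-injective (ssyt (s ∷ ss) c (_ ∷ ne)) (ssyt (s′ ∷ ss′) c′ (_ ∷ ne′)) (bump b i) (bump b′ j)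
  with insert-injective (ssyt ss (Linked.tail c) ne) (ssyt ss′ (Linked.tail c′) ne′) i j
... | refl , refl with bump-injective s s′ b b′
... | refl , refl = refl , refl

rsk-injective : ∀ {w w′ T q} → RSK w T q → RSK w′ T q → w ≡ w′
rsk-injective []      []      = refl
rsk-injective (i ∷ p) (j ∷ q) with insert-injective (rsk-ssyt p) (rsk-ssyt q) i j
... | refl , refl = cong (_ ∷_) (rsk-injective p q)

unappend : ∀ {l r′} → Sorted r′ → length r′ ≡ suc l → ∃₂ λ x r → Append x r r′ × length r ≡ l
unappend {r′ = x ∷ []} _ refl = x , [] , [] , refl
unappend {r′ = a ∷ r′@(_ ∷ _)} (p ∷ s) refl with unappend s refl
... | x , r , q , e = x , a ∷ r , All.lookup p (append-∈ q) ∷ q , cong suc e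
  where
  append-∈ : ∀ {x r r′} → Append x r r′ → x ∈ r′
  append-∈ []      = here refl
  append-∈ (_ ∷ q) = there (append-∈ q)

-- Reverse bumping expels the last entry below y; one exists because the first entry is below y.
-- Only this entry changes, and it becomes y, so a lower row stays dominated if all its entries
-- exceed y.
unbumpRow : ∀ {y a r′} → a < y → Sorted (a ∷ r′) → ∃₂ λ x r →
  Bump x r y (a ∷ r′) × Sorted r × (∀ {l} → All (y <_) l → Dominates (a ∷ r′) l → Dominates r l)
unbumpRow {y} {a} {[]} a<y _ =
  a , [ y ] , here a<y , [] ∷ [] , λ { [] [] → [] ; (q ∷ _) (_ ∷ d) → q ∷ d }
unbumpRow {y} {a} {c ∷ r′} a<y ((a≤c ∷ p) ∷ (q ∷ s)) with c <? y
... | no c≮y = a , _ , here a<y , (≮⇒≥ c≮y ∷ All.map (≤-trans (≮⇒≥ c≮y)) q) ∷ (q ∷ s)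
             , λ { [] [] → [] ; (q ∷ _) (_ ∷ d) → q ∷ d }
... | yes c<y with unbumpRow c<y (q ∷ s)
... | x , r , b , sr , f =
  x , a ∷ r , there (All.lookup (a≤c ∷ p) (bump-∈ b)) b
  , All.tail (↭.All-resp-↭ (bump-↭ b) (<⇒≤ a<y ∷ a≤c ∷ p)) ∷ sr
  , λ { [] [] → [] ; (_ ∷ q) (z ∷ d) → z ∷ f q d }

-- The entry above the place of y in the lower row is smaller than y, so the entry to expel lies
-- weakly to the right of that place. The columns before it are kept.
unbump : ∀ {y r′ l l′} → Sorted r′ → Sorted l → Dominates r′ l′ → RowInsert y l l′ →
         ∃₂ λ x r → Bump x r y r′ × Sorted r × Dominates r l
unbump sr _ (a<y ∷ _) end =
  let x , r , b , s , _ = unbumpRow a<y sr in x , r , b , s , []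
unbump sr (p ∷ _) (a<y ∷ d) (here y<b) =
  let x , r , b , s , f = unbumpRow a<y sr
  in x , r , b , s , f (y<b ∷ All.map (<-≤-trans y<b) p) (<-trans a<y y<b ∷ d)
unbump (p ∷ sr) (_ ∷ sl) (a<b ∷ d) (there b≤y i) =
  let x , r , b , s , d′ = unbump sr sl d i
  in x , _ ∷ r , there (All.lookup p (bump-∈ b)) b
     , All.tail (↭.All-resp-↭ (bump-↭ b) (<⇒≤ (<-≤-trans a<b b≤y) ∷ p)) ∷ s , a<b ∷ d′

unappend-dominates : ∀ {x r r′ l} → Append x r r′ → length l ≤ length r → Dominates r′ l → Dominates r l
unappend-dominates _       _       []      = []
unappend-dominates (_ ∷ a) (s≤s p) (q ∷ d) = q ∷ unappend-dominates a p d

unappend-sorted : ∀ {x r r′} → Append x r r′ → Sorted r′ → Sorted r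
unappend-sorted []      _       = []
unappend-sorted (_ ∷ a) (p ∷ s) = All.tail (↭.All-resp-↭ (append-↭ a) p) ∷ unappend-sorted a s

data AddBox : ℕ → List ℕ → List ℕ → Set where
  new   : AddBox 0 [] [ 1 ]
  here  : ∀ {l μ} → AddBox 0 (l ∷ μ) (suc l ∷ μ)
  there : ∀ {k l μ ν} → AddBox k μ ν → AddBox (suc k) (l ∷ μ) (l ∷ ν)

-- Out of range the size would not grow; the value of the function can therefore be replaced by a
-- derivation to recurse on.
addBox-grows : ∀ k μ → sum (addBox k μ) ≡ suc (sum μ) → AddBox k μ (addBox k μ)
addBox-grows zero    []      _ = new
addBox-grows zero    (l ∷ μ) _ = here
addBox-grows (suc k) []      ()
addBox-grows (suc k) (l ∷ μ) e =
  there (addBox-grows k μ (+-cancelˡ-≡ l _ _ (≡-trans e (sym (+-suc l (sum μ))))))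

linked-∷ : {R : A → A → Set} {x : A} {xs : List A} → (∀ {y ys} → xs ≡ y ∷ ys → R x y) → Linked R xs → Linked R (x ∷ xs)
linked-∷ {xs = []}    _ _ = [-]
linked-∷ {xs = _ ∷ _} f l = f refl ∷ l

linked-head : {R : A → A → Set} {x y : A} {xs : List A} → Linked R (x ∷ y ∷ xs) → R x y
linked-head (p ∷ _) = p

-- The last entry of row k can be removed because the smaller shape is again a partition. It is then
-- pushed up through the rows above, expelling one entry from each.
extract : ∀ {T′ k μ ν} → SSYT T′ → Linked _≥_ μ → All (1 ≤_) μ → AddBox k μ ν → map length T′ ≡ ν →
          ∃₂ λ x T → Insert x T k T′ × SSYT T × map length T ≡ μ
extract {T′ = (x ∷ []) ∷ []} _ _ _ new refl = x , [] , new , ssyt [] [] [] , refl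
extract {T′ = r′ ∷ T} (ssyt (s ∷ ss) c (_ ∷ ne)) d (1≤l ∷ _) here e
  with unappend s (List.∷-injectiveˡ e)
... | x , r , a , refl = x , r ∷ T , append a
  , ssyt (unappend-sorted a s ∷ ss)
         (linked-∷ (λ { {l} {U} refl → unappend-dominates a (shorter {l = l} {U} d (List.∷-injectiveʳ e)) (linked-head {R = Dominates} c) })
                   (Linked.tail c))
         (1≤l ∷ ne)
  , cong (_ ∷_) (List.∷-injectiveʳ e)
  where
  shorter : ∀ {n μ} {l : List ℕ} {T : Tableau} → Linked _≥_ (n ∷ μ) → map length (l ∷ T) ≡ μ → length l ≤ n
  shorter (p ∷ _) refl = p
extract {T′ = r′ ∷ T′} (ssyt (s ∷ ss) c (1≤r ∷ ne)) d (_ ∷ pos) (there b) e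
  with extract (ssyt ss (Linked.tail c) ne) (Linked.tail d) pos b (List.∷-injectiveʳ e)
... | y , T , i , t , refl =
  let x , U , j , u , e′ = finish i t c in x , U , j , u , ≡-trans e′ (cong (_∷ _) (List.∷-injectiveˡ e))
  where
  -- How the lower part received y says how its first row changed, and this change is what reverse
  -- bumping in r′ has to match.
  finish : ∀ {T T′ k} → Insert y T k T′ → SSYT T → Linked Dominates (r′ ∷ T′) →
           ∃₂ λ x U → Insert x U (suc k) (r′ ∷ T′) × SSYT U × map length U ≡ length r′ ∷ map length T
  glue : ∀ {x r T T′ k} → Bump x r y r′ → Sorted r → (∀ {l U} → T ≡ l ∷ U → Dominates r l) →
         Insert y T k T′ → SSYT T →
         ∃₂ λ x U → Insert x U (suc k) (r′ ∷ T′) × SSYT U × map length U ≡ length r′ ∷ map length T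
  glue {x} {r} {T} b sr d i (ssyt ss c ne) = x , r ∷ T , bump b i
    , ssyt (sr ∷ ss) (linked-∷ d c) (subst (1 ≤_) (bump-length b) 1≤r ∷ ne)
    , cong (_∷ _) (sym (bump-length b))
  finish new t (d ∷ _) =
    let _ , _ , b , sr , _ = unbump s [] d end in glue b sr (λ ()) new t
  finish i@(append a) t (d ∷ _) =
    let _ , _ , b , sr , d′ = unbump s (All.head (rows t)) d (append⇒row a)
    in glue b sr (λ { refl → d′ }) i t
  finish i@(bump a _) t (d ∷ _) =
    let _ , _ , b , sr , d′ = unbump s (All.head (rows t)) d (bump⇒row a)
    in glue b sr (λ { refl → d′ }) i t

lattice-partition : ∀ {q} → Lattice q → Partition (length q) (shape q)
lattice-partition []      = partition [] refl []
lattice-partition (p ∷ _) = p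

rsk-surjective : ∀ {q T} → Lattice q → SSYT T → map length T ≡ shape q → ∃[ w ] RSK w T q
rsk-surjective {[]}    {[]} [] _ _ = [] , []
rsk-surjective {k ∷ q} (p ∷ l) t e =
  let partition d z pos = lattice-partition l
      box = addBox-grows k (shape q) (≡-trans (Partition.size p) (cong suc (sym z)))
      x , _ , i , t′ , e′ = extract t d pos box e
      w , r = rsk-surjective l t′ e′
  in x ∷ w , i ∷ r

-- Sorting

sorted-unique : {R : A → A → Set} → (∀ {x y} → R x y → R y x → x ≡ y) →
                {xs ys : List A} → AllPairs R xs → AllPairs R ys → xs ↭ ys → xs ≡ ys
sorted-unique anti {[]}     {ys}     _ _ e = sym (↭.↭-empty-inv (↭-sym e))
sorted-unique anti {x ∷ xs} {[]}     _ _ e = ↭.↭-empty-inv e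
sorted-unique {R = R} anti {x ∷ xs} {y ∷ ys} (p ∷ s) (q ∷ t) e = conclude heads e
  where
  heads : x ≡ y
  heads with ↭.∈-resp-↭ e (here refl) | ↭.∈-resp-↭ (↭-sym e) (here refl)
  ... | here x≡y | _        = x≡y
  ... | there _  | here y≡x = sym y≡x
  ... | there x∈ | there y∈ = anti (All.lookup p y∈) (All.lookup q x∈)
  conclude : x ≡ y → x ∷ xs ↭ y ∷ ys → x ∷ xs ≡ y ∷ ys
  conclude refl e = cong (x ∷_) (sorted-unique anti s t (↭.drop-∷ e))

module InsertionSort {A : Set} {_≼_ : A → A → Set} (_≼?_ : ∀ x y → Dec (x ≼ y))
  (≼-trans : ∀ {x y z} → x ≼ y → y ≼ z → x ≼ z) (≼-total : ∀ {x y} → ¬ x ≼ y → y ≼ x) where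

  insertSorted : A → List A → List A
  insertSorted x []       = [ x ]
  insertSorted x (y ∷ ys) = if does (x ≼? y) then x ∷ y ∷ ys else y ∷ insertSorted x ys

  sort : List A → List A
  sort = foldr insertSorted []

  insertSorted-↭ : ∀ x ys → insertSorted x ys ↭ x ∷ ys
  insertSorted-↭ x []       = ↭-refl
  insertSorted-↭ x (y ∷ ys) with x ≼? y
  ... | yes _ = ↭-refl
  ... | no _  = ↭-trans (prep y (insertSorted-↭ x ys)) (swap y x ↭-refl)

  sort-↭ : ∀ xs → sort xs ↭ xs
  sort-↭ []       = ↭-refl
  sort-↭ (x ∷ xs) = ↭-trans (insertSorted-↭ x (sort xs)) (prep x (sort-↭ xs))

  insertSorted-sorted : ∀ x {ys} → AllPairs _≼_ ys → AllPairs _≼_ (insertSorted x ys)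
  insertSorted-sorted x []                  = [] ∷ []
  insertSorted-sorted x {y ∷ ys} (p ∷ s) with x ≼? y
  ... | yes x≼y = (x≼y ∷ All.map (≼-trans x≼y) p) ∷ p ∷ s
  ... | no x⋠y  = ↭.All-resp-↭ (↭-sym (insertSorted-↭ x ys)) (≼-total x⋠y ∷ p) ∷ insertSorted-sorted x s

  sort-sorted : ∀ xs → AllPairs _≼_ (sort xs)
  sort-sorted []       = []
  sort-sorted (x ∷ xs) = insertSorted-sorted x (sort-sorted xs)

-- Membership and comparisons suffice to locate the triple; this carries triples from one sorting of
-- the letters to another.
sorted-triple : {R : A → A → Set} → (∀ {x y} → R x y → ¬ R y x) → {L : List A} → AllPairs R L →
                ∀ {x y z} → x ∈ L → y ∈ L → z ∈ L → R x y → R y z → R x z → x ∷ y ∷ z ∷ [] ⊑ L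
sorted-triple {A = A} {R} asym s x∈ y∈ z∈ xy yz xz = three s x∈ y∈ z∈
  where
  irrefl : ∀ {x} → ¬ R x x
  irrefl r = asym r r
  one : ∀ {L : List A} {x} → x ∈ L → [ x ] ⊑ L
  one (here refl) = refl ∷ minimum _
  one (there p)   = _ ∷ʳ one p
  two : ∀ {L} → AllPairs R L → _ ∈ L → _ ∈ L → _ ⊑ L
  two (p ∷ s) (here refl) (here refl) = ⊥-elim (irrefl yz)
  two (p ∷ s) (here refl) (there q)   = refl ∷ one q
  two (p ∷ s) (there q)   (here refl) = ⊥-elim (asym yz (All.lookup p q))
  two (p ∷ s) (there q)   (there r)   = _ ∷ʳ two s q r
  three : ∀ {L} → AllPairs R L → _ ∈ L → _ ∈ L → _ ∈ L → _ ⊑ L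
  three (p ∷ s) (here refl) (here refl) _           = ⊥-elim (irrefl xy)
  three (p ∷ s) (here refl) (there _)   (here refl) = ⊥-elim (irrefl xz)
  three (p ∷ s) (here refl) (there q)   (there r)   = refl ∷ two s q r
  three (p ∷ s) (there q)   (here refl) _           = ⊥-elim (asym xy (All.lookup p q))
  three (p ∷ s) (there q)   (there r)   (here refl) = ⊥-elim (asym xz (All.lookup p q))
  three (p ∷ s) (there q)   (there r)   (there t)   = _ ∷ʳ three s q r t

⊑-AllPairs : {R : A → A → Set} {xs ys : List A} → xs ⊑ ys → AllPairs R ys → AllPairs R xs
⊑-AllPairs []         []      = []
⊑-AllPairs (_ ∷ʳ s)   (_ ∷ p) = ⊑-AllPairs s p
⊑-AllPairs (refl ∷ s) (q ∷ p) = ⊑.All-resp-⊆ s q ∷ ⊑-AllPairs s p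

⊑-map⁻ : (f : A → B) (L : List A) {xs : List B} → xs ⊑ map f L → ∃[ M ] M ⊑ L × xs ≡ map f M
⊑-map⁻ f []      []         = [] , [] , refl
⊑-map⁻ f (x ∷ L) (_ ∷ʳ s)   = let M , t , e = ⊑-map⁻ f L s in M , x ∷ʳ t , e
⊑-map⁻ f (x ∷ L) (refl ∷ s) = let M , t , e = ⊑-map⁻ f L s in x ∷ M , refl ∷ t , cong (f x ∷_) e

⊑-∈ : {xs ys : List A} → xs ⊑ ys → ∀ {x} → x ∈ xs → x ∈ ys
⊑-∈ (_ ∷ʳ s)   p         = there (⊑-∈ s p)
⊑-∈ (refl ∷ s) (here e)  = here e
⊑-∈ (refl ∷ s) (there p) = there (⊑-∈ s p)

-- Order isomorphism of triples

relabel : ℕ → ℕ → ℕ → ℕ → ℕ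
relabel lo mid hi 1 = lo
relabel lo mid hi 2 = mid
relabel lo mid hi _ = hi

relabel-< : ∀ {lo mid hi} → lo < mid → mid < hi → ∀ {x y} → x ∈ [1⋯ 3 ] → y ∈ [1⋯ 3 ] →
            relabel lo mid hi x < relabel lo mid hi y ⇔ x < y
relabel-< {lo} {mid} {hi} l m p q = mk⇔ (to p q) (from p q)
  where
  to : ∀ {x y} → x ∈ [1⋯ 3 ] → y ∈ [1⋯ 3 ] → relabel lo mid hi x < relabel lo mid hi y → x < y
  to (here refl)                 (here refl)                 r = ⊥-elim (<-irrefl refl r)
  to (here refl)                 (there (here refl))         r = s≤s (s≤s z≤n)
  to (here refl)                 (there (there (here refl))) r = s≤s (s≤s z≤n)
  to (there (here refl))         (here refl)                 r = ⊥-elim (<-asym r l)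
  to (there (here refl))         (there (here refl))         r = ⊥-elim (<-irrefl refl r)
  to (there (here refl))         (there (there (here refl))) r = s≤s (s≤s (s≤s z≤n))
  to (there (there (here refl))) (here refl)                 r = ⊥-elim (<-asym r (<-trans l m))
  to (there (there (here refl))) (there (here refl))         r = ⊥-elim (<-asym r m)
  to (there (there (here refl))) (there (there (here refl))) r = ⊥-elim (<-irrefl refl r)
  from : ∀ {x y} → x ∈ [1⋯ 3 ] → y ∈ [1⋯ 3 ] → x < y → relabel lo mid hi x < relabel lo mid hi y
  from (here refl)                 (there (here refl))         _ = l
  from (here refl)                 (there (there (here refl))) _ = <-trans l m
  from (there (here refl))         (there (there (here refl))) _ = m
  from (here refl)                 (here refl)                 r = ⊥-elim (<-irrefl refl r)
  from (there (here refl))         (here refl)                 (s≤s ())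
  from (there (here refl))         (there (here refl))         r = ⊥-elim (<-irrefl refl r)
  from (there (there (here refl))) (here refl)                 (s≤s ())
  from (there (there (here refl))) (there (here refl))         (s≤s (s≤s ()))
  from (there (there (here refl))) (there (there (here refl))) r = ⊥-elim (<-irrefl refl r)

orderIsomorphic⁺ : ∀ {lo mid hi} → lo < mid → mid < hi → ∀ π → π ∈ 𝔖 3 →
                   OrderIsomorphic (Vec.map (relabel lo mid hi) π) π
orderIsomorphic⁺ {lo} {mid} {hi} l m π π∈ i j =
  subst₂ (λ x y → x < y ⇔ lookup π i < lookup π j)
    (sym (Vec.lookup-map i _ π)) (sym (Vec.lookup-map j _ π)) (relabel-< l m (entry i) (entry j))
  where
  lookup-∈ : ∀ {n} (v : Vec ℕ n) k → All (_∈ [1⋯ 3 ]) (toList v) → lookup v k ∈ [1⋯ 3 ]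
  lookup-∈ (_ ∷ _) zero    (p ∷ _) = p
  lookup-∈ (_ ∷ v) (suc k) (_ ∷ q) = lookup-∈ v k q
  entry : ∀ k → lookup π k ∈ [1⋯ 3 ]
  entry k = lookup-∈ π k (proj₁ (∈-𝔖⁻ π∈))

private
  pattern 0f = zero
  pattern 1f = suc zero
  pattern 2f = suc (suc zero)

contains123⁺ : ∀ {n} {σ : Vec ℕ n} {a b c} → a ∷ b ∷ c ∷ [] ⊑ toList σ → a < b → b < c → Contains σ p123
-- The last argument finds the pattern in `𝔖 3`, which is listed lexicographically: 123, 132, 213,
-- 231, 312, 321.
contains123⁺ s p q = _ , s , orderIsomorphic⁺ p q p123 (here refl)

contains123⁻ : ∀ {n} {σ : Vec ℕ n} → Contains σ p123 → ∃₂ λ a b → ∃[ c ] a ∷ b ∷ c ∷ [] ⊑ toList σ × a < b × b < c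
contains123⁻ (a ∷ b ∷ c ∷ [] , s , o) =
  a , b , c , s , Equivalence.from (o 0f 1f) (s≤s (s≤s z≤n)) , Equivalence.from (o 1f 2f) (s≤s (s≤s (s≤s z≤n)))

contains132⁺ : ∀ {n} {σ : Vec ℕ n} {a b c} → a ∷ b ∷ c ∷ [] ⊑ toList σ → a < c → c < b → Contains σ p132
contains132⁺ s p q = _ , s , orderIsomorphic⁺ p q p132 (there (here refl))

contains132⁻ : ∀ {n} {σ : Vec ℕ n} → Contains σ p132 → ∃₂ λ a b → ∃[ c ] a ∷ b ∷ c ∷ [] ⊑ toList σ × a < c × c < b
contains132⁻ (a ∷ b ∷ c ∷ [] , s , o) =
  a , b , c , s , Equivalence.from (o 0f 2f) (s≤s (s≤s z≤n)) , Equivalence.from (o 2f 1f) (s≤s (s≤s (s≤s z≤n)))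

contains213⁺ : ∀ {n} {σ : Vec ℕ n} {a b c} → a ∷ b ∷ c ∷ [] ⊑ toList σ → b < a → a < c → Contains σ p213
contains213⁺ s p q = _ , s , orderIsomorphic⁺ p q p213 (there (there (here refl)))

contains213⁻ : ∀ {n} {σ : Vec ℕ n} → Contains σ p213 → ∃₂ λ a b → ∃[ c ] a ∷ b ∷ c ∷ [] ⊑ toList σ × b < a × a < c
contains213⁻ (a ∷ b ∷ c ∷ [] , s , o) =
  a , b , c , s , Equivalence.from (o 1f 0f) (s≤s (s≤s z≤n)) , Equivalence.from (o 0f 2f) (s≤s (s≤s (s≤s z≤n)))

contains231⁺ : ∀ {n} {σ : Vec ℕ n} {a b c} → a ∷ b ∷ c ∷ [] ⊑ toList σ → c < a → a < b → Contains σ p231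
contains231⁺ s p q = _ , s , orderIsomorphic⁺ p q p231 (there (there (there (here refl))))

contains231⁻ : ∀ {n} {σ : Vec ℕ n} → Contains σ p231 → ∃₂ λ a b → ∃[ c ] a ∷ b ∷ c ∷ [] ⊑ toList σ × c < a × a < b
contains231⁻ (a ∷ b ∷ c ∷ [] , s , o) =
  a , b , c , s , Equivalence.from (o 2f 0f) (s≤s (s≤s z≤n)) , Equivalence.from (o 0f 1f) (s≤s (s≤s (s≤s z≤n)))

contains312⁺ : ∀ {n} {σ : Vec ℕ n} {a b c} → a ∷ b ∷ c ∷ [] ⊑ toList σ → b < c → c < a → Contains σ p312
contains312⁺ s p q = _ , s , orderIsomorphic⁺ p q p312 (there (there (there (there (here refl)))))

contains312⁻ : ∀ {n} {σ : Vec ℕ n} → Contains σ p312 → ∃₂ λ a b → ∃[ c ] a ∷ b ∷ c ∷ [] ⊑ toList σ × b < c × c < a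
contains312⁻ (a ∷ b ∷ c ∷ [] , s , o) =
  a , b , c , s , Equivalence.from (o 1f 2f) (s≤s (s≤s z≤n)) , Equivalence.from (o 2f 0f) (s≤s (s≤s (s≤s z≤n)))

contains321⁺ : ∀ {n} {σ : Vec ℕ n} {a b c} → a ∷ b ∷ c ∷ [] ⊑ toList σ → c < b → b < a → Contains σ p321
contains321⁺ s p q = _ , s , orderIsomorphic⁺ p q p321 (there (there (there (there (there (here refl))))))

contains321⁻ : ∀ {n} {σ : Vec ℕ n} → Contains σ p321 → ∃₂ λ a b → ∃[ c ] a ∷ b ∷ c ∷ [] ⊑ toList σ × c < b × b < a
contains321⁻ (a ∷ b ∷ c ∷ [] , s , o) =
  a , b , c , s , Equivalence.from (o 2f 1f) (s≤s (s≤s z≤n)) , Equivalence.from (o 1f 0f) (s≤s (s≤s (s≤s z≤n)))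

-- Biwords and words

Letter : Set
Letter = ℕ × ℕ

-- A letter is an entry of σ with the index under it. Sorting by index, and by entry among equal
-- indices, recovers the biword, since σ has no descent inside a block of equal indices.
_≼_ : Letter → Letter → Set
(a , x) ≼ (b , y) = x < y ⊎ (x ≡ y × a ≤ b)

_≼?_ : ∀ p q → Dec (p ≼ q)
(a , x) ≼? (b , y) = (x <? y) ⊎-dec ((x ≟ y) ×-dec (a ≤? b))

≼-trans : ∀ {p q r} → p ≼ q → q ≼ r → p ≼ r
≼-trans (inj₁ p)          (inj₁ q)          = inj₁ (<-trans p q)
≼-trans (inj₁ p)          (inj₂ (refl , _)) = inj₁ p
≼-trans (inj₂ (refl , _)) (inj₁ q)          = inj₁ q
≼-trans (inj₂ (refl , p)) (inj₂ (refl , q)) = inj₂ (refl , ≤-trans p q)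

≼-total : ∀ {p q} → ¬ p ≼ q → q ≼ p
≼-total {a , x} {b , y} n with <-cmp x y
... | tri< x<y _ _  = ⊥-elim (n (inj₁ x<y))
... | tri> _ _ y<x  = inj₁ y<x
... | tri≈ _ refl _ = inj₂ (refl , [ (λ p → ⊥-elim (n (inj₂ (refl , p)))) , id ]′ (≤-total a b))

≼-antisym : ∀ {p q} → p ≼ q → q ≼ p → p ≡ q
≼-antisym (inj₁ p)          (inj₁ q)          = ⊥-elim (<-asym p q)
≼-antisym (inj₁ p)          (inj₂ (refl , _)) = ⊥-elim (<-irrefl refl p)
≼-antisym (inj₂ (refl , _)) (inj₁ q)          = ⊥-elim (<-irrefl refl q)
≼-antisym (inj₂ (refl , p)) (inj₂ (_ , q))    = cong (_, _) (≤-antisym p q)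

-- Decreasing in the entry of σ: the word shows the indices of n, ..., 1, and insertion from the
-- right meets them as 1, ..., n.
_≽_ : Letter → Letter → Set
(a , x) ≽ (b , y) = b ≤ a

_≽?_ : ∀ p q → Dec (p ≽ q)
(a , x) ≽? (b , y) = b ≤? a

module ByValue = InsertionSort _≼?_ (λ {x y z} → ≼-trans {x} {y} {z}) (λ {x y} → ≼-total {x} {y})
module ByPosition = InsertionSort _≽?_ (λ p q → ≤-trans q p) (λ n → <⇒≤ (≰⇒> n))

zip-proj₁ : ∀ {n} (u : Vec A n) (v : Vec B n) → map proj₁ (zip (toList u) (toList v)) ≡ toList u
zip-proj₁ []      []      = refl
zip-proj₁ (x ∷ u) (y ∷ v) = cong (x ∷_) (zip-proj₁ u v)

zip-proj₂ : ∀ {n} (u : Vec A n) (v : Vec B n) → map proj₂ (zip (toList u) (toList v)) ≡ toList v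
zip-proj₂ []      []      = refl
zip-proj₂ (x ∷ u) (y ∷ v) = cong (y ∷_) (zip-proj₂ u v)

zip-projs : (L : List (A × B)) → zip (map proj₁ L) (map proj₂ L) ≡ L
zip-projs []      = refl
zip-projs (p ∷ L) = cong (p ∷_) (zip-projs L)

fromLength : ∀ {n} (xs : List A) → length xs ≡ n → ∃[ v ] toList {n = n} v ≡ xs
fromLength xs refl = Vec.fromList xs , Vec.toList∘fromList xs

letters : ∀ {n} → Vec ℕ n × Vec ℕ n → List Letter
letters (σ , i) = zip (toList σ) (toList i)

letters-injective : ∀ {n} {b b′ : Vec ℕ n × Vec ℕ n} → letters b ≡ letters b′ → b ≡ b′
letters-injective {b = σ , i} {σ′ , i′} e = cong₂ _,_
  (toList-inj (≡-trans (sym (zip-proj₁ σ i)) (≡-trans (cong (map proj₁) e) (zip-proj₁ σ′ i′))))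
  (toList-inj (≡-trans (sym (zip-proj₂ σ i)) (≡-trans (cong (map proj₂) e) (zip-proj₂ σ′ i′))))

-- Neighbours with equal indices cannot form a descent, so they ascend; transitivity extends this to
-- all pairs.
compatible⇒sorted : ∀ {n} (σ i : Vec ℕ n) → Unique (toList σ) → Compatible (Des σ) i →
                    AllPairs _≼_ (letters (σ , i))
compatible⇒sorted σ i u c = Linked.Linked⇒AllPairs (λ {x y z} → ≼-trans {x} {y} {z}) (linked σ i u c)
  where
  linked : ∀ {n} (σ i : Vec ℕ n) → Unique (toList σ) → Compatible (Des σ) i →
           Linked _≼_ (letters (σ , i))
  linked []          []          _              _           = []
  linked (a ∷ [])    (x ∷ [])    _              _           = [-]
  linked (a ∷ b ∷ σ) (x ∷ y ∷ i) (_ ∷ u) (x≤y , f , c) = step ∷ linked (b ∷ σ) (y ∷ i) u c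
    where
    step : (a , x) ≼ (b , y)
    step with m≤n⇒m<n∨m≡n x≤y
    ... | inj₁ x<y  = inj₁ x<y
    ... | inj₂ refl with b <? a
    ...   | yes b<a = ⊥-elim (<-irrefl refl (f (dec-true (b <? a) b<a)))
    ...   | no b≮a  = inj₂ (refl , ≮⇒≥ b≮a)

sorted⇒compatible : ∀ {n} (σ i : Vec ℕ n) → AllPairs _≼_ (letters (σ , i)) → Compatible (Des σ) i
sorted⇒compatible []          []          _             = tt
sorted⇒compatible (a ∷ [])    (x ∷ [])    _             = tt
sorted⇒compatible (a ∷ b ∷ σ) (x ∷ y ∷ i) ((p ∷ _) ∷ s) = weak p , strict p , sorted⇒compatible (b ∷ σ) (y ∷ i) s
  where
  weak : (a , x) ≼ (b , y) → x ≤ y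
  weak (inj₁ x<y)        = <⇒≤ x<y
  weak (inj₂ (refl , _)) = ≤-refl
  strict : (a , x) ≼ (b , y) → does (b <? a) ≡ true → x < y
  strict (inj₁ x<y)          _ = x<y
  strict (inj₂ (refl , a≤b)) e with () ← ≡-trans (sym e) (dec-false (b <? a) (≤⇒≯ a≤b))

descending : ℕ → List ℕ
descending zero    = []
descending (suc n) = suc n ∷ descending n

∈-descending⁻ : ∀ {n x} → x ∈ descending n → 1 ≤ x × x ≤ n
∈-descending⁻ {suc n} (here refl) = s≤s z≤n , ≤-refl
∈-descending⁻ {suc n} (there p)   = let q , r = ∈-descending⁻ p in q , m≤n⇒m≤1+n r

∈-descending⁺ : ∀ {n x} → 1 ≤ x → x ≤ n → x ∈ descending n
∈-descending⁺ {zero}  (s≤s _) ()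
∈-descending⁺ {suc n} p q with m≤n⇒m<n∨m≡n q
... | inj₁ r    = there (∈-descending⁺ p (≤-pred r))
... | inj₂ refl = here refl

descending-sorted : ∀ n → AllPairs _>_ (descending n)
descending-sorted zero    = []
descending-sorted (suc n) = All.tabulate (λ p → s≤s (proj₂ (∈-descending⁻ p))) ∷ descending-sorted n

descending-length : ∀ n → length (descending n) ≡ n
descending-length zero    = refl
descending-length (suc n) = cong suc (descending-length n)

descending-unique : ∀ n → Unique (descending n)
descending-unique n = AllPairs.map (λ { p refl → <-irrefl refl p }) (descending-sorted n)

unique-full : ∀ {xs ys : List ℕ} → Unique xs → All (_∈ ys) xs → length xs ≡ length ys → Unique ys → xs ↭ ys
unique-full {[]}     {[]}     _ _ _ _ = ↭-refl
unique-full {x ∷ xs} {ys} (p ∷ u) (x∈ ∷ q) e v with ∈-∃++ x∈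
... | us , vs , refl = ↭-trans (prep x (unique-full u (All.tabulate inside) len (proj₂ (remove-mid us v))))
                               (↭-sym (↭.shift x us vs))
  where
  inside : ∀ {z} → z ∈ xs → z ∈ us ++ vs
  inside z∈ with ∈-++⁻ us (All.lookup q z∈)
  ... | inj₁ r           = ∈-++⁺ˡ r
  ... | inj₂ (here refl) = ⊥-elim (All.All¬⇒¬Any p z∈)
  ... | inj₂ (there r)   = ∈-++⁺ʳ us r
  len : length xs ≡ length (us ++ vs)
  len = suc-injective (≡-trans e (↭.↭-length (↭.shift x us vs)))

𝔖-descending : ∀ {n} {σ : Vec ℕ n} → σ ∈ 𝔖 n → toList σ ↭ descending n
𝔖-descending {n} {σ} σ∈ = let p , u = ∈-𝔖⁻ σ∈ in unique-full u
  (All.map (λ q → let r , t = ∈-[1⋯]⁻ q in ∈-descending⁺ r t) p)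
  (≡-trans (Vec.length-toList σ) (sym (descending-length n))) (descending-unique n)

descending-𝔖 : ∀ {n} {σ : Vec ℕ n} → toList σ ↭ descending n → σ ∈ 𝔖 n
descending-𝔖 {n} e = ∈-𝔖⁺
  (↭.All-resp-↭ (↭-sym e) (All.tabulate λ q → let r , t = ∈-descending⁻ q in ∈-[1⋯]⁺ r t))
  (unique-resp (↭-sym e) (descending-unique n))
  where
  unique-resp : ∀ {xs ys : List ℕ} → xs ↭ ys → Unique xs → Unique ys
  unique-resp refl          u                   = u
  unique-resp (prep x p)    (q ∷ u)             = ↭.All-resp-↭ p q ∷ unique-resp p u
  unique-resp (swap x y p)  ((q ∷ r) ∷ (t ∷ u)) =
    ((q ∘ sym) ∷ ↭.All-resp-↭ p t) ∷ ↭.All-resp-↭ p r ∷ unique-resp p u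
  unique-resp (trans p q)   u                   = unique-resp q (unique-resp p u)

toWord : ∀ {n} → Vec ℕ n × Vec ℕ n → List ℕ
toWord b = map proj₂ (ByPosition.sort (letters b))

module _ {n : ℕ} {b : Vec ℕ n × Vec ℕ n} (σ∈ : proj₁ b ∈ 𝔖 n) where

  private
    L = ByPosition.sort (letters b)

  sort-positions : map proj₁ L ≡ descending n
  sort-positions = sorted-unique (λ p q → ≤-antisym q p)
    (AllPairs.map⁺ (ByPosition.sort-sorted (letters b)))
    (AllPairs.map <⇒≤ (descending-sorted n))
    (↭-trans (↭.map⁺ proj₁ (ByPosition.sort-↭ (letters b)))
             (↭-trans (↭-reflexive (zip-proj₁ (proj₁ b) (proj₂ b))) (𝔖-descending σ∈)))

  toWord-letters : zip (descending n) (toWord b) ≡ L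
  toWord-letters = ≡-trans (cong (λ xs → zip xs (toWord b)) (sym sort-positions)) (zip-projs L)

toWord-↭ : ∀ {n} (b : Vec ℕ n × Vec ℕ n) → toWord b ↭ toList (proj₂ b)
toWord-↭ b = ↭-trans (↭.map⁺ proj₂ (ByPosition.sort-↭ (letters b)))
                     (↭-reflexive (zip-proj₂ (proj₁ b) (proj₂ b)))

-- Attaching n, ..., 1 to the word gives back the letters up to order, and the biword is their only
-- listing sorted by `_≼_`.
toWord-injective : ∀ {n} {σ i σ′ i′ : Vec ℕ n} → σ ∈ 𝔖 n → σ′ ∈ 𝔖 n →
                   Compatible (Des σ) i → Compatible (Des σ′) i′ →
                   toWord (σ , i) ≡ toWord (σ′ , i′) → (σ , i) ≡ (σ′ , i′)
toWord-injective {n} {σ} {i} {σ′} {i′} σ∈ σ′∈ c c′ e = letters-injective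
  (sorted-unique ≼-antisym
    (compatible⇒sorted σ i (proj₂ (∈-𝔖⁻ σ∈)) c) (compatible⇒sorted σ′ i′ (proj₂ (∈-𝔖⁻ σ′∈)) c′)
    (begin
      letters (σ , i)                      ↭⟨ ByPosition.sort-↭ (letters (σ , i)) ⟨
      ByPosition.sort (letters (σ , i))    ≡⟨ toWord-letters σ∈ ⟨
      zip (descending n) (toWord (σ , i))  ≡⟨ cong (zip (descending n)) e ⟩
      zip (descending n) (toWord (σ′ , i′)) ≡⟨ toWord-letters σ′∈ ⟩
      ByPosition.sort (letters (σ′ , i′))  ↭⟨ ByPosition.sort-↭ (letters (σ′ , i′)) ⟩
      letters (σ′ , i′)                    ∎))
  where open PermutationReasoning

toWord-surjective : ∀ {n} (w : List ℕ) → length w ≡ n →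
  ∃[ b ] proj₁ b ∈ 𝔖 n × Compatible (Des (proj₁ b)) (proj₂ b) × toWord {n} b ≡ w
toWord-surjective {n} w len with fromLength w len
... | v , refl with fromLength (descending n) (descending-length n)
... | d , d≡ = (σ , i) , σ∈ , sorted⇒compatible σ i (subst (AllPairs _≼_) (sym L≡) (ByValue.sort-sorted K)) , w≡
  where
  -- The inverse construction: attach n, ..., 1 to the word and sort by `_≼_`.
  K = zip (toList d) (toList v)
  L = ByValue.sort K

  lengthL : ∀ {C : Set} (f : Letter → C) {u : List C} → map f K ≡ u → length u ≡ n → length (map f L) ≡ n
  lengthL f e l = ≡-trans (↭.↭-length (↭.map⁺ f (ByValue.sort-↭ K))) (≡-trans (cong length e) l)

  σσ = fromLength (map proj₁ L) (lengthL proj₁ (zip-proj₁ d v) (Vec.length-toList d))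
  ii = fromLength (map proj₂ L) (lengthL proj₂ (zip-proj₂ d v) (Vec.length-toList v))
  σ = proj₁ σσ
  i = proj₁ ii

  L≡ : letters (σ , i) ≡ L
  L≡ = ≡-trans (cong₂ zip (proj₂ σσ) (proj₂ ii)) (zip-projs L)

  σ∈ : σ ∈ 𝔖 n
  σ∈ = descending-𝔖 (begin
    toList σ     ≡⟨ proj₂ σσ ⟩
    map proj₁ L  ↭⟨ ↭.map⁺ proj₁ (ByValue.sort-↭ K) ⟩
    map proj₁ K  ≡⟨ zip-proj₁ d v ⟩
    toList d     ≡⟨ d≡ ⟩
    descending n ∎)
    where open PermutationReasoning

  strict : ∀ {M} → map proj₁ M ≡ descending n → AllPairs (λ p q → proj₁ p > proj₁ q) M
  strict e = AllPairs.map⁻ (subst (AllPairs _>_) (sym e) (descending-sorted n))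

  w≡ : toWord (σ , i) ≡ toList v
  w≡ = ≡-trans (cong (map proj₂) (sorted-unique (λ p q → ⊥-elim (<-asym p q))
    (strict (sort-positions σ∈)) (strict (≡-trans (zip-proj₁ d v) d≡))
    (↭-trans (ByPosition.sort-↭ _) (↭-trans (↭-reflexive L≡) (ByValue.sort-↭ K))))) (zip-proj₂ d v)

-- The patterns 321 and 123 of σ as subsequences of the word

StrictlyIncreasing₃ WeaklyDecreasing₃ : List ℕ → Set
StrictlyIncreasing₃ w = ∃₂ λ x y → ∃[ z ] x ∷ y ∷ z ∷ [] ⊑ w × x < y × y < z
WeaklyDecreasing₃   w = ∃₂ λ x y → ∃[ z ] x ∷ y ∷ z ∷ [] ⊑ w × y ≤ x × z ≤ y

module _ {n : ℕ} {σ i : Vec ℕ n} (σ∈ : σ ∈ 𝔖 n) (c : Compatible (Des σ) i) where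

  private
    L = letters (σ , i)
    K = ByPosition.sort L

    Before After : Letter → Letter → Set
    Before p q = p ≼ q × proj₁ p ≢ proj₁ q
    After p q  = proj₁ p > proj₁ q

    L-sorted : AllPairs Before L
    L-sorted = AllPairs.zipWith id (compatible⇒sorted σ i u c , AllPairs.map⁻ (subst Unique (sym (zip-proj₁ σ i)) u))
      where u = proj₂ (∈-𝔖⁻ σ∈)

    Before-asym : ∀ {p q} → Before p q → ¬ Before q p
    Before-asym (p , ne) (q , _) = ne (cong proj₁ (≼-antisym p q))

    K-sorted : AllPairs After K
    K-sorted = AllPairs.map⁻ (subst (AllPairs _>_) (sym (sort-positions {b = σ , i} σ∈)) (descending-sorted n))

    L⇒K : ∀ {p} → p ∈ L → p ∈ K
    L⇒K = ↭.∈-resp-↭ (↭-sym (ByPosition.sort-↭ L))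

    K⇒L : ∀ {p} → p ∈ K → p ∈ L
    K⇒L = ↭.∈-resp-↭ (ByPosition.sort-↭ L)

    L-sublist : ∀ {xs} → xs ⊑ toList σ → ∃[ M ] M ⊑ L × xs ≡ map proj₁ M
    L-sublist s = ⊑-map⁻ proj₁ L (subst (_ ⊑_) (sym (zip-proj₁ σ i)) s)

    L-sublist⁻ : ∀ {M} → M ⊑ L → map proj₁ M ⊑ toList σ
    L-sublist⁻ s = subst (_ ⊑_) (zip-proj₁ σ i) (⊑.map⁺ proj₁ s)

    weak : ∀ {p q} → p ≼ q → proj₂ p ≤ proj₂ q
    weak (inj₁ x<y)        = <⇒≤ x<y
    weak (inj₂ (refl , _)) = ≤-refl

    strict : ∀ {p q} → p ≼ q → proj₁ q < proj₁ p → proj₂ p < proj₂ q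
    strict (inj₁ x<y)       _   = x<y
    strict (inj₂ (_ , a≤b)) b<a = ⊥-elim (<⇒≱ b<a a≤b)

    ascent : ∀ {p q} → proj₁ p < proj₁ q → proj₂ p ≤ proj₂ q → Before p q
    ascent a<b x≤y = [ inj₁ , (λ e → inj₂ (e , <⇒≤ a<b)) ]′ (m≤n⇒m<n∨m≡n x≤y) , <⇒≢ a<b

  -- Entries decrease along the word, so a 321 keeps its order there; at an inversion of σ equal
  -- indices are impossible, so the indices increase strictly.
  contains321⇒ : Contains σ p321 → StrictlyIncreasing₃ (toWord (σ , i))
  contains321⇒ h with contains321⁻ h
  ... | _ , _ , _ , s , c<b , b<a with L-sublist s
  ... | p ∷ q ∷ r ∷ [] , t , refl with ⊑-AllPairs t L-sorted
  ... | ((pq , _) ∷ _) ∷ ((qr , _) ∷ _) ∷ _ =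
    _ , _ , _
    , ⊑.map⁺ proj₂ (sorted-triple {R = After} (λ x y → <-asym x y) K-sorted
        (L⇒K (⊑-∈ t (here refl))) (L⇒K (⊑-∈ t (there (here refl)))) (L⇒K (⊑-∈ t (there (there (here refl)))))
        b<a c<b (<-trans c<b b<a))
    , strict {p} {q} pq b<a , strict {q} {r} qr c<b

  contains321⇐ : StrictlyIncreasing₃ (toWord (σ , i)) → Contains σ p321
  contains321⇐ (_ , _ , _ , s , x<y , y<z) with ⊑-map⁻ proj₂ K s
  ... | p ∷ q ∷ r ∷ [] , t , refl with ⊑-AllPairs t K-sorted
  ... | (a>b ∷ _) ∷ (b>c ∷ _) ∷ _ = contains321⁺
    (L-sublist⁻ (sorted-triple {R = Before} (λ {p} {q} → Before-asym {p} {q}) L-sorted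
      (K⇒L (⊑-∈ t (here refl))) (K⇒L (⊑-∈ t (there (here refl)))) (K⇒L (⊑-∈ t (there (there (here refl)))))
      (inj₁ x<y , >⇒≢ a>b) (inj₁ y<z , >⇒≢ b>c) (inj₁ (<-trans x<y y<z) , >⇒≢ (<-trans b>c a>b))))
    b>c a>b

  contains123⇒ : Contains σ p123 → WeaklyDecreasing₃ (toWord (σ , i))
  contains123⇒ h with contains123⁻ h
  ... | _ , _ , _ , s , a<b , b<c with L-sublist s
  ... | p ∷ q ∷ r ∷ [] , t , refl with ⊑-AllPairs t L-sorted
  ... | ((pq , _) ∷ _) ∷ ((qr , _) ∷ _) ∷ _ =
    _ , _ , _
    -- Entries decrease along the word, so the triple is met in reverse.
    , ⊑.map⁺ proj₂ (sorted-triple {R = After} (λ x y → <-asym x y) K-sorted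
        (L⇒K (⊑-∈ t (there (there (here refl))))) (L⇒K (⊑-∈ t (there (here refl)))) (L⇒K (⊑-∈ t (here refl)))
        b<c a<b (<-trans a<b b<c))
    , weak {q} {r} qr , weak {p} {q} pq

  contains123⇐ : WeaklyDecreasing₃ (toWord (σ , i)) → Contains σ p123
  contains123⇐ (_ , _ , _ , s , y≤x , z≤y) with ⊑-map⁻ proj₂ K s
  ... | r ∷ q ∷ p ∷ [] , t , refl with ⊑-AllPairs t K-sorted
  ... | (c>b ∷ _) ∷ (b>a ∷ _) ∷ _ = contains123⁺
    (L-sublist⁻ (sorted-triple {R = Before} (λ {p} {q} → Before-asym {p} {q}) L-sorted
      (K⇒L (⊑-∈ t (there (there (here refl))))) (K⇒L (⊑-∈ t (there (here refl)))) (K⇒L (⊑-∈ t (here refl)))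
      (ascent b>a z≤y) (ascent c>b y≤x) (ascent (<-trans b>a c>b) (≤-trans z≤y y≤x))))
    b>a c>b

-- The shape of the insertion tableau

firstRow : Tableau → List ℕ
firstRow []      = []
firstRow (r ∷ T) = r

-- Chain k t w: w has a weakly decreasing subsequence of length k with entries at most t.
data Chain : ℕ → ℕ → List ℕ → Set where
  done : ∀ {t w} → Chain 0 t w
  skip : ∀ {k t x w} → Chain k t w → Chain k t (x ∷ w)
  take : ∀ {k t x w} → x ≤ t → Chain k x w → Chain (suc k) t (x ∷ w)

-- For a sorted row: at least k entries are at most t. This is the counterpart of `Chain` for the
-- first row, and the proof that the two agree is Schensted's.
data Starts : ℕ → ℕ → List ℕ → Set where
  []  : ∀ {t r} → Starts 0 t r
  _∷_ : ∀ {k t a r} → a ≤ t → Starts k t r → Starts (suc k) t (a ∷ r)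

-- Together with the two converses below, this is the recursion of `Chain`: the k + 1 small entries
-- were there before, or x is at most t and extends k entries that are at most x.
starts-insert⁻ : ∀ {k t x r r′} → Sorted r → RowInsert x r r′ → Starts (suc k) t r′ →
                 Starts (suc k) t r ⊎ (x ≤ t × Starts k x r)
starts-insert⁻ _ end (x≤t ∷ []) = inj₂ (x≤t , [])
starts-insert⁻ _ (here _) (x≤t ∷ []) = inj₂ (x≤t , [])
starts-insert⁻ ((b≤c ∷ _) ∷ _) (here _) (x≤t ∷ (c≤t ∷ p)) = inj₁ (≤-trans b≤c c≤t ∷ (c≤t ∷ p))
starts-insert⁻ _ (there _ _) (b≤t ∷ []) = inj₁ (b≤t ∷ [])
starts-insert⁻ (_ ∷ s) (there b≤x i) (b≤t ∷ p@(_ ∷ _)) with starts-insert⁻ s i p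
... | inj₁ q         = inj₁ (b≤t ∷ q)
... | inj₂ (x≤t , q) = inj₂ (x≤t , b≤x ∷ q)

starts-insert⁺ˡ : ∀ {k t x r r′} → RowInsert x r r′ → Starts k t r → Starts k t r′
starts-insert⁺ˡ _           []        = []
starts-insert⁺ˡ (here x<b)  (b≤t ∷ p) = ≤-trans (<⇒≤ x<b) b≤t ∷ p
starts-insert⁺ˡ (there _ i) (b≤t ∷ p) = b≤t ∷ starts-insert⁺ˡ i p

starts-insert⁺ʳ : ∀ {k t x r r′} → RowInsert x r r′ → x ≤ t → Starts k x r → Starts (suc k) t r′
starts-insert⁺ʳ end           x≤t []        = x≤t ∷ []
starts-insert⁺ʳ (here _)      x≤t []        = x≤t ∷ []
starts-insert⁺ʳ (here x<b)    x≤t (b≤x ∷ _) = ⊥-elim (<⇒≱ x<b b≤x)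
starts-insert⁺ʳ (there b≤x i) x≤t []        = ≤-trans b≤x x≤t ∷ []
starts-insert⁺ʳ (there _ i)   x≤t (b≤x ∷ p) = ≤-trans b≤x x≤t ∷ starts-insert⁺ʳ i x≤t p

insert-firstRow : ∀ {x T k T′} → Insert x T k T′ → RowInsert x (firstRow T) (firstRow T′)
insert-firstRow new        = end
insert-firstRow (append a) = append⇒row a
insert-firstRow (bump b _) = bump⇒row b

firstRow-sorted : ∀ {T} → SSYT T → Sorted (firstRow T)
firstRow-sorted (ssyt [] _ _)      = []
firstRow-sorted (ssyt (s ∷ _) _ _) = s

starts⇒chain : ∀ {k t w T q} → RSK w T q → Starts k t (firstRow T) → Chain k t w
starts⇒chain {zero}  _       _ = done
starts⇒chain {suc k} (i ∷ p) h with starts-insert⁻ (firstRow-sorted (rsk-ssyt p)) (insert-firstRow i) h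
... | inj₁ h′         = skip (starts⇒chain p h′)
... | inj₂ (x≤t , h′) = take x≤t (starts⇒chain p h′)

chain⇒starts : ∀ {k t w T q} → RSK w T q → Chain k t w → Starts k t (firstRow T)
chain⇒starts _       done         = []
chain⇒starts (i ∷ p) (skip c)     = starts-insert⁺ˡ (insert-firstRow i) (chain⇒starts p c)
chain⇒starts (i ∷ p) (take x≤t c) = starts-insert⁺ʳ (insert-firstRow i) x≤t (chain⇒starts p c)

starts⇒length : ∀ {k t r} → Starts k t r → k ≤ length r
starts⇒length []      = z≤n
starts⇒length (_ ∷ p) = s≤s (starts⇒length p)

length⇒starts : ∀ {k t r} → All (_≤ t) r → k ≤ length r → Starts k t r
length⇒starts {zero}  _       _       = []
length⇒starts {suc k} (p ∷ q) (s≤s l) = p ∷ length⇒starts q l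

chain₃⇒decreasing : ∀ {t w} → Chain 3 t w → WeaklyDecreasing₃ w
chain₃⇒decreasing (skip c) = let x , y , z , s , p = chain₃⇒decreasing c in x , y , z , _ ∷ʳ s , p
chain₃⇒decreasing (take {x = x} _ c) = let y , z , s , p , q = two c in x , y , z , refl ∷ s , p , q
  where
  one : ∀ {t w} → Chain 1 t w → ∃[ z ] [ z ] ⊑ w × z ≤ t
  one (skip c)   = let z , s , p = one c in z , _ ∷ʳ s , p
  one (take p _) = _ , refl ∷ minimum _ , p
  two : ∀ {t w} → Chain 2 t w → ∃₂ λ y z → y ∷ z ∷ [] ⊑ w × y ≤ t × z ≤ y
  two (skip c)   = let y , z , s , p = two c in y , z , _ ∷ʳ s , p
  two (take p c) = let z , s , q = one c in _ , z , refl ∷ s , p , q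

decreasing⇒chain₃ : ∀ {w} → WeaklyDecreasing₃ w → ∃[ t ] Chain 3 t w
decreasing⇒chain₃ (x , y , z , s , p , q) = x , chain s (≤-refl ∷ p ∷ q ∷ [-])
  where
  chain : ∀ {w xs t} → xs ⊑ w → Linked _≥_ (t ∷ xs) → Chain (length xs) t w
  chain []         _       = done
  chain (_ ∷ʳ s)   l       = skip (chain s l)
  chain (refl ∷ s) (p ∷ l) = take p (chain s l)

-- Schensted's theorem for length three. The sum of the first row is taken as t, since every entry
-- is at most that.
decreasing⇔firstRow : ∀ {w T q} → RSK w T q → WeaklyDecreasing₃ w ⇔ 3 ≤ length (firstRow T)
decreasing⇔firstRow {T = T} p = mk⇔
  (λ d → starts⇒length (chain⇒starts p (proj₂ (decreasing⇒chain₃ d))))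
  (λ l → chain₃⇒decreasing (starts⇒chain p (length⇒starts (part≤sum (firstRow T)) l)))

append-All : ∀ {x r r′} → Append x r r′ → All (_≤ x) r
append-All []      = []
append-All (p ∷ a) = p ∷ append-All a

bumped-∈ : ∀ {x r y r′} → Bump x r y r′ → y ∈ r
bumped-∈ (here _)    = here refl
bumped-∈ (there _ b) = there (bumped-∈ b)

bump-least : ∀ {x r y r′ v} → Sorted r → Bump x r y r′ → v ∈ r → x < v → y ≤ v
bump-least _       (here _)    (here refl) _ = ≤-refl
bump-least (p ∷ _) (here _)    (there v∈)  _ = All.lookup p v∈
bump-least _       (there p _) (here refl) q = ⊥-elim (<⇒≱ q p)
bump-least (_ ∷ s) (there _ b) (there v∈)  q = bump-least s b v∈ q

bump-below : ∀ {x r y r′ v} → Sorted r → Bump x r y r′ → v ∈ r′ → v < y → v ≤ x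
bump-below _       (here _)    (here refl) _ = ≤-refl
bump-below (p ∷ _) (here _)    (there v∈)  q = ⊥-elim (<⇒≱ q (All.lookup p v∈))
bump-below _       (there p _) (here refl) _ = p
bump-below (_ ∷ s) (there _ b) (there v∈)  q = bump-below s b v∈ q

bump-keeps : ∀ {x r y r′ v} → Bump x r y r′ → v ∈ r → v ≢ y → v ∈ r′
bump-keeps (here _)    (here refl) ne = ⊥-elim (ne refl)
bump-keeps (here _)    (there v∈)  _  = there v∈
bump-keeps (there _ _) (here refl) _  = here refl
bump-keeps (there _ b) (there v∈)  ne = there (bump-keeps b v∈ ne)

-- Increasing subsequences of length three and the third row

IncreasingAbove : List ℕ → ℕ → Set
IncreasingAbove w x = ∃₂ λ y z → y ∷ z ∷ [] ⊑ w × x < y × y < z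

Exceeds : List ℕ → ℕ → Set
Exceeds w x = ∃[ z ] z ∈ w × x < z

∈-⊑ : {x : A} {xs : List A} → x ∈ xs → [ x ] ⊑ xs
∈-⊑ (here refl) = refl ∷ minimum _
∈-⊑ (there p)   = _ ∷ʳ ∈-⊑ p

increasingAbove-∷⁻ : ∀ {w x u} → IncreasingAbove (x ∷ w) u → IncreasingAbove w u ⊎ (u < x × Exceeds w x)
increasingAbove-∷⁻ (y , z , _ ∷ʳ s   , p)     = inj₁ (y , z , s , p)
increasingAbove-∷⁻ (y , z , refl ∷ s , p , q) = inj₂ (p , z , ⊑-∈ s (here refl) , q)

increasingAbove-∷⁺ : ∀ {w x u} → IncreasingAbove w u ⊎ (u < x × Exceeds w x) → IncreasingAbove (x ∷ w) u
increasingAbove-∷⁺ (inj₁ (y , z , s , p))      = y , z , _ ∷ʳ s , p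
increasingAbove-∷⁺ (inj₂ (p , z , z∈ , q)) = _ , z , refl ∷ ∈-⊑ z∈ , p , q

increasing₃-∷⁻ : ∀ {w x} → StrictlyIncreasing₃ (x ∷ w) → StrictlyIncreasing₃ w ⊎ IncreasingAbove w x
increasing₃-∷⁻ (x , y , z , _ ∷ʳ s   , p) = inj₁ (x , y , z , s , p)
increasing₃-∷⁻ (x , y , z , refl ∷ s , p) = inj₂ (y , z , s , p)

Blocked : List ℕ → List ℕ → ℕ → Set
Blocked r₁ r₂ x = ∃₂ λ y z → y ∈ r₁ × z ∈ r₂ × x < y × y < z

-- While the tableau has only the rows r₁ and r₂, a letter can be inserted without creating a third
-- row exactly if it does not start an increasing subsequence of length three.
Describes : List ℕ → List ℕ → List ℕ → Set
Describes w r₁ r₂ = ∀ u → IncreasingAbove w u ⇔ Blocked r₁ r₂ u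

module _ {w r₁ r₂ : List ℕ} {x : ℕ} (inv : Describes w r₁ r₂) (e : r₁ ++ r₂ ↭ w) (s₁ : Sorted r₁) where

  private
    above⇒ : Exceeds w x → Exceeds r₁ x ⊎ Exceeds r₂ x
    above⇒ (z , z∈ , p) with ∈-++⁻ r₁ (↭.∈-resp-↭ (↭-sym e) z∈)
    ... | inj₁ q = inj₁ (z , q , p)
    ... | inj₂ q = inj₂ (z , q , p)

  module _ {r₁′ : List ℕ} (a : Append x r₁ r₁′) where

    -- Nothing in r₁ exceeds an appended x, so the new blocking pairs are x with a larger entry of
    -- r₂.
    append-describes : Describes (x ∷ w) r₁′ r₂
    append-describes u = mk⇔ (to ∘ increasingAbove-∷⁻) (increasingAbove-∷⁺ ∘ from)
      where
      to : IncreasingAbove w u ⊎ (u < x × Exceeds w x) → Blocked r₁′ r₂ u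
      to (inj₁ h) =
        let y , z , y∈ , z∈ , p = Equivalence.to (inv u) h
        in y , z , ↭.∈-resp-↭ (↭-sym (append-↭ a)) (there y∈) , z∈ , p
      to (inj₂ (u<x , h)) with above⇒ h
      ... | inj₁ (z , z∈ , x<z) = ⊥-elim (<⇒≱ x<z (All.lookup (append-All a) z∈))
      ... | inj₂ (z , z∈ , x<z) = x , z , ↭.∈-resp-↭ (↭-sym (append-↭ a)) (here refl) , z∈ , u<x , x<z
      from : Blocked r₁′ r₂ u → IncreasingAbove w u ⊎ (u < x × Exceeds w x)
      from (y , z , y∈ , z∈ , p , q) with ↭.∈-resp-↭ (append-↭ a) y∈
      ... | here refl = inj₂ (p , z , ↭.∈-resp-↭ e (∈-++⁺ʳ r₁ z∈) , q)
      ... | there y∈′ = inj₁ (Equivalence.from (inv u) (y , z , y∈′ , z∈ , p , q))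

    append-free : ¬ IncreasingAbove w x
    append-free h = let y , z , y∈ , _ , p , _ = Equivalence.to (inv x) h
                    in <⇒≱ p (All.lookup (append-All a) y∈)

  module _ {y : ℕ} {r₁′ r₂′ : List ℕ} (b : Bump x r₁ y r₁′) (a : Append y r₂ r₂′) where

    private
      r₂≤y : ∀ {z} → z ∈ r₂ → z ≤ y
      r₂≤y = All.lookup (append-All a)

      r₂′≤y : ∀ {z} → z ∈ r₂′ → z ≤ y
      r₂′≤y z∈ with ↭.∈-resp-↭ (append-↭ a) z∈
      ... | here refl = ≤-refl
      ... | there q   = r₂≤y q

      y∈w : y ∈ w
      y∈w = ↭.∈-resp-↭ e (∈-++⁺ˡ (bumped-∈ b))

    -- Everything in r₂′ is at most y, so the lower entry of a blocking pair is below y and hence at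
    -- most x. The pair of x and y thus blocks whatever any pair blocks.
    bump-describes : Describes (x ∷ w) r₁′ r₂′
    bump-describes u = mk⇔ (to ∘ increasingAbove-∷⁻) (increasingAbove-∷⁺ ∘ from)
      where
      to : IncreasingAbove w u ⊎ (u < x × Exceeds w x) → Blocked r₁′ r₂′ u
      to (inj₁ h) =
        let v , z , v∈ , z∈ , p , q = Equivalence.to (inv u) h
        in v , z , bump-keeps b v∈ (<⇒≢ (<-≤-trans q (r₂≤y z∈)))
           , ↭.∈-resp-↭ (↭-sym (append-↭ a)) (there z∈) , p , q
      to (inj₂ (u<x , _)) =
        x , y , bump-∈ b , ↭.∈-resp-↭ (↭-sym (append-↭ a)) (here refl) , u<x , bump< b
      from : Blocked r₁′ r₂′ u → IncreasingAbove w u ⊎ (u < x × Exceeds w x)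
      from (v , z , v∈ , z∈ , u<v , v<z) =
        inj₂ (<-≤-trans u<v (bump-below s₁ b v∈ (<-≤-trans v<z (r₂′≤y z∈))) , y , y∈w , bump< b)

    -- An entry of r₁ above x is at least y, the least such entry, while r₂ has nothing above y.
    bump-free : ¬ IncreasingAbove w x
    bump-free h = let v , z , v∈ , z∈ , x<v , v<z = Equivalence.to (inv x) h
                  in <⇒≱ v<z (≤-trans (r₂≤y z∈) (bump-least s₁ b v∈ x<v))

secondRow : Tableau → List ℕ
secondRow []          = []
secondRow (_ ∷ [])    = []
secondRow (_ ∷ r ∷ _) = r

insert-rows : ∀ {x T k T′} → Insert x T k T′ → length T ≤ length T′
insert-rows new        = z≤n
insert-rows (append _) = ≤-refl
insert-rows (bump _ i) = s≤s (insert-rows i)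

increasing-rows : ∀ {w T q} → RSK w T q →
  (length T ≤ 2 × ¬ StrictlyIncreasing₃ w × Describes w (firstRow T) (secondRow T)) ⊎
  (3 ≤ length T × StrictlyIncreasing₃ w)
increasing-rows [] = inj₁ (z≤n , (λ { (_ , _ , _ , () , _) })
  , λ u → mk⇔ (λ { (_ , _ , () , _) }) (λ { (_ , _ , () , _) }))
increasing-rows (_∷_ {w} {T} {x = x} i p) with increasing-rows p
... | inj₂ (l , x , y , z , s , h) = inj₂ (≤-trans l (insert-rows i) , x , y , z , _ ∷ʳ s , h)
... | inj₁ (l , n , d) = step i l (rsk-ssyt p) d (rsk-↭ p)
  where
  free : ¬ IncreasingAbove w x → ¬ StrictlyIncreasing₃ (x ∷ w)
  free h = [ n , h ]′ ∘ increasing₃-∷⁻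
  step : ∀ {T k T′} → Insert x T k T′ → length T ≤ 2 → SSYT T → Describes w (firstRow T) (secondRow T) →
         concat T ↭ w →
         (length T′ ≤ 2 × ¬ StrictlyIncreasing₃ (x ∷ w) × Describes (x ∷ w) (firstRow T′) (secondRow T′)) ⊎
         (3 ≤ length T′ × StrictlyIncreasing₃ (x ∷ w))
  step new l t d e = inj₁ (s≤s z≤n , free (append-free d e [] []) , append-describes d e [] [])
  step {r ∷ []} (append a) l t d e = inj₁ (l , free (append-free d e sr a) , append-describes d e sr a)
    where sr = All.head (rows t)
  step {r ∷ r₂ ∷ []} (append a) l t d e = inj₁ (l , free (append-free d e′ sr a) , append-describes d e′ sr a)
    where sr = All.head (rows t) ; e′ = subst (λ v → r ++ v ↭ w) (List.++-identityʳ r₂) e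
  step {r ∷ []} (bump b new) l t d e = inj₁ (s≤s (s≤s z≤n) , free (bump-free d e sr b []) , bump-describes d e sr b [])
    where sr = All.head (rows t)
  step {r ∷ r₂ ∷ []} (bump b (append a)) l t d e =
    inj₁ (s≤s (s≤s z≤n) , free (bump-free d e′ sr b a) , bump-describes d e′ sr b a)
    where sr = All.head (rows t) ; e′ = subst (λ v → r ++ v ↭ w) (List.++-identityʳ r₂) e
  -- The two expelled entries form a blocking pair for x, and by the invariant x starts an
  -- increasing triple.
  step {r ∷ r₂ ∷ []} (bump b (bump b′ new)) l t d e =
    inj₂ (s≤s (s≤s (s≤s z≤n))
    , let y , z , s , h = Equivalence.from (d x) (_ , _ , bumped-∈ b , bumped-∈ b′ , bump< b , bump< b′)
      in x , y , z , refl ∷ s , h)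
  step {_ ∷ _ ∷ _ ∷ _} _ (s≤s (s≤s ())) t d e

increasing⇔rows : ∀ {w T q} → RSK w T q → StrictlyIncreasing₃ w ⇔ 3 ≤ length T
increasing⇔rows p with increasing-rows p
... | inj₁ (l , n , _) = mk⇔ (⊥-elim ∘ n) (λ l′ → ⊥-elim (<⇒≱ l′ l))
... | inj₂ (l , h)     = mk⇔ (λ _ → l) (λ _ → h)

-- Expansions from classes of words

partition? : ∀ n μ → Dec (Partition n μ)
partition? n μ = map′ (λ (d , e , p) → partition d e p) (λ (partition d e p) → d , e , p)
  (Linked.linked? _≥?_ μ ×-dec (sum μ ≟ n) ×-dec All.all? (1 ≤?_) μ)

lattice? : ∀ q → Dec (Lattice q)
lattice? []      = yes []
lattice? (k ∷ q) = map′ (λ (p , l) → p ∷ l) (λ { (p ∷ l) → p , l })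
  (partition? (suc (length q)) (shape (k ∷ q)) ×-dec lattice? q)

addBox-row : ∀ {k μ ν} → AddBox k μ ν → k ≤ length μ
addBox-row new       = z≤n
addBox-row here      = z≤n
addBox-row (there b) = s≤s (addBox-row b)

-- A bound on the letters makes the lattice words of length n a finite list, whose length can serve
-- as a coefficient.
lattice-bounded : ∀ {q n} → Lattice q → length q ≤ n → All (_∈ upTo n) q
lattice-bounded []      _ = []
lattice-bounded {k ∷ q} {n} (p ∷ l) h =
  ∈-upTo⁺ (≤-trans (s≤s k≤) h) ∷ lattice-bounded l (≤-trans (n≤1+n _) h)
  where
  open Partition (lattice-partition l)
  k≤ : k ≤ length q
  k≤ = ≤-trans (addBox-row (addBox-grows k (shape q) (≡-trans (Partition.size p) (cong suc (sym size)))))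
               (≤-trans (sum-length≤ positive) (≤-reflexive size))

latticeWords : ∀ n {Good : List ℕ → Set} → (∀ μ → Dec (Good μ)) → List ℕ → List (List ℕ)
latticeWords n good? μ =
  filter (λ q → lattice? q ×-dec List.≡-dec _≟_ (shape q) μ ×-dec good? μ) (map toList (words (upTo n) n))

module _ {n : ℕ} {Good : List ℕ → Set} (good? : ∀ μ → Dec (Good μ)) where

  private
    latticeWord? : ∀ μ q → Dec (Lattice q × shape q ≡ μ × Good μ)
    latticeWord? μ q = lattice? q ×-dec List.≡-dec _≟_ (shape q) μ ×-dec good? μ

  ∈-latticeWords⁺ : ∀ {μ q} → Lattice q → shape q ≡ μ → Good μ → length q ≡ n → q ∈ latticeWords n good? μ
  ∈-latticeWords⁺ {μ} {q} l e g refl =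
    ∈-filter⁺ (latticeWord? μ) (∈-listWords (lattice-bounded l ≤-refl)) (l , e , g)

  ∈-latticeWords⁻ : ∀ {μ q} → q ∈ latticeWords n good? μ → Lattice q × shape q ≡ μ × Good μ × length q ≡ n
  ∈-latticeWords⁻ {μ} q∈ =
    let p , l , e , g = ∈-filter⁻ (latticeWord? μ) {xs = map toList (words (upTo n) n)} q∈
        v , _ , e′ = ∈-map⁻ toList p
    in l , e , g , ≡-trans (cong length e′) (Vec.length-toList v)

  latticeWords-unique : ∀ μ → Unique (latticeWords n good? μ)
  latticeWords-unique μ = Unique.filter⁺ (latticeWord? μ)
    (map-unique toList (λ _ _ → toList-inj) (words-unique n (Unique.upTo⁺ n)))

  -- Applies when avoidance depends only on the shape of the insertion tableau. The coefficient of
  -- `s μ` is the number of standard tableaux of shape μ, in the guise of lattice words, or 0 if μ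
  -- is not good.
  wordExpansion : ∀ Π →
    (∀ {σ i : Vec ℕ n} {T q} → σ ∈ 𝔖 n → Compatible (Des σ) i → RSK (toWord (σ , i)) T q →
       Avoids Π σ ⇔ Good (map length T)) →
    ∀ m → Q n Π m ≡ Σ[ partitions n ] (λ μ → (+ length (latticeWords n good? μ)) · s μ) m
  wordExpansion Π avoids⇔good = schurExpansion n Π (latticeWords n good?) latticeWords-unique φ into inj surj
    where
    φ : Vec ℕ n × Vec ℕ n → Tableau × List ℕ
    φ b = let T , q , _ = rsk (toWord b) in T , q

    word-length : ∀ b → length (toWord b) ≡ n
    word-length b = ≡-trans (↭.↭-length (toWord-↭ b)) (Vec.length-toList (proj₂ b))

    biword⁻ : ∀ {σ i} → Biword n Π (σ , i) → σ ∈ 𝔖 n × Avoids Π σ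
    biword⁻ (σ∈ , _) = ∈-filter⁻ (avoids? Π) {xs = 𝔖 n} σ∈

    into : ∀ {σ i} → Biword n Π (σ , i) → let T , q = φ (σ , i) in
           Semistandard T × Partition n (map length T) × q ∈ latticeWords n good? (map length T) ×
           concat T ↭ toList i
    into {σ} {i} bw@(_ , c) =
      let T , q , p = rsk (toWord (σ , i))
          σ∈ , av = biword⁻ bw
          t = rsk-ssyt p
          e = ↭-trans (rsk-↭ p) (toWord-↭ (σ , i))
      in ssyt⇒semistandard t
       , subst (λ k → Partition k (map length T)) (≡-trans (↭.↭-length e) (Vec.length-toList i)) (ssyt⇒partition t)
       , ∈-latticeWords⁺ (rsk-lattice p) (sym (rsk-shape p)) (Equivalence.to (avoids⇔good σ∈ c p) av)
           (≡-trans (rsk-length p) (word-length (σ , i)))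
       , e

    inj : ∀ {x y} → Biword n Π x → Biword n Π y → φ x ≡ φ y → x ≡ y
    inj {x} {y} bx@(_ , cx) by@(_ , cy) e =
      let T , q , p = rsk (toWord x)
          U , r , p′ = rsk (toWord y)
      in toWord-injective (proj₁ (biword⁻ bx)) (proj₁ (biword⁻ by)) cx cy
           (rsk-injective p (subst₂ (RSK (toWord y)) (sym (cong proj₁ e)) (sym (cong proj₂ e)) p′))

    surj : ∀ {T q} → Semistandard T → Partition n (map length T) → q ∈ latticeWords n good? (map length T) →
           ∃[ x ] Biword n Π x × φ x ≡ (T , q)
    surj ss pt q∈ =
      let l , e , g , len = ∈-latticeWords⁻ q∈
          w , p = rsk-surjective l (semistandard⇒ssyt ss pt) (sym e)
          (σ , i) , σ∈ , c , w≡ = toWord-surjective w (≡-trans (sym (rsk-length p)) len)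
          p′ = subst (λ v → RSK v _ _) (sym w≡) p
          _ , _ , p″ = rsk (toWord (σ , i))
          e₁ , e₂ = rsk-functional p″ p′
      in (σ , i) , (∈-filter⁺ (avoids? Π) σ∈ (Equivalence.from (avoids⇔good σ∈ c p′) g) , c)
         , cong₂ _,_ e₁ e₂

-- Expansions for the empty set, 321 alone and 123 alone

record SchurExpansion (n : ℕ) (f : PowerSeries) : Set where
  constructor schur
  field
    coefficients : List ℕ → ℤ
    nonnegative  : All (λ μ → 0ℤ ℤ.≤ coefficients μ) (partitions n)
    expands      : ∀ m → f m ≡ Σ[ partitions n ] (λ μ → coefficients μ · s μ) m

expansion : ∀ n f (R : List ℕ → List B) →
            (∀ m → f m ≡ Σ[ partitions n ] (λ μ → (+ length (R μ)) · s μ) m) → SchurExpansion n f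
expansion n f R e = schur (λ μ → + length (R μ)) (All.universal (λ μ → ℤ.+≤+ z≤n) (partitions n)) e

wordExpansion-nonnegative : ∀ n {Good : List ℕ → Set} (good? : ∀ μ → Dec (Good μ)) Π →
  (∀ {σ i : Vec ℕ n} {T q} → σ ∈ 𝔖 n → Compatible (Des σ) i → RSK (toWord (σ , i)) T q →
     Avoids Π σ ⇔ Good (map length T)) → SchurExpansion n (Q n Π)
wordExpansion-nonnegative n good? Π h =
  expansion n (Q n Π) (latticeWords n good?) (wordExpansion good? Π h)

expansion-∅ : ∀ n → SchurExpansion n (Q n {3} [])
expansion-∅ n = wordExpansion-nonnegative n (λ _ → yes tt) [] (λ _ _ _ → mk⇔ (λ _ → tt) (λ _ → []))

firstPart : List ℕ → ℕ
firstPart []      = 0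
firstPart (l ∷ _) = l

expansion-321 : ∀ n → SchurExpansion n (Q n (p321 ∷ []))
expansion-321 n = wordExpansion-nonnegative n (λ μ → length μ ≤? 2) (p321 ∷ []) λ {σ} {i} {T} σ∈ c p →
  let rows⇔ = increasing⇔rows p
      len = List.length-map length T
  in mk⇔ (λ { (h ∷ []) → subst (_≤ 2) (sym len) (≤-pred (≰⇒> λ l →
              h (contains321⇐ σ∈ c (Equivalence.from rows⇔ l)))) })
         (λ l → (λ h → <⇒≱ (Equivalence.to rows⇔ (contains321⇒ σ∈ c h)) (subst (_≤ 2) len l)) ∷ [])

expansion-123 : ∀ n → SchurExpansion n (Q n (p123 ∷ []))
expansion-123 n = wordExpansion-nonnegative n (λ μ → firstPart μ ≤? 2) (p123 ∷ []) λ {σ} {i} {T} σ∈ c p →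
  let row⇔ = decreasing⇔firstRow p
  in mk⇔ (λ { (h ∷ []) → subst (_≤ 2) (len T) (≤-pred (≰⇒> λ l →
              h (contains123⇐ σ∈ c (Equivalence.from row⇔ l)))) })
         (λ l → (λ h → <⇒≱ (Equivalence.to row⇔ (contains123⇒ σ∈ c h)) (subst (_≤ 2) (sym (len T)) l)) ∷ [])
  where
  len : ∀ T → length (firstRow T) ≡ firstPart (map length T)
  len []      = refl
  len (_ ∷ _) = refl

-- Symmetry of Schur functions (Bender–Knuth)

below : ℕ → ℕ → ℕ
below k x = if does (x <? k) then 1 else 0

-- A sorted row is determined by the numbers of its entries below each k, and column strictness is a
-- family of inequalities between such numbers.
lt : ℕ → List ℕ → ℕ
lt k []      = 0
lt k (x ∷ r) = below k x + lt k r

below-yes : ∀ {k x} → x < k → below k x ≡ 1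
below-yes {k} {x} p rewrite dec-true (x <? k) p = refl

below-no : ∀ {k x} → k ≤ x → below k x ≡ 0
below-no {k} {x} p rewrite dec-false (x <? k) (≤⇒≯ p) = refl

below-mono : ∀ {j k x y} → (x < j → y < k) → below j x ≤ below k y
below-mono {j} {k} {x} {y} f with x <? j
... | yes x<j = ≤-reflexive (≡-trans (below-yes x<j) (sym (below-yes (f x<j))))
... | no x≮j  = subst (_≤ below k y) (sym (below-no {j} {x} (≮⇒≥ x≮j))) z≤n

lt-mono : ∀ {j k} r → j ≤ k → lt j r ≤ lt k r
lt-mono         []      p = z≤n
lt-mono {j} {k} (x ∷ r) p = +-mono-≤ (below-mono {j} {k} {x} (λ q → <-≤-trans q p)) (lt-mono r p)

lt-++ : ∀ k r {u} → lt k (r ++ u) ≡ lt k r + lt k u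
lt-++ k []      = refl
lt-++ k (x ∷ r) = ≡-trans (cong (λ z → below k x + z) (lt-++ k r)) (sym (+-assoc (below k x) _ _))

lt-all : ∀ {k} r → All (_< k) r → lt k r ≡ length r
lt-all []      []      = refl
lt-all {k} (x ∷ r) (p ∷ q) = cong₂ _+_ (below-yes {k} {x} p) (lt-all r q)

lt-none : ∀ {k} r → All (k ≤_) r → lt k r ≡ 0
lt-none []      []      = refl
lt-none {k} (x ∷ r) (p ∷ q) = cong₂ _+_ (below-no {k} {x} p) (lt-none r q)

lt-↭ : ∀ k {u v} → u ↭ v → lt k u ≡ lt k v
lt-↭ k refl         = refl
lt-↭ k (prep x p)   = cong (λ z → below k x + z) (lt-↭ k p)
lt-↭ k (swap {xs} {ys} x y p) = begin
  below k x + (below k y + lt k xs) ≡⟨ +-assoc (below k x) _ _ ⟨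
  below k x + below k y + lt k xs   ≡⟨ cong₂ _+_ (+-comm (below k x) _) (lt-↭ k p) ⟩
  below k y + below k x + lt k ys   ≡⟨ +-assoc (below k y) _ _ ⟩
  below k y + (below k x + lt k ys) ∎
  where open ≡-Reasoning
lt-↭ k (trans p q)  = ≡-trans (lt-↭ k p) (lt-↭ k q)

sorted-lt-unique : ∀ r u → Sorted r → Sorted u → (∀ k → lt k r ≡ lt k u) → r ≡ u
sorted-lt-unique []      []      _ _ _ = refl
sorted-lt-unique []      (y ∷ u) _ _ e with () ← ≡-trans (e (suc y)) (cong (_+ lt (suc y) u) (below-yes {suc y} {y} ≤-refl))
sorted-lt-unique (x ∷ r) []      _ _ e with () ← ≡-trans (sym (e (suc x))) (cong (_+ lt (suc x) r) (below-yes {suc x} {x} ≤-refl))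
sorted-lt-unique (x ∷ r) (y ∷ u) (p ∷ s) (q ∷ t) e = conclude (≤-antisym (bound r u q e) (bound u r p (λ k → sym (e k))))
  where
  bound : ∀ {x y} r u → All (y ≤_) u → (∀ k → lt k (x ∷ r) ≡ lt k (y ∷ u)) → y ≤ x
  bound {x} {y} r u q e = ≮⇒≥ λ x<y → absurd (≡-trans (sym (cong (_+ lt (suc x) r) (below-yes {suc x} {x} ≤-refl)))
    (≡-trans (e (suc x)) (lt-none {suc x} (y ∷ u) (x<y ∷ All.map (≤-trans x<y) q))))
    where
    absurd : ∀ {k} → suc k ≢ 0
    absurd ()
  conclude : y ≡ x → x ∷ r ≡ y ∷ u
  conclude refl = cong (x ∷_) (sorted-lt-unique r u s t (λ k → +-cancelˡ-≡ (below k x) _ _ (e k)))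

module Ascending = InsertionSort _≤?_ ≤-trans (λ n → <⇒≤ (≰⇒> n))

lt-unique : ∀ u v → (∀ k → lt k u ≡ lt k v) → u ↭ v
lt-unique u v e = begin
  u                ↭⟨ Ascending.sort-↭ u ⟨
  Ascending.sort u ≡⟨ sorted-lt-unique _ _ (Ascending.sort-sorted u) (Ascending.sort-sorted v)
                        (λ k → ≡-trans (lt-↭ k (Ascending.sort-↭ u)) (≡-trans (e k) (lt-↭ k (↭-sym (Ascending.sort-↭ v))))) ⟩
  Ascending.sort v ↭⟨ Ascending.sort-↭ v ⟩
  v                ∎
  where open PermutationReasoning

dominates⇒lt : ∀ {u l} k → Dominates u l → lt (suc k) l ≤ lt k u
dominates⇒lt k [] = z≤n
dominates⇒lt k (_∷_ {a} {b} p d) =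
  +-mono-≤ (below-mono {suc k} {k} {b} {a} (λ q → <-≤-trans p (≤-pred q))) (dominates⇒lt k d)

-- At k = b, the first lower entry, the inequality provides an upper entry below b, hence the first
-- upper entry is below b. Wherever b is counted, removing both heads lowers both sides by one.
lt⇒dominates : ∀ {u l} → Sorted u → Sorted l → (∀ k → lt (suc k) l ≤ lt k u) → Dominates u l
lt⇒dominates {l = []}    _ _ _ = []
lt⇒dominates {[]} {b ∷ l} _ _ h =
  ⊥-elim (1+n≰n (≤-trans (≤-reflexive (sym (below-yes {suc b} {b} ≤-refl))) (≤-trans (m≤m+n _ (lt (suc b) l)) (h b))))
lt⇒dominates {a ∷ u} {b ∷ l} (p ∷ s) (q ∷ t) h = a<b ∷ lt⇒dominates s t tails
  where
  a<b : a < b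
  a<b = ≰⇒> λ b≤a → 1+n≰n (≤-trans (≤-reflexive (sym (below-yes {suc b} {b} ≤-refl)))
    (≤-trans (m≤m+n _ (lt (suc b) l)) (≤-trans (h b) (≤-reflexive (lt-none (a ∷ u) (b≤a ∷ All.map (≤-trans b≤a) p))))))
  tails : ∀ k → lt (suc k) l ≤ lt k u
  tails k with b <? suc k
  ... | no b≮k  = subst (_≤ lt k u) (sym (lt-none {suc k} l (All.map (≤-trans (≮⇒≥ b≮k)) q))) z≤n
  ... | yes b<k = +-cancelˡ-≤ 1 _ _ (subst₂ _≤_
    (cong (_+ lt (suc k) l) (below-yes {suc k} {b} b<k))
    (cong (_+ lt k u) (below-yes {k} {a} (<-≤-trans a<b (≤-pred b<k)))) (h k))

-- The row whose counting function is f up to n: each k below n occurs f (k + 1) - f k times.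
rowOf : ℕ → (ℕ → ℕ) → List ℕ
rowOf zero    f = []
rowOf (suc n) f = rowOf n f ++ replicate (f (suc n) ∸ f n) n

module _ {f : ℕ → ℕ} (f0 : f 0 ≡ 0) (f-mono : ∀ k → f k ≤ f (suc k)) where

  rowOf-bounded : ∀ n → All (_< n) (rowOf n f)
  rowOf-bounded zero    = []
  rowOf-bounded (suc n) = All.++⁺ (All.map m≤n⇒m≤1+n (rowOf-bounded n)) (All.replicate⁺ (f (suc n) ∸ f n) ≤-refl)

  rowOf-sorted : ∀ n → Sorted (rowOf n f)
  rowOf-sorted zero    = []
  rowOf-sorted (suc n) = AllPairs.++⁺ (rowOf-sorted n) (constant (f (suc n) ∸ f n))
    (All.map (λ p → All.replicate⁺ (f (suc n) ∸ f n) (<⇒≤ p)) (rowOf-bounded n))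
    where
    constant : ∀ d → Sorted (replicate d n)
    constant zero    = []
    constant (suc d) = All.replicate⁺ d ≤-refl ∷ constant d

  lt-rowOf-full : ∀ {k} n → n ≤ k → lt k (rowOf n f) ≡ f n
  lt-rowOf-full zero    _ = sym f0
  lt-rowOf-full {k} (suc n) n<k = begin
    lt k (rowOf n f ++ replicate d n)           ≡⟨ lt-++ k (rowOf n f) ⟩
    lt k (rowOf n f) + lt k (replicate d n)     ≡⟨ cong₂ _+_ (lt-rowOf-full n (<⇒≤ n<k)) (lt-all {k} (replicate d n) (All.replicate⁺ d n<k)) ⟩
    f n + length (replicate d n)                ≡⟨ cong (λ z → f n + z) (List.length-replicate d) ⟩
    f n + d                                     ≡⟨ m+[n∸m]≡n (f-mono n) ⟩
    f (suc n)                                   ∎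
    where
    open ≡-Reasoning
    d = f (suc n) ∸ f n

  lt-rowOf : ∀ {k} n → k ≤ n → lt k (rowOf n f) ≡ f k
  lt-rowOf {k} n k≤n with m≤n⇒m<n∨m≡n k≤n
  ... | inj₂ refl = lt-rowOf-full n ≤-refl
  lt-rowOf {k} (suc n) _ | inj₁ (s≤s k≤n) = begin
    lt k (rowOf n f ++ replicate d n)       ≡⟨ lt-++ k (rowOf n f) ⟩
    lt k (rowOf n f) + lt k (replicate d n) ≡⟨ cong₂ _+_ (lt-rowOf n k≤n) (lt-none {k} (replicate d n) (All.replicate⁺ d k≤n)) ⟩
    f k + 0                                 ≡⟨ +-identityʳ (f k) ⟩
    f k                                     ∎
    where
    open ≡-Reasoning
    d = f (suc n) ∸ f n

modify : (c b : ℕ) → (ℕ → ℕ) → ℕ → ℕ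
modify c b f k = if does (k ≟ c) then b else f k

modify-≡ : ∀ c b f → modify c b f c ≡ b
modify-≡ c b f rewrite dec-true (c ≟ c) refl = refl

modify-≢ : ∀ {c} b f {k} → k ≢ c → modify c b f k ≡ f k
modify-≢ {c} b f {k} p rewrite dec-false (k ≟ c) p = refl

-- A single value of the counting function may move between its two neighbours without spoiling
-- monotonicity; `rowOf` turns the result into a row.
modifyRow : ∀ c b r → lt c r ≤ b → b ≤ lt (2 + c) r →
            ∃[ r′ ] Sorted r′ × (∀ k → k ≢ suc c → lt k r′ ≡ lt k r) × lt (suc c) r′ ≡ b
modifyRow c b r A≤b b≤C = rowOf n f , rowOf-sorted f0 f-mono n , other
  , ≡-trans (lt-rowOf f0 f-mono n (m≤n+m (suc c) (suc (sum r)))) (modify-≡ (suc c) b (λ k → lt k r))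
  where
  -- Larger than every entry of r and than c + 1, so cutting off at n loses nothing and the modified
  -- value is not the one at n.
  n = suc (sum r) + suc c
  f = modify (suc c) b (λ k → lt k r)
  f0 : f 0 ≡ 0
  f0 = lt-none {0} r (All.tabulate λ _ → z≤n)
  f-mono : ∀ k → f k ≤ f (suc k)
  f-mono k with k ≟ c
  ... | yes refl = subst₂ _≤_ (sym (modify-≢ b (λ k → lt k r) (<⇒≢ (n<1+n c)))) (sym (modify-≡ (suc c) b (λ k → lt k r))) A≤b
  ... | no k≢c with k ≟ suc c
  ...   | yes refl = subst₂ _≤_ (sym (modify-≡ (suc c) b (λ k → lt k r)))
                       (sym (modify-≢ b (λ k → lt k r) (>⇒≢ (n<1+n (suc c))))) b≤C
  ...   | no k≢1+c = subst₂ _≤_ (sym (modify-≢ b (λ k → lt k r) k≢1+c))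
                       (sym (modify-≢ b (λ k → lt k r) (k≢c ∘ suc-injective))) (lt-mono r (n≤1+n k))
  bounded : ∀ {k} → n ≤ k → All (_< k) r
  bounded n≤k = All.map (λ p → ≤-trans (s≤s p) (≤-trans (m≤m+n _ (suc c)) n≤k)) (part≤sum r)
  other : ∀ k → k ≢ suc c → lt k (rowOf n f) ≡ lt k r
  other k k≢ with k ≤? n
  ... | yes k≤n = ≡-trans (lt-rowOf f0 f-mono n k≤n) (modify-≢ b (λ k → lt k r) k≢)
  ... | no k≰n  = begin
    lt k (rowOf n f) ≡⟨ lt-rowOf-full f0 f-mono n (<⇒≤ (≰⇒> k≰n)) ⟩
    f n              ≡⟨ modify-≢ b (λ k → lt k r) (λ e → m≢1+n+m (suc c) (sym e)) ⟩
    lt n r           ≡⟨ lt-all r (bounded ≤-refl) ⟩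
    length r         ≡⟨ lt-all r (bounded (<⇒≤ (≰⇒> k≰n))) ⟨
    lt k r           ∎
    where open ≡-Reasoning

-- With all other counts fixed, the number lt (suc c) of entries ≤ c of a row can be any number in the
-- interval from lt c r ⊔ lt (2 + c) next to lt (2 + c) r ⊓ p, where p is the number of entries < c of
-- the row above.  The involution reflects it in this interval, row by row.
record BKRow (c p : ℕ) (next r r′ : List ℕ) : Set where
  constructor bkRow
  field
    sorted    : Sorted r′
    unchanged : ∀ k → k ≢ suc c → lt k r′ ≡ lt k r
    reflected : lt (suc c) r′ + lt (suc c) r ≡ (lt c r ⊔ lt (2 + c) next) + (lt (2 + c) r ⊓ p)

-- The intervals depend only on counts at c and 2 + c, which stay fixed. So each row is reflected
-- independently of the others and the new tableau has the same intervals, which makes the move an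
-- involution.
data BK (c : ℕ) : ℕ → Tableau → Tableau → Set where
  []  : ∀ {p} → BK c p [] []
  _∷_ : ∀ {p r r′ T T′} → BKRow c p (firstRow T) r r′ → BK c (lt c r) T T′ → BK c p (r ∷ T) (r′ ∷ T′)

module _ {c : ℕ} where

  bk-firstRow : ∀ {p T T′ k} → k ≢ suc c → BK c p T T′ → lt k (firstRow T′) ≡ lt k (firstRow T)
  bk-firstRow k≢ []      = refl
  bk-firstRow k≢ (b ∷ _) = BKRow.unchanged b _ k≢

  c≢ : c ≢ suc c
  c≢ = <⇒≢ (n<1+n c)

  2+c≢ : 2 + c ≢ suc c
  2+c≢ = >⇒≢ (n<1+n (suc c))

  bk-sym : ∀ {p T T′} → All Sorted T → BK c p T T′ → BK c p T′ T
  bk-sym _ [] = []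
  bk-sym {p} (s ∷ ss) (_∷_ {r = r} {r′} {T} {T′} (bkRow _ u e) bk) =
    bkRow s (λ k k≢ → sym (u k k≢)) (begin
      lt (suc c) r + lt (suc c) r′ ≡⟨ +-comm (lt (suc c) r) _ ⟩
      lt (suc c) r′ + lt (suc c) r ≡⟨ e ⟩
      (lt c r ⊔ lt (2 + c) (firstRow T)) + (lt (2 + c) r ⊓ p)
        ≡⟨ cong₂ _+_ (cong₂ _⊔_ (u c c≢) (bk-firstRow 2+c≢ bk)) (cong (_⊓ p) (u (2 + c) 2+c≢)) ⟨
      (lt c r′ ⊔ lt (2 + c) (firstRow T′)) + (lt (2 + c) r′ ⊓ p) ∎)
    ∷ subst (λ z → BK c z T′ T) (sym (u c c≢)) (bk-sym ss bk)
    where open ≡-Reasoning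

  bk-functional : ∀ {p T T′ T″} → BK c p T T′ → BK c p T T″ → T′ ≡ T″
  bk-functional [] [] = refl
  bk-functional (_∷_ {r = r} {r′} (bkRow s u e) b) (_∷_ {r′ = r″} (bkRow s′ u′ e′) b′) = cong₂ _∷_ (sorted-lt-unique r′ r″ s s′ agree) (bk-functional b b′)
    where
    agree : ∀ k → lt k r′ ≡ lt k r″
    agree k with k ≟ suc c
    ... | yes refl = +-cancelʳ-≡ (lt (suc c) r) _ _ (≡-trans e (sym e′))
    ... | no k≢    = ≡-trans (u k k≢) (sym (u′ k k≢))

  bk-length : ∀ {p T T′} → BK c p T T′ → map length T′ ≡ map length T
  bk-length [] = refl
  bk-length (_∷_ {r = r} {r′} (bkRow _ u _) bk) = cong₂ _∷_ (begin
    length r′ ≡⟨ lt-all r′ (bounded r′ (λ p → ≤-trans p (m≤n+m _ (sum r)))) ⟨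
    lt K r′   ≡⟨ u K (λ e → m≢1+n+m (suc c) (sym e)) ⟩
    lt K r    ≡⟨ lt-all r (bounded r (λ p → ≤-trans p (m≤m+n _ (sum r′)))) ⟩
    length r  ∎) (bk-length bk)
    where
    open ≡-Reasoning
    K = suc (sum r + sum r′) + suc c
    bounded : ∀ u → (∀ {x} → x ≤ sum u → x ≤ sum r + sum r′) → All (_< K) u
    bounded u f = All.map (λ p → ≤-trans (s≤s (f p)) (m≤m+n _ (suc c))) (part≤sum u)

  -- The reflections telescope: the lower end for a row is the maximum of `lt c r` and
  -- `lt (2 + c) next`, the upper end for the next row is the minimum of the same numbers, and
  -- together they give the sum. The maximum on the left-hand side is the unmatched half at the top.
  bk-count : ∀ {p T T′} → BK c p T T′ →
    lt (suc c) (concat T′) + lt (suc c) (concat T) + (lt (2 + c) (firstRow T) ⊔ p) ≡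
    lt c (concat T) + lt (2 + c) (concat T) + p
  bk-count [] = refl
  bk-count {p} (_∷_ {r = r} {r′} {T} {T′} (bkRow _ _ e) bk) = begin
    lt (suc c) (r′ ++ concat T′) + lt (suc c) (r ++ concat T) + (C ⊔ p)
      ≡⟨ cong₂ (λ y z → y + z + (C ⊔ p)) (lt-++ (suc c) r′) (lt-++ (suc c) r) ⟩
    (B′ + ΣB′) + (Bᵣ + ΣB) + (C ⊔ p)       ≡⟨ shuffle₁ B′ ΣB′ Bᵣ ΣB (C ⊔ p) ⟩
    (B′ + Bᵣ) + (ΣB′ + ΣB) + (C ⊔ p)       ≡⟨ cong (λ z → z + (ΣB′ + ΣB) + (C ⊔ p)) e ⟩
    ((Aᵣ ⊔ Cn) + (C ⊓ p)) + (ΣB′ + ΣB) + (C ⊔ p) ≡⟨ shuffle₂ (Aᵣ ⊔ Cn) (C ⊓ p) (ΣB′ + ΣB) (C ⊔ p) ⟩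
    (ΣB′ + ΣB + (Aᵣ ⊔ Cn)) + ((C ⊔ p) + (C ⊓ p)) ≡⟨ cong₂ _+_ (cong (λ z → ΣB′ + ΣB + z) (⊔-comm Aᵣ Cn)) (⊔+⊓ C p) ⟩
    (ΣB′ + ΣB + (Cn ⊔ Aᵣ)) + (C + p)       ≡⟨ cong (_+ (C + p)) (bk-count bk) ⟩
    (ΣA + ΣC + Aᵣ) + (C + p)               ≡⟨ shuffle₃ ΣA ΣC Aᵣ C p ⟩
    (Aᵣ + ΣA) + (C + ΣC) + p               ≡⟨ cong₂ (λ y z → y + z + p) (lt-++ c r) (lt-++ (2 + c) r) ⟨
    lt c (r ++ concat T) + lt (2 + c) (r ++ concat T) + p ∎
    where
    open ≡-Reasoning
    Aᵣ = lt c r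
    Bᵣ = lt (suc c) r
    B′ = lt (suc c) r′
    C = lt (2 + c) r
    Cn = lt (2 + c) (firstRow T)
    ΣA = lt c (concat T)
    ΣB = lt (suc c) (concat T)
    ΣB′ = lt (suc c) (concat T′)
    ΣC = lt (2 + c) (concat T)
    ⊔+⊓ : ∀ x y → (x ⊔ y) + (x ⊓ y) ≡ x + y
    ⊔+⊓ x y with ≤-total x y
    ... | inj₁ x≤y = ≡-trans (cong₂ _+_ (m≤n⇒m⊔n≡n x≤y) (m≤n⇒m⊓n≡m x≤y)) (+-comm y x)
    ... | inj₂ y≤x = cong₂ _+_ (m≥n⇒m⊔n≡m y≤x) (m≥n⇒m⊓n≡n y≤x)
    shuffle₁ : ∀ a b d e f → (a + b) + (d + e) + f ≡ (a + d) + (b + e) + f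
    shuffle₁ = solve-∀
    shuffle₂ : ∀ a b d e → (a + b) + d + e ≡ (d + a) + (e + b)
    shuffle₂ = solve-∀
    shuffle₃ : ∀ a b d e f → (a + b + d) + (e + f) ≡ (d + a) + (e + b) + f
    shuffle₃ = solve-∀

  next≤ : ∀ {r T} k → Linked Dominates (r ∷ T) → lt (suc k) (firstRow T) ≤ lt k r
  next≤ k [-]     = z≤n
  next≤ k (d ∷ _) = dominates⇒lt k d

  -- The inequality is column strictness at c against a row above with p entries below c. It is
  -- returned for the new tableau so that the changed row above can be attached.
  bk-exists : ∀ {p T} → SSYT T → lt (suc c) (firstRow T) ≤ p →
    ∃[ T′ ] BK c p T T′ × SSYT T′ × lt (suc c) (firstRow T′) ≤ p
  bk-exists {p} {[]} t h = [] , [] , t , h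
  bk-exists {p} {r ∷ T} (ssyt (sr ∷ ss) d (1≤r ∷ ne)) h
    with bk-exists {lt c r} {T} (ssyt ss (Linked.tail d) ne) (next≤ c d)
  ... | T′ , bk , ssyt ss′ d′ ne′ , h′ =
    let r′ , s′ , u , e = modifyRow c b r (m⊔n≤o⇒m≤o Aᵣ Cn lo≤b) (m≤n⊓o⇒m≤n C p b≤hi)
        row = bkRow s′ u (≡-trans (cong (_+ Bᵣ) e) (m∸n+n≡m (≤-trans Bᵣ≤hi (m≤n+m hi lo))))
        len = List.∷-injectiveˡ (bk-length (row ∷ bk))
    in r′ ∷ T′ , row ∷ bk
       , ssyt (s′ ∷ ss′) (linked-∷ (dominates s′ u e) d′) (subst (1 ≤_) (sym len) 1≤r ∷ ne′)
       , ≤-trans (≤-reflexive e) (m≤n⊓o⇒m≤o C p b≤hi)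
    where
    Aᵣ = lt c r
    Bᵣ = lt (suc c) r
    C = lt (2 + c) r
    Cn = lt (2 + c) (firstRow T)
    lo = Aᵣ ⊔ Cn
    hi = C ⊓ p
    -- The mirror image of Bᵣ in the interval from lo to hi; the subtraction is exact because Bᵣ is
    -- at most hi.
    b = (lo + hi) ∸ Bᵣ
    lo≤Bᵣ : lo ≤ Bᵣ
    lo≤Bᵣ = ⊔-lub (lt-mono r (n≤1+n c)) (next≤ (suc c) d)
    Bᵣ≤hi : Bᵣ ≤ hi
    Bᵣ≤hi = ⊓-glb (lt-mono r (n≤1+n (suc c))) h
    lo≤b : lo ≤ b
    lo≤b = ≤-trans (≤-reflexive (sym (m+n∸n≡m lo Bᵣ))) (∸-monoˡ-≤ Bᵣ (+-monoʳ-≤ lo Bᵣ≤hi))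
    b≤hi : b ≤ hi
    b≤hi = ≤-trans (∸-monoˡ-≤ Bᵣ (+-monoˡ-≤ hi lo≤Bᵣ)) (≤-reflexive (m+n∸m≡n Bᵣ hi))
    dominates : ∀ {r′} → Sorted r′ → (∀ k → k ≢ suc c → lt k r′ ≡ lt k r) → lt (suc c) r′ ≡ b →
                ∀ {l U} → T′ ≡ l ∷ U → Dominates r′ l
    dominates {r′} s′ u e {l} {U} refl = lt⇒dominates s′ (All.head ss′) check
      where
      check : ∀ k → lt (suc k) l ≤ lt k r′
      -- Only two inequalities involve a changed count: at k = c that of the lower row, at k = c + 1
      -- that of r′.
      check k with k ≟ c
      ... | yes refl = ≤-trans h′ (≤-reflexive (sym (u c c≢)))
      ... | no k≢c with k ≟ suc c
      ...   | yes refl = ≤-trans (≤-reflexive (bk-firstRow 2+c≢ bk)) (≤-trans (≤-trans (m≤n⊔m Aᵣ Cn) lo≤b) (≤-reflexive (sym e)))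
      ...   | no k≢1+c = subst₂ _≤_ (sym (bk-firstRow (k≢c ∘ suc-injective) bk)) (sym (u k k≢1+c)) (next≤ k d)

-- Transpositions and the content after the involution

transpose : ℕ → ℕ → ℕ → ℕ
transpose a b x = if does (x ≟ a) then b else if does (x ≟ b) then a else x

transpose-left : ∀ a b → transpose a b a ≡ b
transpose-left a b rewrite dec-true (a ≟ a) refl = refl

transpose-right : ∀ a b → transpose a b b ≡ a
transpose-right a b with b ≟ a
... | yes refl rewrite dec-true (b ≟ b) refl = refl
... | no b≢a rewrite dec-false (b ≟ a) b≢a | dec-true (b ≟ b) refl = refl

transpose-other : ∀ {a b x} → x ≢ a → x ≢ b → transpose a b x ≡ x
transpose-other {a} {b} {x} p q rewrite dec-false (x ≟ a) p | dec-false (x ≟ b) q = refl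

transpose-involutive : ∀ a b x → transpose a b (transpose a b x) ≡ x
transpose-involutive a b x with x ≟ a
... | yes refl = ≡-trans (cong (transpose a b) (transpose-left a b)) (transpose-right a b)
... | no x≢a with x ≟ b
...   | yes refl = ≡-trans (cong (transpose a b) (transpose-right a b)) (transpose-left a b)
...   | no x≢b   = ≡-trans (cong (transpose a b) (transpose-other x≢a x≢b)) (transpose-other x≢a x≢b)

below-step : ∀ {c k} → k ≢ suc c → below k (suc c) ≡ below k c
below-step {c} {k} k≢ with <-cmp k (suc c)
... | tri< k<1+c _ _ = ≡-trans (below-no {k} (<⇒≤ k<1+c)) (sym (below-no {k} (≤-pred k<1+c)))
... | tri≈ _ e _     = ⊥-elim (k≢ e)
... | tri> _ _ 1+c<k = ≡-trans (below-yes 1+c<k) (sym (below-yes (<⇒≤ 1+c<k)))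

below-transpose : ∀ {c k} x → k ≢ suc c → below k (transpose c (suc c) x) ≡ below k x
below-transpose {c} {k} x k≢ with x ≟ c
... | yes refl = ≡-trans (cong (below k) (transpose-left c (suc c))) (below-step k≢)
... | no x≢c with x ≟ suc c
...   | no x≢1+c = cong (below k) (transpose-other x≢c x≢1+c)
...   | yes refl = ≡-trans (cong (below k) (transpose-right c (suc c))) (sym (below-step k≢))

below-transposed : ∀ c x → below (suc c) (transpose c (suc c) x) + below (suc c) x ≡ below c x + below (2 + c) x
below-transposed c x with <-cmp x c
... | tri≈ _ refl _ = ≡-trans (cong₂ _+_ (≡-trans (cong (below (suc c)) (transpose-left c (suc c))) (below-no {suc c} ≤-refl)) (below-yes {suc c} {c} ≤-refl))
                              (sym (cong₂ _+_ (below-no {c} ≤-refl) (below-yes {2 + c} {c} (s≤s (n≤1+n c)))))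
... | tri< x<c x≢c _ = cong₂ _+_ (≡-trans (cong (below (suc c)) (transpose-other x≢c (<⇒≢ (m<n⇒m<1+n x<c)))) both) (≡-trans (below-yes (m<n⇒m<1+n x<c)) (sym (below-yes (m<n⇒m<1+n (m<n⇒m<1+n x<c)))))
  where
  both = ≡-trans (below-yes (m<n⇒m<1+n x<c)) (sym (below-yes x<c))
... | tri> _ x≢c c<x with x ≟ suc c
...   | yes refl = ≡-trans (cong₂ _+_ (≡-trans (cong (below (suc c)) (transpose-right c (suc c))) (below-yes {suc c} {c} ≤-refl)) (below-no {suc c} ≤-refl))
                     (≡-trans refl (sym (cong₂ _+_ (below-no {c} (n≤1+n c)) (below-yes {2 + c} {suc c} ≤-refl))))
...   | no x≢1+c = ≡-trans (cong₂ _+_ (≡-trans (cong (below (suc c)) (transpose-other x≢c x≢1+c)) (below-no {suc c} c<x)) (below-no {suc c} c<x))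
                     (sym (cong₂ _+_ (below-no {c} (<⇒≤ c<x)) (below-no {2 + c} (≤∧≢⇒< c<x (x≢1+c ∘ sym)))))

lt-transpose : ∀ {c k} r → k ≢ suc c → lt k (map (transpose c (suc c)) r) ≡ lt k r
lt-transpose []      _  = refl
lt-transpose (x ∷ r) k≢ = cong₂ _+_ (below-transpose x k≢) (lt-transpose r k≢)

-- Exchanging c and c + 1 reflects the count between those at c and 2 + c. The right-hand side is
-- that of `bk-count` once p is cancelled.
lt-transposed : ∀ c r → lt (suc c) (map (transpose c (suc c)) r) + lt (suc c) r ≡ lt c r + lt (2 + c) r
lt-transposed c []      = refl
lt-transposed c (x ∷ r) = begin
  (below (suc c) (τ x) + lt (suc c) (map τ r)) + (below (suc c) x + lt (suc c) r)
    ≡⟨ interchange (below (suc c) (τ x)) _ (below (suc c) x) _ ⟩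
  (below (suc c) (τ x) + below (suc c) x) + (lt (suc c) (map τ r) + lt (suc c) r)
    ≡⟨ cong₂ _+_ (below-transposed c x) (lt-transposed c r) ⟩
  (below c x + below (2 + c) x) + (lt c r + lt (2 + c) r)
    ≡⟨ interchange (below c x) _ (lt c r) _ ⟩
  (below c x + lt c r) + (below (2 + c) x + lt (2 + c) r) ∎
  where
  open ≡-Reasoning
  τ = transpose c (suc c)
  interchange : ∀ a b d e → (a + b) + (d + e) ≡ (a + d) + (b + e)
  interchange = solve-∀

bk-content : ∀ {c T T′} → BK c (lt (2 + c) (firstRow T)) T T′ → concat T′ ↭ map (transpose c (suc c)) (concat T)
bk-content {c} {T} {T′} bk = lt-unique (concat T′) (map (transpose c (suc c)) (concat T)) agree
  where
  counts : ∀ {p T T′} k → k ≢ suc c → BK c p T T′ → lt k (concat T′) ≡ lt k (concat T)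
  counts k k≢ [] = refl
  counts k k≢ (_∷_ {r = r} {r′} b bk) =
    ≡-trans (lt-++ k r′) (≡-trans (cong₂ _+_ (BKRow.unchanged b k k≢) (counts k k≢ bk)) (sym (lt-++ k r)))
  agree : ∀ k → lt k (concat T′) ≡ lt k (map (transpose c (suc c)) (concat T))
  agree k with k ≟ suc c
  ... | no k≢    = ≡-trans (counts k k≢ bk) (sym (lt-transpose (concat T) k≢))
  -- At the top p is the count at 2 + c of the first row itself, so the extra maximum equals p and
  -- cancels.
  ... | yes refl = +-cancelʳ-≡ (lt (suc c) (concat T)) _ _
    (≡-trans (+-cancelʳ-≡ P _ _ (≡-trans (cong (λ z → lt (suc c) (concat T′) + lt (suc c) (concat T) + z) (sym (⊔-idem P))) (bk-count bk)))
             (sym (lt-transposed c (concat T))))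
    where P = lt (2 + c) (firstRow T)

benderKnuth : ∀ c {T} → SSYT T → ∃[ T′ ] BK c (lt (2 + c) (firstRow T)) T T′ × SSYT T′
benderKnuth c {T} t = let T′ , bk , t′ , _ = bk-exists t (lt-mono (firstRow T) (n≤1+n (suc c))) in T′ , bk , t′

schur-transpose : ∀ {n μ} → Partition n μ → ∀ c m → s μ (map (transpose c (suc c)) m) ≡ s μ m
schur-transpose {n} {μ} pt c m = cong +_ (sym
  (length-bijection (tableaux-unique μ m) (tableaux-unique μ m′) f into inj surj))
  where
  m′ = map (transpose c (suc c)) m

  bk? : ∀ T → Dec (SSYT T)
  bk? T = map′ (λ (ss , p) → semistandard⇒ssyt ss p) (λ t → ssyt⇒semistandard t , ssyt⇒partition t)
               (semistandard? T ×-dec partition? (length (concat T)) (map length T))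

  -- The bijection has to be total; the identity outside the tableaux is a filler.
  f : Tableau → Tableau
  f T with bk? T
  ... | yes t = proj₁ (benderKnuth c t)
  ... | no _  = T

  f-bk : ∀ {T} → SSYT T → BK c (lt (2 + c) (firstRow T)) T (f T) × SSYT (f T)
  f-bk {T} t with bk? T
  ... | yes t′ = proj₂ (benderKnuth c t′)
  ... | no ¬t  = ⊥-elim (¬t t)

  tableau⁻ : ∀ {m T} → T ∈ tableaux μ m → SSYT T × concat T ↭ m × map length T ≡ μ
  tableau⁻ {m} {T} p = let ss , e , sh = ∈-tableaux⁻ {μ} {m} p in
    semistandard⇒ssyt ss (subst (Partition n) (sym sh) pt) , e , sh

  tableau⁺ : ∀ {m T} → SSYT T → concat T ↭ m → map length T ≡ μ → T ∈ tableaux μ m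
  tableau⁺ {m} {T} t e sh = subst (λ ν → T ∈ tableaux ν m) sh (∈-tableaux⁺ (ssyt⇒semistandard t) e)

  into : ∀ {T} → T ∈ tableaux μ m → f T ∈ tableaux μ m′
  into p = let t , e , sh = tableau⁻ {m} p ; bk , t′ = f-bk t in
    tableau⁺ {m′} t′ (↭-trans (bk-content bk) (↭.map⁺ _ e)) (≡-trans (bk-length bk) sh)

  same : ∀ {T T′} → BK c (lt (2 + c) (firstRow T)) T T′ → SSYT T → BK c (lt (2 + c) (firstRow T′)) T′ T
  same {T} {T′} bk t = subst (λ p → BK c p T′ T) (sym (bk-firstRow 2+c≢ bk)) (bk-sym (rows t) bk)

  f-involutive : ∀ {T} → SSYT T → f (f T) ≡ T
  f-involutive t = let bk , t′ = f-bk t in bk-functional (proj₁ (f-bk t′)) (same bk t)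

  inj : ∀ {T U} → T ∈ tableaux μ m → U ∈ tableaux μ m → f T ≡ f U → T ≡ U
  inj p q e = let t , _ = tableau⁻ {m} p ; u , _ = tableau⁻ {m} q in
    ≡-trans (sym (f-involutive t)) (≡-trans (cong f e) (f-involutive u))

  surj : ∀ {T} → T ∈ tableaux μ m′ → ∃[ U ] U ∈ tableaux μ m × f U ≡ T
  surj {T} p = let t , e , sh = tableau⁻ {m′} p ; bk , t′ = f-bk t in
    f T , tableau⁺ {m} t′ (↭-trans (bk-content bk) (↭-trans (↭.map⁺ _ e) (↭-reflexive (twice m)))) (≡-trans (bk-length bk) sh)
    , f-involutive t
    where
    twice : ∀ m → map (transpose c (suc c)) (map (transpose c (suc c)) m) ≡ m
    twice []      = refl
    twice (x ∷ m) = cong₂ _∷_ (transpose-involutive c (suc c) x) (twice m)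

-- From adjacent transpositions to all permutations of the variables

transpose-comm : ∀ a b x → transpose a b x ≡ transpose b a x
transpose-comm a b x with x ≟ a | x ≟ b
... | yes refl | yes refl = refl
... | yes refl | no _     = ≡-trans (transpose-left a b) (sym (transpose-right b a))
... | no _     | yes refl = ≡-trans (transpose-right a b) (sym (transpose-left b a))
... | no p     | no q     = ≡-trans (transpose-other p q) (sym (transpose-other q p))

-- Conjugation by an adjacent transposition brings the two exchanged letters one step closer, which
-- allows induction on their distance.
transpose-conjugate : ∀ {a b} → a < b → ∀ x →
  transpose a (suc b) x ≡ transpose b (suc b) (transpose a b (transpose b (suc b) x))
transpose-conjugate {a} {b} a<b x with x ≟ b
... | yes refl = begin
  transpose a (suc b) b                                     ≡⟨ transpose-other (>⇒≢ a<b) (<⇒≢ ≤-refl) ⟩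
  b                                                         ≡⟨ transpose-right b (suc b) ⟨
  transpose b (suc b) (suc b)                               ≡⟨ cong (transpose b (suc b)) (transpose-other (>⇒≢ (m<n⇒m<1+n a<b)) (>⇒≢ ≤-refl)) ⟨
  transpose b (suc b) (transpose a b (suc b))               ≡⟨ cong (transpose b (suc b) ∘ transpose a b) (transpose-left b (suc b)) ⟨
  transpose b (suc b) (transpose a b (transpose b (suc b) b)) ∎
  where open ≡-Reasoning
... | no x≢b with x ≟ suc b
...   | yes refl = begin
  transpose a (suc b) (suc b)                               ≡⟨ transpose-right a (suc b) ⟩
  a                                                         ≡⟨ transpose-other (<⇒≢ a<b) (<⇒≢ (m<n⇒m<1+n a<b)) ⟨
  transpose b (suc b) a                                     ≡⟨ cong (transpose b (suc b)) (transpose-right a b) ⟨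
  transpose b (suc b) (transpose a b b)                     ≡⟨ cong (transpose b (suc b) ∘ transpose a b) (transpose-right b (suc b)) ⟨
  transpose b (suc b) (transpose a b (transpose b (suc b) (suc b))) ∎
  where open ≡-Reasoning
...   | no x≢1+b with x ≟ a
...     | yes refl = begin
  transpose a (suc b) a                                     ≡⟨ transpose-left a (suc b) ⟩
  suc b                                                     ≡⟨ transpose-left b (suc b) ⟨
  transpose b (suc b) b                                     ≡⟨ cong (transpose b (suc b)) (transpose-left a b) ⟨
  transpose b (suc b) (transpose a b a)                     ≡⟨ cong (transpose b (suc b) ∘ transpose a b) (transpose-other x≢b x≢1+b) ⟨
  transpose b (suc b) (transpose a b (transpose b (suc b) a)) ∎
  where open ≡-Reasoning
...     | no x≢a = begin
  transpose a (suc b) x                                     ≡⟨ transpose-other x≢a x≢1+b ⟩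
  x                                                         ≡⟨ transpose-other x≢b x≢1+b ⟨
  transpose b (suc b) x                                     ≡⟨ cong (transpose b (suc b)) (transpose-other x≢a x≢b) ⟨
  transpose b (suc b) (transpose a b x)                     ≡⟨ cong (transpose b (suc b) ∘ transpose a b) (transpose-other x≢b x≢1+b) ⟨
  transpose b (suc b) (transpose a b (transpose b (suc b) x)) ∎
  where open ≡-Reasoning

-- On finitely many letters, every permutation of ℕ is a product of adjacent transpositions.
adjacent⇒symmetric : ∀ {f : PowerSeries} → (∀ c m → f (map (transpose c (suc c)) m) ≡ f m) → Symmetric f
adjacent⇒symmetric {f} adjacent φ m = go
  where
  open ≡-Reasoning
  to = Inverse.to φ

  increasing : ∀ {a b} → a <′ b → ∀ m → f (map (transpose a b) m) ≡ f m
  increasing {a} <′-base m = adjacent a m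
  increasing {a} (<′-step {b} p) m = begin
    f (map (transpose a (suc b)) m)
      ≡⟨ cong f (List.map-cong (transpose-conjugate (<′⇒< p)) m) ⟩
    f (map (transpose b (suc b) ∘ transpose a b ∘ transpose b (suc b)) m)
      ≡⟨ cong f (List.map-∘ m) ⟩
    f (map (transpose b (suc b)) (map (transpose a b ∘ transpose b (suc b)) m))
      ≡⟨ adjacent b _ ⟩
    f (map (transpose a b ∘ transpose b (suc b)) m)
      ≡⟨ cong f (List.map-∘ m) ⟩
    f (map (transpose a b) (map (transpose b (suc b)) m))
      ≡⟨ increasing p _ ⟩
    f (map (transpose b (suc b)) m)
      ≡⟨ adjacent b m ⟩
    f m ∎

  any : ∀ a b m → f (map (transpose a b) m) ≡ f m
  any a b m with <-cmp a b
  ... | tri< a<b _ _  = increasing (<⇒<′ a<b) m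
  ... | tri> _ _ b<a  = ≡-trans (cong f (List.map-cong (transpose-comm a b) m)) (increasing (<⇒<′ b<a) m)
  ... | tri≈ _ refl _ = cong f (≡-trans (List.map-cong idle m) (List.map-id m))
    where
    idle : ∀ x → transpose a a x ≡ x
    idle x with x ≟ a
    ... | yes refl = transpose-left a a
    ... | no p     = transpose-other p p

  record Product (V : List ℕ) : Set where
    field
      ψ         : ℕ → ℕ
      injective : ∀ {x y} → ψ x ≡ ψ y → x ≡ y
      agrees    : ∀ {x} → x ∈ V → ψ x ≡ to x
      preserves : ∀ m → f (map ψ m) ≡ f m

  to-injective : ∀ {x y} → to x ≡ to y → x ≡ y
  to-injective {x} {y} e = ≡-trans (sym (Inverse.strictlyInverseʳ φ x)) (≡-trans (cong (Inverse.from φ) e) (Inverse.strictlyInverseʳ φ y))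

  transpose-injective : ∀ a b {x y} → transpose a b x ≡ transpose a b y → x ≡ y
  transpose-injective a b {x} {y} e =
    ≡-trans (sym (transpose-involutive a b x)) (≡-trans (cong (transpose a b) e) (transpose-involutive a b y))

  product : ∀ V → Product V
  product [] = record { ψ = id ; injective = id ; agrees = λ () ; preserves = λ m → cong f (List.map-id m) }
  product (v ∷ V) with product V | v ∈? V
    where open import Data.List.Membership.DecPropositional _≟_ using (_∈?_)
  ... | P | yes v∈ = record { Product P ; agrees = λ { (here refl) → Product.agrees P v∈ ; (there p) → Product.agrees P p } }
  -- One more transposition, of ψ v and φ v, corrects the value at v. Neither of these is a value of
  -- ψ on V, so the agreement on V is not disturbed.
  ... | P | no v∉ = record
    { ψ         = τ ∘ ψ
    ; injective = injective ∘ transpose-injective (ψ v) (to v)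
    ; agrees    = λ { (here refl) → transpose-left (ψ v) (to v)
                    ; (there {x} p) → ≡-trans (transpose-other (other p) (other′ p)) (agrees p) }
    ; preserves = λ m → ≡-trans (cong f (List.map-∘ m)) (≡-trans (any (ψ v) (to v) (map ψ m)) (preserves m))
    }
    where
    open Product P
    τ = transpose (ψ v) (to v)
    other : ∀ {x} → x ∈ V → ψ x ≢ ψ v
    other p e = v∉ (subst (_∈ V) (injective e) p)
    other′ : ∀ {x} → x ∈ V → ψ x ≢ to v
    other′ p e = v∉ (subst (_∈ V) (to-injective (≡-trans (sym (agrees p)) e)) p)

  go : f (map to m) ≡ f m
  go = ≡-trans (cong f (map-cong-∈ m (λ p → sym (Product.agrees P p)))) (Product.preserves P m)
    where
    P = product m
    map-cong-∈ : ∀ {g h : ℕ → ℕ} xs → (∀ {x} → x ∈ xs → g x ≡ h x) → map g xs ≡ map h xs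
    map-cong-∈ []       _ = refl
    map-cong-∈ (x ∷ xs) e = cong₂ _∷_ (e (here refl)) (map-cong-∈ xs (e ∘ there))

schur-symmetric : ∀ {n μ} → Partition n μ → Symmetric (s μ)
schur-symmetric {μ = μ} pt = adjacent⇒symmetric {s μ} (schur-transpose pt)

schurExpansion⇒nonnegative : ∀ {n f} → SchurExpansion n f → SchurNonnegative n f
schurExpansion⇒nonnegative {n} {f} (schur c c≥0 e) = symmetric , c , c≥0 , e
  where
  sums : ∀ μs → All (λ μ → Symmetric (s μ)) μs → Symmetric (Σ[ μs ] (λ μ → c μ · s μ))
  sums []       []      φ m = refl
  sums (μ ∷ μs) (p ∷ q) φ m = cong₂ ℤ._+_ (cong (c μ ℤ.*_) (p φ m)) (sums μs q φ m)
  symmetric : Symmetric f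
  symmetric φ m = ≡-trans (e _) (≡-trans (sums (partitions n) (All.tabulate λ p → schur-symmetric (∈-partitions⁻ {n} p)) φ m) (sym (e m)))

-- Hook shapes

trues : ∀ {n} → Vec Bool n → ℕ
trues []          = 0
trues (true ∷ S)  = suc (trues S)
trues (false ∷ S) = trues S

arm leg : ∀ {n} → Vec Bool n → Vec ℕ n → List ℕ
arm []          []      = []
arm (true ∷ S)  (y ∷ i) = arm S i
arm (false ∷ S) (y ∷ i) = y ∷ arm S i
leg []          []      = []
leg (true ∷ S)  (y ∷ i) = y ∷ leg S i
leg (false ∷ S) (y ∷ i) = leg S i

-- Each bit of S is aligned with the entry after its position. The first entry has no bit and
-- becomes the corner.
hook : ∀ {n} → Subset (n ∸ 1) → Vec ℕ n → Tableau
hook S []      = []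
hook S (x ∷ i) = (x ∷ arm S i) ∷ map [_] (leg S i)

length-leg : ∀ {n} (S : Vec Bool n) i → length (leg S i) ≡ trues S
length-leg []          []      = refl
length-leg (true ∷ S)  (y ∷ i) = cong suc (length-leg S i)
length-leg (false ∷ S) (y ∷ i) = length-leg S i

arm-leg-↭ : ∀ {n} (S : Vec Bool n) i → arm S i ++ leg S i ↭ toList i
arm-leg-↭ []          []      = ↭-refl
arm-leg-↭ (true ∷ S)  (y ∷ i) = ↭-trans (↭.shift y (arm S i) (leg S i)) (prep y (arm-leg-↭ S i))
arm-leg-↭ (false ∷ S) (y ∷ i) = prep y (arm-leg-↭ S i)

concat-map-[_] : (xs : List A) → concat (map [_] xs) ≡ xs
concat-map-[_] []       = refl
concat-map-[_] (x ∷ xs) = cong (x ∷_) (concat-map-[_] xs)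

hook-↭ : ∀ {n} (S : Subset (n ∸ 1)) (i : Vec ℕ n) → concat (hook S i) ↭ toList i
hook-↭ S []      = ↭-refl
hook-↭ S (x ∷ i) = prep x (subst (λ xs → arm S i ++ xs ↭ toList i) (sym (concat-map-[_] (leg S i))) (arm-leg-↭ S i))

module _ where
  private
    variable
      n : ℕ
      S : Vec Bool n
      i : Vec ℕ n
      x : ℕ

  compatible-≤ : Compatible S (x ∷ i) → All (x ≤_) (toList i)
  compatible-≤ {S = []}    {i = []}    _           = []
  compatible-≤ {S = _ ∷ S} {i = _ ∷ i} (p , _ , c) = p ∷ All.map (≤-trans p) (compatible-≤ {S = S} c)

  compatible-sorted : Compatible S (x ∷ i) → Sorted (x ∷ toList i)
  compatible-sorted {S = []}    {i = []}    _             = [] ∷ []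
  compatible-sorted {S = s ∷ S} {i = _ ∷ i} h@(_ , _ , c) = compatible-≤ {S = s ∷ S} h ∷ compatible-sorted {S = S} c

  leg-bounded : Compatible S (x ∷ i) → All (x <_) (leg S i)
  leg-bounded {S = []}        {i = []}    _           = []
  leg-bounded {S = true ∷ S}  {i = _ ∷ i} (_ , q , c) = q refl ∷ All.map (<-trans (q refl)) (leg-bounded {S = S} c)
  leg-bounded {S = false ∷ S} {i = _ ∷ i} (p , _ , c) = All.map (≤-<-trans p) (leg-bounded {S = S} c)

  leg-increasing : Compatible S (x ∷ i) → AllPairs _<_ (leg S i)
  leg-increasing {S = []}        {i = []}    _           = []
  leg-increasing {S = true ∷ S}  {i = _ ∷ i} (_ , _ , c) = leg-bounded {S = S} c ∷ leg-increasing {S = S} c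
  leg-increasing {S = false ∷ S} {i = _ ∷ i} (_ , _ , c) = leg-increasing {S = S} c

arm-⊑ : ∀ {n} (S : Vec Bool n) i → arm S i ⊑ toList i
arm-⊑ []          []      = []
arm-⊑ (true ∷ S)  (y ∷ i) = y ∷ʳ arm-⊑ S i
arm-⊑ (false ∷ S) (y ∷ i) = refl ∷ arm-⊑ S i

hook-ssyt : ∀ {n} (S : Subset (n ∸ 1)) (i : Vec ℕ n) → Compatible S i → SSYT (hook S i)
hook-ssyt S []      _ = ssyt [] [] []
hook-ssyt S (x ∷ i) c = ssyt
  (⊑-AllPairs (refl ∷ arm-⊑ S i) (compatible-sorted {S = S} c) ∷ All.map⁺ (All.universal (λ _ → [] ∷ []) (leg S i)))
  (column (leg-bounded {S = S} c) (leg-increasing {S = S} c))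
  (s≤s z≤n ∷ All.map⁺ (All.universal (λ _ → s≤s z≤n) (leg S i)))
  where
  column : ∀ {x r ys} → All (x <_) ys → AllPairs _<_ ys → Linked Dominates ((x ∷ r) ∷ map [_] ys)
  column []      []      = [-]
  column (p ∷ _) (q ∷ s) = (p ∷ []) ∷ column q s

-- At the first place where the sets differ, one leg starts with y and the other contains only
-- entries above y.
compatible-leg-injective : ∀ {n x} (S S′ : Vec Bool n) i → Compatible S (x ∷ i) → Compatible S′ (x ∷ i) →
                           leg S i ≡ leg S′ i → S ≡ S′
compatible-leg-injective []          []           []      _           _           _ = refl
compatible-leg-injective (true ∷ S)  (true ∷ S′)  (y ∷ i) (_ , _ , c) (_ , _ , c′) e =
  cong (true ∷_) (compatible-leg-injective S S′ i c c′ (List.∷-injectiveʳ e))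
compatible-leg-injective (false ∷ S) (false ∷ S′) (y ∷ i) (_ , _ , c) (_ , _ , c′) e =
  cong (false ∷_) (compatible-leg-injective S S′ i c c′ e)
compatible-leg-injective (true ∷ S)  (false ∷ S′) (y ∷ i) _ (_ , _ , c′) e =
  ⊥-elim (<-irrefl refl (All.head (subst (All (y <_)) (sym e) (leg-bounded {S = S′} c′))))
compatible-leg-injective (false ∷ S) (true ∷ S′)  (y ∷ i) (_ , _ , c) _ e =
  ⊥-elim (<-irrefl refl (All.head (subst (All (y <_)) e (leg-bounded {S = S} c))))

map-[_]-injective : ∀ {xs ys : List A} → map [_] xs ≡ map [_] ys → xs ≡ ys
map-[_]-injective {xs = xs} {ys} e = ≡-trans (sym (concat-map-[_] xs)) (≡-trans (cong concat e) (concat-map-[_] ys))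

hook-injective : ∀ {n} {S S′ : Subset (n ∸ 1)} {i i′ : Vec ℕ n} → Compatible S i → Compatible S′ i′ →
                 hook S i ≡ hook S′ i′ → S ≡ S′ × i ≡ i′
hook-injective {zero}  {[]} {[]} {[]} {[]} _ _ _ = refl , refl
hook-injective {suc n} {S} {S′} {x ∷ i} {x′ ∷ i′} c c′ e = conclude i≡ c′ e
  where
  i≡ : x ∷ i ≡ x′ ∷ i′
  i≡ = toList-inj (sorted-unique ≤-antisym (compatible-sorted {S = S} c) (compatible-sorted {S = S′} c′)
    (↭-trans (↭-sym (hook-↭ S (x ∷ i))) (↭-trans (↭-reflexive (cong concat e)) (hook-↭ S′ (x′ ∷ i′)))))
  conclude : ∀ {j} → x ∷ i ≡ j → Compatible S′ j → hook S (x ∷ i) ≡ hook S′ j → S ≡ S′ × x ∷ i ≡ j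
  conclude refl c′ e = compatible-leg-injective S S′ i c c′ (map-[_]-injective (List.∷-injectiveʳ e)) , refl

-- A leg entry must exceed its predecessor strictly, so it has to precede the arm entries equal to
-- it: ties go to the leg.
merge : ∀ {x} n r l → length r + length l ≡ n → All (x ≤_) r → Sorted r → All (x <_) l → AllPairs _<_ l →
  ∃₂ λ S (i : Vec ℕ n) → Compatible S (x ∷ i) × arm S i ≡ r × leg S i ≡ l
merge zero    []      []      _ _ _ _ _ = [] , [] , tt , refl , refl
merge (suc n) (a ∷ r) []      e (p ∷ _) (q ∷ s) _ _ =
  let S , i , c , e₁ , e₂ = merge n r [] (suc-injective e) q s [] []
  in false ∷ S , a ∷ i , (p , (λ ()) , c) , cong (a ∷_) e₁ , e₂
merge (suc n) []      (b ∷ l) e _ _ (p ∷ _) (q ∷ s) =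
  let S , i , c , e₁ , e₂ = merge n [] l (suc-injective e) [] [] q s
  in true ∷ S , b ∷ i , (<⇒≤ p , (λ _ → p) , c) , e₁ , cong (b ∷_) e₂
merge (suc n) (a ∷ r) (b ∷ l) e (p ∷ ps) (q ∷ s) (u ∷ us) (v ∷ t) with b ≤? a
... | yes b≤a =
  let S , i , c , e₁ , e₂ = merge n (a ∷ r) l (suc-injective (≡-trans (sym (+-suc _ (length l))) e))
                              (b≤a ∷ All.map (≤-trans b≤a) q) (q ∷ s) v t
  in true ∷ S , b ∷ i , (<⇒≤ u , (λ _ → u) , c) , e₁ , cong (b ∷_) e₂
... | no b≰a =
  let S , i , c , e₁ , e₂ = merge n r (b ∷ l) (suc-injective e) q s
                              (≰⇒> b≰a ∷ All.map (<-trans (≰⇒> b≰a)) v) (v ∷ t)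
  in false ∷ S , a ∷ i , (p , (λ ()) , c) , cong (a ∷_) e₁ , e₂

data Hook : List ℕ → Set where
  []   : Hook []
  corner : ∀ {l μ} → All (_≡ 1) μ → Hook (l ∷ μ)

hook? : ∀ μ → Dec (Hook μ)
hook? []      = yes []
hook? (l ∷ μ) = map′ corner (λ { (corner p) → p }) (All.all? (_≟ 1) μ)

hook-shape : ∀ {n} (S : Subset (n ∸ 1)) (i : Vec ℕ n) →
             Hook (map length (hook S i)) × length (map length (hook S i)) ∸ 1 ≡ trues S
hook-shape [] []      = [] , refl
hook-shape S (x ∷ i) = corner (All.map⁺ (All.map⁺ (All.universal (λ _ → refl) (leg S i))))
  , ≡-trans (List.length-map length (map [_] (leg S i))) (≡-trans (List.length-map [_] (leg S i)) (length-leg S i))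

hook-surjective : ∀ {n T} → SSYT T → Partition n (map length T) → Hook (map length T) →
  ∃₂ λ S (i : Vec ℕ n) → Compatible S i × hook S i ≡ T × trues S ≡ length (map length T) ∸ 1
hook-surjective {T = []} _ (partition _ refl _) _ = [] , [] , tt , refl , refl
hook-surjective {T = [] ∷ T} (ssyt _ _ (() ∷ _)) _ _
hook-surjective {T = (x ∷ r) ∷ T} (ssyt ((p ∷ s) ∷ _) c _) (partition _ refl _) (corner h)
  with singles T h
  where
  singles : ∀ T → All (_≡ 1) (map length T) → ∃[ l ] T ≡ map [_] l
  singles []            []      = [] , refl
  singles ((y ∷ []) ∷ T) (_ ∷ h) = let l , e = singles T h in y ∷ l , cong ([ y ] ∷_) e
... | l , refl =
  let S , i , cp , e₁ , e₂ = merge _ r l (cong (λ k → length r + k) (sizes l)) p s (AllPairs.head (increasing c)) (AllPairs.tail (increasing c))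
  in S , x ∷ i , cp , cong₂ (λ r l → (x ∷ r) ∷ map [_] l) e₁ e₂
     , ≡-trans (sym (length-leg S i)) (≡-trans (cong length e₂) (sym (≡-trans (List.length-map length (map [_] l)) (List.length-map [_] l))))
  where
  sizes : ∀ l → length l ≡ sum (map length (map {B = List ℕ} [_] l))
  sizes []      = refl
  sizes (y ∷ l) = cong suc (sizes l)
  increasing : ∀ {x r l} → Linked Dominates ((x ∷ r) ∷ map [_] l) → AllPairs _<_ (x ∷ l)
  increasing = Linked.Linked⇒AllPairs <-trans ∘ linked
    where
    linked : ∀ {x r l} → Linked Dominates ((x ∷ r) ∷ map [_] l) → Linked _<_ (x ∷ l)
    linked {l = []}    _             = [-]
    linked {l = _ ∷ _} ((p ∷ _) ∷ c) = p ∷ linked c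

-- Classes of permutations determined by their descent sets

record DescentClass (n : ℕ) (Π : List (Vec ℕ 3)) (K : ℕ → Set) : Set where
  field
    injective  : ∀ {σ σ′ : Vec ℕ n} → σ ∈ 𝔖-avoiding n Π → σ′ ∈ 𝔖-avoiding n Π → Des σ ≡ Des σ′ → σ ≡ σ′
    sound      : ∀ {σ : Vec ℕ n} → σ ∈ 𝔖-avoiding n Π → K (trues (Des σ))
    surjective : ∀ (S : Subset (n ∸ 1)) → K (trues S) → ∃[ σ ] σ ∈ 𝔖-avoiding n Π × Des σ ≡ S

-- A hook with leg length d gets coefficient 1 if d lies in K, and every other shape 0; the label
-- list R accordingly holds `tt` or nothing.
hookExpansion : ∀ {n Π K} → (∀ d → Dec (K d)) → DescentClass n Π K → SchurExpansion n (Q n Π)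
hookExpansion {n} {Π} {K} K? class = expansion n (Q n Π) R (schurExpansion n Π R R! φ into inj surj)
  where
  open DescentClass class

  -- Truncated subtraction gives the empty shape, which occurs for n = 0, leg length 0, in agreement
  -- with the empty descent set.
  good? : ∀ μ → Dec (Hook μ × K (length μ ∸ 1))
  good? μ = hook? μ ×-dec K? (length μ ∸ 1)

  R : List ℕ → List ⊤
  R μ = filter (λ _ → good? μ) [ tt ]

  R! : ∀ μ → Unique (R μ)
  R! μ = Unique.filter⁺ (λ _ → good? μ) ([] ∷ [])

  φ : Vec ℕ n × Vec ℕ n → Tableau × ⊤
  φ (σ , i) = hook (Des σ) i , tt

  into : ∀ {σ i} → Biword n Π (σ , i) → let T , b = φ (σ , i) in
         Semistandard T × Partition n (map length T) × b ∈ R (map length T) × concat T ↭ toList i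
  into {σ} {i} (σ∈ , c) =
    let t = hook-ssyt (Des σ) i c
        e = hook-↭ (Des σ) i
        h , d = hook-shape (Des σ) i
    in ssyt⇒semistandard t
     , subst (λ k → Partition k (map length (hook (Des σ) i))) (≡-trans (↭.↭-length e) (Vec.length-toList i)) (ssyt⇒partition t)
     , ∈-filter⁺ (λ _ → good? (map length (hook (Des σ) i))) (here refl) (h , subst K (sym d) (sound σ∈))
     , e

  inj : ∀ {x y} → Biword n Π x → Biword n Π y → φ x ≡ φ y → x ≡ y
  inj (σ∈ , c) (σ′∈ , c′) e =
    let S≡ , i≡ = hook-injective c c′ (cong proj₁ e) in cong₂ _,_ (injective σ∈ σ′∈ S≡) i≡

  surj : ∀ {T b} → Semistandard T → Partition n (map length T) → b ∈ R (map length T) →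
         ∃[ x ] Biword n Π x × φ x ≡ (T , b)
  surj {T} ss pt b∈ =
    let _ , h , k = ∈-filter⁻ (λ _ → good? (map length T)) {xs = [ tt ]} b∈
        S , i , c , T≡ , d = hook-surjective (semistandard⇒ssyt ss pt) pt h
        σ , σ∈ , S≡ = surjective S (subst K (sym d) k)
    in (σ , i) , (σ∈ , subst (λ S → Compatible S i) (sym S≡) c) , cong (_, tt) (≡-trans (cong (λ S → hook S i) S≡) T≡)

-- Permutations determined by their descent sets

count : ∀ {n} → Bool → Vec Bool n → ℕ
count true  S = trues S
count false S = trues (Vec.map not S)

count-false : ∀ {n} (S : Vec Bool n) → count false S ≡ n ∸ trues S
count-false {n} S = ≡-trans (sym (m+n∸m≡n (trues S) (count false S))) (cong (_∸ trues S) (total S))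
  where
  total : ∀ {n} (S : Vec Bool n) → trues S + count false S ≡ n
  total []          = refl
  total (true ∷ S)  = cong suc (total S)
  total (false ∷ S) = ≡-trans (+-suc (trues S) _) (cong suc (total S))

count-∷ : ∀ {n} t (S : Vec Bool n) → count t (t ∷ S) ≡ suc (count t S)
count-∷ true  S = refl
count-∷ false S = refl

count-≤ : ∀ {n} t u (S : Vec Bool n) → count t S ≤ count t (u ∷ S)
count-≤ true  true  S = n≤1+n _
count-≤ true  false S = ≤-refl
count-≤ false true  S = ≤-refl
count-≤ false false S = n≤1+n _

count-not : ∀ {n} t (S : Vec Bool n) → count t (not t ∷ S) ≡ count t S
count-not true  S = refl
count-not false S = refl

infix 4 _⊏[_]_
-- The relation between the two sides of a descent (`true`) or an ascent (`false`), so that 321 and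
-- 123 are treated at once.
_⊏[_]_ : ℕ → Bool → ℕ → Set
a ⊏[ true ]  b = b < a
a ⊏[ false ] b = a < b

⊏-trans : ∀ t {a b c} → a ⊏[ t ] b → b ⊏[ t ] c → a ⊏[ t ] c
⊏-trans true  p q = <-trans q p
⊏-trans false p q = <-trans p q

⊏-irrefl : ∀ t {a} → ¬ a ⊏[ t ] a
⊏-irrefl true  = <-irrefl refl
⊏-irrefl false = <-irrefl refl

bit : ℕ → ℕ → Bool
bit a b = does (b <? a)

bit-cases : ∀ t {a b} → a ≢ b → (bit a b ≡ t × a ⊏[ t ] b) ⊎ (bit a b ≡ not t × b ⊏[ t ] a)
bit-cases t {a} {b} a≢b with <-cmp a b
bit-cases true  {a} {b} a≢b | tri< a<b _ _ = inj₂ (dec-false (b <? a) (<-asym a<b) , a<b)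
bit-cases false {a} {b} a≢b | tri< a<b _ _ = inj₁ (dec-false (b <? a) (<-asym a<b) , a<b)
bit-cases t     {a} {b} a≢b | tri≈ _ e _   = ⊥-elim (a≢b e)
bit-cases true  {a} {b} a≢b | tri> _ _ b<a = inj₁ (dec-true (b <? a) b<a , b<a)
bit-cases false {a} {b} a≢b | tri> _ _ b<a = inj₂ (dec-true (b <? a) b<a , b<a)

head-≢ : ∀ {a b : ℕ} {w} → Unique (a ∷ b ∷ w) → a ≢ b
head-≢ ((p ∷ _) ∷ _) = p

-- If the step from a to b is of the other kind, b can replace a in the pair, since b ⊏ a ⊏ y.
pair⇒count : ∀ t {n} (σ : Vec ℕ n) {x y} → Unique (toList σ) → x ∷ y ∷ [] ⊑ toList σ → x ⊏[ t ] y →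
             1 ≤ count t (Des σ)
pair⇒count t (a ∷ [])    u (_ ∷ʳ ()) p
pair⇒count t (a ∷ [])    u (refl ∷ ()) p
pair⇒count t (a ∷ b ∷ w) (_ ∷ u) (_ ∷ʳ q)   p = ≤-trans (pair⇒count t (b ∷ w) u q p) (count-≤ t (bit a b) (Des (b ∷ w)))
pair⇒count t (a ∷ b ∷ w) U@(_ ∷ u) (refl ∷ q) p with bit-cases t (head-≢ U) | q
... | inj₁ (e , _) | _ rewrite e = subst (1 ≤_) (sym (count-∷ t (Des (b ∷ w)))) (s≤s z≤n)
... | inj₂ (e , b⊏a) | refl ∷ _ = ⊥-elim (⊏-irrefl t (⊏-trans t b⊏a p))
... | inj₂ (e , b⊏a) | _ ∷ʳ q′ = ≤-trans (pair⇒count t (b ∷ w) u (refl ∷ q′) (⊏-trans t b⊏a p)) (count-≤ t (bit a b) (Des (b ∷ w)))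

triple⇒count : ∀ t {n} (σ : Vec ℕ n) {x y z} → Unique (toList σ) → x ∷ y ∷ z ∷ [] ⊑ toList σ →
               x ⊏[ t ] y → y ⊏[ t ] z → 2 ≤ count t (Des σ)
triple⇒count t (a ∷ [])    u (_ ∷ʳ ()) p p′
triple⇒count t (a ∷ [])    u (refl ∷ ()) p p′
triple⇒count t (a ∷ b ∷ w) (_ ∷ u) (_ ∷ʳ q)   p p′ = ≤-trans (triple⇒count t (b ∷ w) u q p p′) (count-≤ t (bit a b) (Des (b ∷ w)))
triple⇒count t (a ∷ b ∷ w) U@(_ ∷ u) (refl ∷ q) p p′ with bit-cases t (head-≢ U) | q
... | inj₁ (e , _) | _ rewrite e = subst (2 ≤_) (sym (count-∷ t (Des (b ∷ w)))) (s≤s (pair⇒count t (b ∷ w) u q p′))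
... | inj₂ (e , b⊏a) | refl ∷ _ = ⊥-elim (⊏-irrefl t (⊏-trans t b⊏a p))
... | inj₂ (e , b⊏a) | _ ∷ʳ q′ = ≤-trans (triple⇒count t (b ∷ w) u (refl ∷ q′) (⊏-trans t b⊏a p) p′) (count-≤ t (bit a b) (Des (b ∷ w)))

count⇒pair : ∀ t {n} (σ : Vec ℕ n) → Unique (toList σ) → 1 ≤ count t (Des σ) →
             ∃₂ λ x y → x ∷ y ∷ [] ⊑ toList σ × x ⊏[ t ] y
count⇒pair true  []       u ()
count⇒pair false []       u ()
count⇒pair true  (a ∷ []) u ()
count⇒pair false (a ∷ []) u ()
count⇒pair t (a ∷ b ∷ w) U@(_ ∷ u) h with bit-cases t (head-≢ U)
... | inj₁ (_ , a⊏b) = a , b , refl ∷ refl ∷ minimum _ , a⊏b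
... | inj₂ (e , _) rewrite e =
  let x , y , q , p = count⇒pair t (b ∷ w) u (subst (1 ≤_) (count-not t (Des (b ∷ w))) h)
  in x , y , a ∷ʳ q , p

Triple : Set₁
Triple = ℕ → ℕ → ℕ → Set

Free : ∀ {n} → Triple → Vec ℕ n → Set
Free Bad σ = ∀ a x y → a ∷ x ∷ y ∷ [] ⊑ toList σ → ¬ Bad a x y

free-tail : ∀ {n Bad a} {w : Vec ℕ n} → Free Bad (a ∷ w) → Free Bad w
free-tail f a x y q = f a x y (_ ∷ʳ q)

-- Two steps of the same kind need not give a monotone triple: 2143 has two descents but no 321.
-- This condition supplies what is missing, a later pair of that kind that lies beyond a.
Extends : Bool → Triple → Set
Extends t Bad = ∀ {n a b} {w : Vec ℕ n} → Unique (toList (a ∷ b ∷ w)) → Free Bad (a ∷ b ∷ w) → a ⊏[ t ] b →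
                1 ≤ count t (Des (b ∷ w)) → ∃₂ λ x y → x ∷ y ∷ [] ⊑ b ∷ toList w × a ⊏[ t ] x × x ⊏[ t ] y

count⇒triple : ∀ t {Bad n} (σ : Vec ℕ n) → Extends t Bad → Unique (toList σ) → Free Bad σ → 2 ≤ count t (Des σ) →
               ∃₂ λ x y → ∃[ z ] x ∷ y ∷ z ∷ [] ⊑ toList σ × x ⊏[ t ] y × y ⊏[ t ] z
count⇒triple true  []       ext u f ()
count⇒triple false []       ext u f ()
count⇒triple true  (a ∷ []) ext u f ()
count⇒triple false (a ∷ []) ext u f ()
count⇒triple t (a ∷ b ∷ w) ext U@(_ ∷ u) f h with bit-cases t (head-≢ U)
... | inj₁ (e , a⊏b) rewrite e =
  let x , y , q , p = ext U f a⊏b (≤-pred (subst (2 ≤_) (count-∷ t (Des (b ∷ w))) h))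
  in a , x , y , refl ∷ q , p
... | inj₂ (e , _) rewrite e =
  let x , y , z , q , p = count⇒triple t (b ∷ w) ext u (free-tail {a = a} {b ∷ w} f)
                            (subst (2 ≤_) (count-not t (Des (b ∷ w))) h)
  in x , y , z , a ∷ʳ q , p

-- The increasing map that skips the value a; it relabels a permutation so that a can be put in
-- front.
punch : ℕ → ℕ → ℕ
punch a x = if does (x <? a) then x else suc x

punch-< : ∀ {a x} → x < a → punch a x ≡ x
punch-< {a} {x} p rewrite dec-true (x <? a) p = refl

punch-≥ : ∀ {a x} → a ≤ x → punch a x ≡ suc x
punch-≥ {a} {x} p rewrite dec-false (x <? a) (≤⇒≯ p) = refl

punch-mono : ∀ a {x y} → x < y → punch a x < punch a y
punch-mono a {x} {y} p with x <? a | y <? a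
... | yes q | yes r = subst₂ _<_ (sym (punch-< q)) (sym (punch-< r)) p
... | yes q | no r  = subst₂ _<_ (sym (punch-< q)) (sym (punch-≥ (≮⇒≥ r))) (m<n⇒m<1+n p)
... | no q  | yes r = ⊥-elim (q (<-trans p r))
... | no q  | no r  = subst₂ _<_ (sym (punch-≥ (≮⇒≥ q))) (sym (punch-≥ (≮⇒≥ r))) (s≤s p)

punch-cancel-< : ∀ a {x y} → punch a x < punch a y → x < y
punch-cancel-< a {x} {y} p with <-cmp x y
... | tri< q _ _    = q
... | tri≈ _ refl _ = ⊥-elim (<-irrefl refl p)
... | tri> _ _ q    = ⊥-elim (<-asym p (punch-mono a q))

punch<⁻ : ∀ {a x} → punch a x < a → x < a
punch<⁻ {a} {x} p with x <? a
... | yes q = q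
... | no q  = ⊥-elim (q (<-trans (n<1+n x) (subst (_< a) (punch-≥ (≮⇒≥ q)) p)))

<punch⁻ : ∀ {a x} → a < punch a x → a ≤ x
<punch⁻ {a} {x} p with x <? a
... | yes q = ⊥-elim (<-asym q (subst (a <_) (punch-< q) p))
... | no q  = ≮⇒≥ q

punch-≢ : ∀ a x → punch a x ≢ a
punch-≢ a x e with x <? a
... | yes q = <⇒≢ q (≡-trans (sym (punch-< q)) e)
... | no q  = >⇒≢ (s≤s (≮⇒≥ q)) (≡-trans (sym (punch-≥ (≮⇒≥ q))) e)

punch-≤ : ∀ a x → punch a x ≤ suc x
punch-≤ a x with x <? a
... | yes q = subst (_≤ suc x) (sym (punch-< q)) (n≤1+n x)
... | no q  = ≤-reflexive (punch-≥ (≮⇒≥ q))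

punch-positive : ∀ a {x} → 1 ≤ x → 1 ≤ punch a x
punch-positive a {x} p with x <? a
... | yes q = subst (1 ≤_) (sym (punch-< q)) p
... | no q  = subst (1 ≤_) (sym (punch-≥ (≮⇒≥ q))) (s≤s z≤n)

bit-punch : ∀ a x y → bit (punch a x) (punch a y) ≡ bit x y
bit-punch a x y with y <? x
... | yes q = ≡-trans (dec-true (punch a y <? punch a x) (punch-mono a q)) (sym (dec-true (y <? x) q))
... | no q  = ≡-trans (dec-false (punch a y <? punch a x) (q ∘ punch-cancel-< a)) (sym (dec-false (y <? x) q))

Des-punch : ∀ a {n} (w : Vec ℕ n) → Des (Vec.map (punch a) w) ≡ Des w
Des-punch a []          = refl
Des-punch a (x ∷ [])    = refl
Des-punch a (x ∷ y ∷ w) = cong₂ _∷_ (bit-punch a x y) (Des-punch a (y ∷ w))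

-- The rank of the first entry of a permutation in the class among all its entries is a function of
-- the descent set, so that a permutation in the class is determined by its descent set.
record RankedClass (Bad : Triple) : Set₁ where
  field
    rank         : ∀ {n} → Vec Bool n → ℕ
    rank-bounded : ∀ {n} (S : Vec Bool n) → rank S ≤ n
    rank-correct : ∀ {n a} {w : Vec ℕ n} → Unique (a ∷ toList w) → Free Bad (a ∷ w) →
                   lt a (toList w) ≡ rank (Des (a ∷ w))
    bad-punch    : ∀ a {x y z} → Bad (punch a x) (punch a y) (punch a z) → Bad x y z
    -- The last three fields concern putting an entry of rank `rank (t ∷ S)` in front of a
    -- relabelled word: the first bit becomes t, and no bad triple begins at the new entry.
    bit-true     : ∀ {n b} {S : Vec Bool n} → b ≡ suc (rank S) → b ≤ suc n → b ≤ rank (true ∷ S)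
    bit-false    : ∀ {n b} {S : Vec Bool n} → b ≡ suc (rank S) → suc (rank (false ∷ S)) ≤ b
    good         : ∀ {n b t x y} {S : Vec Bool n} {w : Vec ℕ n} → b ≡ suc (rank S) → All (λ z → 1 ≤ z × z ≤ suc n) (b ∷ toList w) →
                   Unique (b ∷ toList w) → Free Bad (b ∷ w) → x ∷ y ∷ [] ⊑ b ∷ toList w →
                   let a = suc (rank (t ∷ S)) in ¬ Bad a (punch a x) (punch a y)

module _ {Bad : Triple} (class : RankedClass Bad) where

  open RankedClass class

  -- The entries of the two words are the same, and the number of smaller ones determines the head.
  -- The tails then satisfy the same hypotheses.
  Des-injective : ∀ {n} (σ σ′ : Vec ℕ n) → Unique (toList σ) → Unique (toList σ′) → Free Bad σ → Free Bad σ′ →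
                  toList σ ↭ toList σ′ → Des σ ≡ Des σ′ → σ ≡ σ′
  Des-injective []      []        _ _ _ _ _ _ = refl
  Des-injective (a ∷ w) (a′ ∷ w′) u u′ f f′ e d =
    conclude heads u′ f′ e d
    where
    ranks : lt a (toList w) ≡ lt a′ (toList w′)
    ranks = ≡-trans (rank-correct u f) (≡-trans (cong rank d) (sym (rank-correct u′ f′)))
    not< : ∀ {a a′ w w′} → a ∷ w ↭ a′ ∷ w′ → lt a w ≡ lt a′ w′ → ¬ a < a′
    not< {a} {a′} {w} {w′} e r a<a′ = 1+n≰n (begin
      suc (lt a′ w′)         ≡⟨ cong suc r ⟨
      suc (lt a w)           ≤⟨ s≤s (lt-mono w (<⇒≤ a<a′)) ⟩
      suc (lt a′ w)          ≡⟨ cong (_+ lt a′ w) (below-yes a<a′) ⟨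
      lt a′ (a ∷ w)          ≡⟨ lt-↭ a′ e ⟩
      lt a′ (a′ ∷ w′)        ≡⟨ cong (_+ lt a′ w′) (below-no {a′} ≤-refl) ⟩
      lt a′ w′               ∎)
      where open ≤-Reasoning
    heads : a ≡ a′
    heads = ≤-antisym (≮⇒≥ (not< (↭-sym e) (sym ranks))) (≮⇒≥ (not< e ranks))
    conclude : ∀ {a″} {w″ : Vec ℕ _} → a ≡ a″ → Unique (a″ ∷ toList w″) → Free Bad (a″ ∷ w″) →
               a ∷ toList w ↭ a″ ∷ toList w″ → Des (a ∷ w) ≡ Des (a″ ∷ w″) → a ∷ w ≡ a″ ∷ w″
    conclude {w″ = w″} refl u″ f″ e d = cong (a ∷_) (Des-injective w w″ (AllPairs.tail u) (AllPairs.tail u″)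
      (free-tail {a = a} {w} f) (free-tail {a = a} {w″} f″) (↭.drop-∷ e) (tails w w″ d))
      where
      tails : ∀ {n} (w w″ : Vec ℕ n) → Des (a ∷ w) ≡ Des (a ∷ w″) → Des w ≡ Des w″
      tails []      []       _ = refl
      tails (_ ∷ _) (_ ∷ _) d = Vec.∷-injectiveʳ d

  -- The rank prescribes the first entry, with 1 added because entries start at 1; the rest is
  -- relabelled around it.
  build : ∀ {n} → Vec Bool n → Vec ℕ (suc n)
  build []      = 1 ∷ []
  build (t ∷ S) = let a = suc (rank (t ∷ S)) in a ∷ Vec.map (punch a) (build S)

  record Realizes {n} (S : Vec Bool n) (v : Vec ℕ (suc n)) : Set where
    field
      bounded : All (λ z → 1 ≤ z × z ≤ suc n) (toList v)
      unique  : Unique (toList v)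
      free    : Free Bad v
      descent : Des v ≡ S
      starts  : Vec.head v ≡ suc (rank S)

  extend : ∀ {n} t (S : Vec Bool n) v → Realizes S v →
           let a = suc (rank (t ∷ S)) in Realizes (t ∷ S) (a ∷ Vec.map (punch a) v)
  extend {n} t S (b ∷ w) R = record
    { bounded = (s≤s z≤n , s≤s (rank-bounded (t ∷ S)))
                ∷ subst (All (λ z → 1 ≤ z × z ≤ 2 + n)) (sym map≡)
                    (All.map⁺ (All.map (λ (p , q) → punch-positive a p , ≤-trans (punch-≤ a _) (s≤s q)) bnd))
    ; unique  = subst (All (a ≢_)) (sym map≡) (All.map⁺ (All.universal (λ x e → punch-≢ a x (sym e)) (b ∷ toList w)))
                ∷ subst Unique (sym map≡) (Unique.map⁺ punch-injective unq)
    ; free    = free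
    ; descent = cong₂ _∷_ first (≡-trans (Des-punch a (b ∷ w)) dsc)
    ; starts  = refl
    }
    where
    open Realizes R renaming (bounded to bnd; unique to unq; free to fre; descent to dsc; starts to hd)
    a = suc (rank (t ∷ S))
    map≡ : toList (Vec.map (punch a) (b ∷ w)) ≡ map (punch a) (b ∷ toList w)
    map≡ = Vec.toList-map (punch a) (b ∷ w)
    punch-injective : ∀ {x y} → punch a x ≡ punch a y → x ≡ y
    punch-injective {x} {y} e with <-cmp x y
    ... | tri< p _ _ = ⊥-elim (<⇒≢ (punch-mono a p) e)
    ... | tri≈ _ p _ = p
    ... | tri> _ _ p = ⊥-elim (>⇒≢ (punch-mono a p) e)
    first : bit a (punch a b) ≡ t
    first = go t refl
      where
      go : ∀ u → t ≡ u → bit a (punch a b) ≡ t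
      go true  refl = let p = s≤s (bit-true hd (proj₂ (All.head bnd))) in
        dec-true (punch a b <? a) (subst (_< a) (sym (punch-< p)) p)
      go false refl = dec-false (punch a b <? a) (λ q → <⇒≱ (punch<⁻ q) (bit-false {S = S} hd))
    free : Free Bad (a ∷ Vec.map (punch a) (b ∷ w))
    free x y z (_ ∷ʳ q) h with ⊑-map⁻ (punch a) (b ∷ toList w) (subst (x ∷ y ∷ z ∷ [] ⊑_) map≡ q)
    ... | x′ ∷ y′ ∷ z′ ∷ [] , r , refl = fre _ _ _ r (bad-punch a h)
    free _ y z (refl ∷ q) h with ⊑-map⁻ (punch a) (b ∷ toList w) (subst (y ∷ z ∷ [] ⊑_) map≡ q)
    ... | y′ ∷ z′ ∷ [] , r , refl = good {t = t} {S = S} hd bnd unq fre r h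

  build-realizes : ∀ {n} (S : Vec Bool n) → Realizes S (build S)
  build-realizes [] = record
    { bounded = (s≤s z≤n , s≤s z≤n) ∷ []
    ; unique  = [] ∷ []
    ; free    = λ { _ _ _ (_ ∷ʳ ()) ; _ _ _ (refl ∷ ()) }
    ; descent = refl
    ; starts  = cong suc (sym (n≤0⇒n≡0 (rank-bounded [])))
    }
  build-realizes (t ∷ S) = extend t S (build S) (build-realizes S)

  Des-surjective : ∀ {n} (S : Subset (n ∸ 1)) → ∃[ σ ] σ ∈ 𝔖 n × Free Bad σ × Des {n} σ ≡ S
  Des-surjective {zero}  [] = [] , here refl , (λ _ _ _ ()) , refl
  Des-surjective {suc n} S = build S , ∈-𝔖⁺ (All.map (uncurry ∈-[1⋯]⁺) bounded) unique , free , descent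
    where open Realizes (build-realizes S)

  descentClass : ∀ {n Π K} → (∀ {σ : Vec ℕ n} → σ ∈ 𝔖 n → Avoids Π σ ⇔ (Free Bad σ × K (trues (Des σ)))) →
                 DescentClass n Π K
  descentClass {n} {Π} {K} char = record
    { injective  = λ {σ} {σ′} p q → let σ∈ , f , _ = member p ; σ′∈ , f′ , _ = member q in
        Des-injective σ σ′ (proj₂ (∈-𝔖⁻ σ∈)) (proj₂ (∈-𝔖⁻ σ′∈)) f f′
          (↭-trans (𝔖-descending σ∈) (↭-sym (𝔖-descending σ′∈)))
    ; sound      = λ p → proj₂ (proj₂ (member p))
    ; surjective = λ S k → let σ , σ∈ , f , e = Des-surjective S in
        σ , ∈-filter⁺ (avoids? Π) σ∈ (Equivalence.from (char σ∈) (f , subst (K ∘ trues) (sym e) k)) , e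
    }
    where
    member : ∀ {σ} → σ ∈ 𝔖-avoiding n Π → σ ∈ 𝔖 n × Free Bad σ × K (trues (Des σ))
    member p = let σ∈ , av = ∈-filter⁻ (avoids? Π) {xs = 𝔖 n} p ; f , k = Equivalence.to (char σ∈) av in σ∈ , f , k

-- The four classes given by two nonmonotone patterns

Bad132 Bad213 Bad231 Bad312 : Triple
Bad132 a x y = a < y × y < x
Bad213 a x y = x < a × a < y
Bad231 a x y = y < a × a < x
Bad312 a x y = x < y × y < a

infixr 6 _∪_
_∪_ : Triple → Triple → Triple
(P ∪ Q) a x y = P a x y ⊎ Q a x y

lt-cong : ∀ {a b} r → (∀ {y} → y ∈ r → y < a → y < b) → (∀ {y} → y ∈ r → y < b → y < a) → lt a r ≡ lt b r
lt-cong         []      f g = refl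
lt-cong {a} {b} (x ∷ r) f g = cong₂ _+_
  (≤-antisym (below-mono {a} {b} {x} {x} (f (here refl))) (below-mono {b} {a} {x} {x} (g (here refl))))
  (lt-cong r (f ∘ there) (g ∘ there))

lt-length : ∀ {n a} (w : Vec ℕ n) → All (_< a) (toList w) → lt a (toList w) ≡ n
lt-length w p = ≡-trans (lt-all (toList w) p) (Vec.length-toList w)

first-two : ∀ {n a b y} {w : Vec ℕ n} → y ∈ toList w → a ∷ b ∷ y ∷ [] ⊑ toList (a ∷ b ∷ w)
first-two y∈ = refl ∷ refl ∷ ∈-⊑ y∈

later-≢ : ∀ {b x y : ℕ} {w} → Unique (b ∷ w) → x ∷ y ∷ [] ⊑ b ∷ w → y ≢ b
later-≢ (p ∷ _) (_ ∷ʳ r)   e = All.lookup p (⊑-∈ r (there (here refl))) (sym e)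
later-≢ (p ∷ _) (refl ∷ r) e = All.lookup p (⊑-∈ r (here refl)) (sym e)

earlier : ∀ {b x y : ℕ} {w} → x ∷ y ∷ [] ⊑ b ∷ w → x ≡ b ⊎ b ∷ x ∷ y ∷ [] ⊑ b ∷ w
earlier (_ ∷ʳ r)   = inj₂ (refl ∷ r)
earlier (refl ∷ _) = inj₁ refl

-- In the following lemmas, the head b of a word becomes the second entry, and the new first entry a
-- has rank b or b + 1.
module _ {n a b x y : ℕ} {w : Vec ℕ n} (u : Unique (b ∷ toList w)) (q : x ∷ y ∷ [] ⊑ b ∷ toList w) where

  near132 : ∀ {Bad : Triple} → (∀ {a x y} → Bad132 a x y → Bad a x y) → Free Bad (b ∷ w) → b ≤ a → ¬ Bad132 a (punch a x) (punch a y)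
  near132 inc f b≤a (p , p′) with earlier q
  ... | inj₁ refl = <⇒≱ (punch-cancel-< a p′) (≤-trans b≤a (<punch⁻ p))
  ... | inj₂ r    = f _ _ _ r (inc (≤∧≢⇒< (≤-trans b≤a (<punch⁻ p)) (later-≢ u q ∘ sym) , punch-cancel-< a p′))

  near312 : ∀ {Bad : Triple} → (∀ {a x y} → Bad312 a x y → Bad a x y) → Free Bad (b ∷ w) → a ≤ suc b → ¬ Bad312 a (punch a x) (punch a y)
  near312 inc f a≤1+b (p , p′) with earlier q
  ... | inj₁ refl = <⇒≱ (punch-cancel-< a p) (≤-pred (<-≤-trans (punch<⁻ p′) a≤1+b))
  ... | inj₂ r    = f _ _ _ r (inc (punch-cancel-< a p , ≤∧≢⇒< (≤-pred (<-≤-trans (punch<⁻ p′) a≤1+b)) (later-≢ u q)))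

  near231 : ∀ {Bad : Triple} → (∀ {a x y} → Bad231 a x y → Bad a x y) → Free Bad (b ∷ w) → a ≡ suc b → ¬ Bad231 a (punch a x) (punch a y)
  near231 inc f refl (p , p′) with earlier q
  ... | inj₁ refl = <⇒≱ (<punch⁻ p′) ≤-refl
  ... | inj₂ r    = f _ _ _ r (inc (≤∧≢⇒< (≤-pred (punch<⁻ p)) (later-≢ u q) , <punch⁻ p′))

  near213 : ∀ {Bad : Triple} → (∀ {a x y} → Bad213 a x y → Bad a x y) → Free Bad (b ∷ w) → a ≡ b → ¬ Bad213 a (punch a x) (punch a y)
  near213 inc f refl (p , p′) with earlier q
  ... | inj₁ refl = <-irrefl refl (punch<⁻ p)
  ... | inj₂ r    = f _ _ _ r (inc (punch<⁻ p , ≤∧≢⇒< (<punch⁻ p′) (later-≢ u q ∘ sym)))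

not-above : ∀ {n z xs} → All (λ z → 1 ≤ z × z ≤ n) xs → z ∈ xs → ¬ suc n < punch (suc n) z
not-above bnd z∈ p = <⇒≱ (s≤s (proj₂ (All.lookup bnd z∈))) (<punch⁻ p)

not-below : ∀ {n z xs} → All (λ z → 1 ≤ z × z ≤ n) xs → z ∈ xs → ¬ punch 1 z < 1
not-below bnd z∈ p = <⇒≱ (punch<⁻ p) (proj₁ (All.lookup bnd z∈))

bad132-punch : ∀ a {x y z} → Bad132 (punch a x) (punch a y) (punch a z) → Bad132 x y z
bad132-punch a (p , q) = punch-cancel-< a p , punch-cancel-< a q

bad213-punch : ∀ a {x y z} → Bad213 (punch a x) (punch a y) (punch a z) → Bad213 x y z
bad213-punch a (p , q) = punch-cancel-< a p , punch-cancel-< a q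

bad231-punch : ∀ a {x y z} → Bad231 (punch a x) (punch a y) (punch a z) → Bad231 x y z
bad231-punch a (p , q) = punch-cancel-< a p , punch-cancel-< a q

bad312-punch : ∀ a {x y z} → Bad312 (punch a x) (punch a y) (punch a z) → Bad312 x y z
bad312-punch a (p , q) = punch-cancel-< a p , punch-cancel-< a q

module _ {n a b : ℕ} {w : Vec ℕ n} {Bad : Triple} (u : Unique (a ∷ b ∷ toList w)) (f : Free Bad (a ∷ b ∷ w)) where

  private
    ≢a : ∀ {y} → y ∈ b ∷ toList w → y ≢ a
    ≢a y∈ e = All.lookup (AllPairs.head u) y∈ (sym e)

    ≢b : ∀ {y} → y ∈ toList w → y ≢ b
    ≢b y∈ e = All.lookup (AllPairs.head (AllPairs.tail u)) y∈ (sym e)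

  above231 : (∀ {a x y} → Bad231 a x y → Bad a x y) → a < b → All (a <_) (b ∷ toList w)
  above231 inc a<b = a<b ∷ All.tabulate λ y∈ →
    ≤∧≢⇒< (≮⇒≥ λ y<a → f _ _ _ (first-two {w = w} y∈) (inc (y<a , a<b))) (≢a (there y∈) ∘ sym)

  below213 : (∀ {a x y} → Bad213 a x y → Bad a x y) → b < a → All (_< a) (b ∷ toList w)
  below213 inc b<a = b<a ∷ All.tabulate λ y∈ →
    ≤∧≢⇒< (≮⇒≥ λ a<y → f _ _ _ (first-two {w = w} y∈) (inc (b<a , a<y))) (≢a (there y∈))

  -- A later entry between a and b would complete a 132, so no later entry separates a from b.
  rank132 : (∀ {a x y} → Bad132 a x y → Bad a x y) → a < b → lt a (b ∷ toList w) ≡ lt b (toList w)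
  rank132 inc a<b = cong₂ _+_ (below-no {a} (<⇒≤ a<b))
    (lt-cong (toList w) (λ _ y<a → <-trans y<a a<b)
      (λ y∈ y<b → ≤∧≢⇒< (≮⇒≥ λ a<y → f _ _ _ (first-two {w = w} y∈) (inc (a<y , y<b))) (≢a (there y∈))))

  -- Again no later entry lies between, by 312; the additional one is b, which is below a.
  rank312 : (∀ {a x y} → Bad312 a x y → Bad a x y) → b < a → lt a (b ∷ toList w) ≡ suc (lt b (toList w))
  rank312 inc b<a = cong₂ _+_ (below-yes b<a)
    (lt-cong (toList w)
      (λ y∈ y<a → ≤∧≢⇒< (≮⇒≥ λ b<y → f _ _ _ (first-two {w = w} y∈) (inc (b<y , y<a))) (≢b y∈))
      (λ _ y<b → <-trans y<b b<a))

  pair-above : All (a <_) (b ∷ toList w) → 1 ≤ count false (Des (b ∷ w)) →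
               ∃₂ λ x y → x ∷ y ∷ [] ⊑ b ∷ toList w × a < x × x < y
  pair-above p h = let x , y , q , r = count⇒pair false (b ∷ w) (AllPairs.tail u) h
                   in x , y , q , All.lookup p (⊑-∈ q (here refl)) , r

  pair-below : All (_< a) (b ∷ toList w) → 1 ≤ count true (Des (b ∷ w)) →
               ∃₂ λ x y → x ∷ y ∷ [] ⊑ b ∷ toList w × x < a × y < x
  pair-below p h = let x , y , q , r = count⇒pair true (b ∷ w) (AllPairs.tail u) h
                   in x , y , q , All.lookup p (⊑-∈ q (here refl)) , r

-- `Extremal`: every entry is the least or the greatest of those from it onwards. `Layered`:
-- increasing sequence of decreasing runs of consecutive values; `ReverseLayered`: the reversals of
-- these. `Unimodal`: every entry is the least or the greatest of those up to it.
Extremal Layered ReverseLayered Unimodal : Triple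
Extremal       = Bad213 ∪ Bad231
Layered        = Bad231 ∪ Bad312
ReverseLayered = Bad132 ∪ Bad213
Unimodal       = Bad132 ∪ Bad312

-- If the first step is a descent, the first entry exceeds all others; if it is an ascent, none.
extremal : RankedClass Extremal
extremal = record
  { rank = rank ; rank-bounded = bounded ; rank-correct = correct
  ; bad-punch = λ a → [ inj₁ ∘ bad213-punch a , inj₂ ∘ bad231-punch a ]′
  ; bit-true = λ _ p → p ; bit-false = λ { refl → s≤s z≤n }
  ; good = λ { {t = true} _ bnd _ _ q → [ (λ (_ , p) → not-above bnd (⊑-∈ q (there (here refl))) p)
                                        , (λ (_ , p) → not-above bnd (⊑-∈ q (here refl)) p) ]′
             ; {t = false} _ bnd _ _ q → [ (λ (p , _) → not-below bnd (⊑-∈ q (here refl)) p)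
                                         , (λ (p , _) → not-below bnd (⊑-∈ q (there (here refl))) p) ]′ }
  }
  where
  rank : ∀ {n} → Vec Bool n → ℕ
  rank []                  = 0
  rank {suc n} (true ∷ S)  = suc n
  rank (false ∷ S)         = 0
  bounded : ∀ {n} (S : Vec Bool n) → rank S ≤ n
  bounded []          = z≤n
  bounded (true ∷ S)  = ≤-refl
  bounded (false ∷ S) = z≤n
  correct : ∀ {n a} {w : Vec ℕ n} → Unique (a ∷ toList w) → Free Extremal (a ∷ w) →
            lt a (toList w) ≡ rank (Des (a ∷ w))
  correct {w = []}    u f = refl
  correct {a = a} {b ∷ w} u f with bit-cases true (head-≢ u)
  ... | inj₁ (e , b<a) = ≡-trans (lt-length (b ∷ w) (below213 {w = w} u f inj₁ b<a))
    (cong (λ t → rank (t ∷ Des (b ∷ w))) (sym e))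
  ... | inj₂ (e , a<b) = ≡-trans (lt-none (b ∷ toList w) (All.map <⇒≤ (above231 {w = w} u f inj₂ a<b)))
    (cong (λ t → rank (t ∷ Des (b ∷ w))) (sym e))

-- Below the first entry lies just the rest of its layer, so the rank is the length of the initial
-- run of descents.
layered : RankedClass Layered
layered = record
  { rank = rank ; rank-bounded = bounded ; rank-correct = correct
  ; bad-punch = λ a → [ inj₁ ∘ bad231-punch a , inj₂ ∘ bad312-punch a ]′
  ; bit-true = λ { refl _ → ≤-refl } ; bit-false = λ { refl → s≤s z≤n }
  ; good = λ { {t = true} {w = w} refl _ u f q → [ near231 {w = w} u q inj₁ f refl , near312 {w = w} u q inj₂ f ≤-refl ]′
             ; {t = false} _ bnd _ _ q → [ (λ (p , _) → not-below bnd (⊑-∈ q (there (here refl))) p)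
                                         , (λ (_ , p) → not-below bnd (⊑-∈ q (there (here refl))) p) ]′ }
  }
  where
  rank : ∀ {n} → Vec Bool n → ℕ
  rank []          = 0
  rank (true ∷ S)  = suc (rank S)
  rank (false ∷ S) = 0
  bounded : ∀ {n} (S : Vec Bool n) → rank S ≤ n
  bounded []          = z≤n
  bounded (true ∷ S)  = s≤s (bounded S)
  bounded (false ∷ S) = z≤n
  correct : ∀ {n a} {w : Vec ℕ n} → Unique (a ∷ toList w) → Free Layered (a ∷ w) →
            lt a (toList w) ≡ rank (Des (a ∷ w))
  correct {w = []}    u f = refl
  correct {a = a} {b ∷ w} u f with bit-cases true (head-≢ u)
  ... | inj₁ (e , b<a) = ≡-trans (≡-trans (rank312 {w = w} u f inj₂ b<a)
      (cong suc (correct {w = w} (AllPairs.tail u) (free-tail {a = a} {b ∷ w} f))))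
    (cong (λ t → rank (t ∷ Des (b ∷ w))) (sym e))
  ... | inj₂ (e , a<b) = ≡-trans (lt-none (b ∷ toList w) (All.map <⇒≤ (above231 {w = w} u f inj₁ a<b)))
    (cong (λ t → rank (t ∷ Des (b ∷ w))) (sym e))

-- The first block rises and lies above all that follows it. So the rank is the number of entries
-- after the block, which is the number of bits from the first descent on.
reverseLayered : RankedClass ReverseLayered
reverseLayered = record
  { rank = rank ; rank-bounded = bounded ; rank-correct = correct
  ; bad-punch = λ a → [ inj₁ ∘ bad132-punch a , inj₂ ∘ bad213-punch a ]′
  ; bit-true = λ _ p → p ; bit-false = λ { refl → ≤-refl }
  ; good = λ { {t = true} _ bnd _ _ q → [ (λ (p , _) → not-above bnd (⊑-∈ q (there (here refl))) p)
                                        , (λ (_ , p) → not-above bnd (⊑-∈ q (there (here refl))) p) ]′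
             ; {t = false} {w = w} refl _ u f q → [ near132 {w = w} u q inj₁ f ≤-refl , near213 {w = w} u q inj₂ f refl ]′ }
  }
  where
  rank : ∀ {n} → Vec Bool n → ℕ
  rank []                  = 0
  rank {suc n} (true ∷ S)  = suc n
  rank (false ∷ S)         = rank S
  bounded : ∀ {n} (S : Vec Bool n) → rank S ≤ n
  bounded []          = z≤n
  bounded (true ∷ S)  = ≤-refl
  bounded (false ∷ S) = m≤n⇒m≤1+n (bounded S)
  correct : ∀ {n a} {w : Vec ℕ n} → Unique (a ∷ toList w) → Free ReverseLayered (a ∷ w) →
            lt a (toList w) ≡ rank (Des (a ∷ w))
  correct {w = []}    u f = refl
  correct {a = a} {b ∷ w} u f with bit-cases true (head-≢ u)
  ... | inj₁ (e , b<a) = ≡-trans (lt-length (b ∷ w) (below213 {w = w} u f inj₂ b<a))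
    (cong (λ t → rank (t ∷ Des (b ∷ w))) (sym e))
  ... | inj₂ (e , a<b) = ≡-trans (≡-trans (rank132 {w = w} u f inj₁ a<b)
      (correct {w = w} (AllPairs.tail u) (free-tail {a = a} {b ∷ w} f)))
    (cong (λ t → rank (t ∷ Des (b ∷ w))) (sym e))

-- An entry below the first one is a new minimum, reached by a descent, and an entry above it is a
-- new maximum, reached by an ascent; hence the rank is the number of descents.
unimodal : RankedClass Unimodal
unimodal = record
  { rank = trues ; rank-bounded = bounded ; rank-correct = correct
  ; bad-punch = λ a → [ inj₁ ∘ bad132-punch a , inj₂ ∘ bad312-punch a ]′
  ; bit-true = λ { refl _ → ≤-refl } ; bit-false = λ { refl → ≤-refl }
  ; good = λ { {t = true} {w = w} refl _ u f q → [ near132 {w = w} u q inj₁ f (n≤1+n _) , near312 {w = w} u q inj₂ f ≤-refl ]′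
             ; {t = false} {w = w} refl _ u f q → [ near132 {w = w} u q inj₁ f ≤-refl , near312 {w = w} u q inj₂ f (n≤1+n _) ]′ }
  }
  where
  bounded : ∀ {n} (S : Vec Bool n) → trues S ≤ n
  bounded []          = z≤n
  bounded (true ∷ S)  = s≤s (bounded S)
  bounded (false ∷ S) = m≤n⇒m≤1+n (bounded S)
  correct : ∀ {n a} {w : Vec ℕ n} → Unique (a ∷ toList w) → Free Unimodal (a ∷ w) →
            lt a (toList w) ≡ trues (Des (a ∷ w))
  correct {w = []}    u f = refl
  correct {a = a} {b ∷ w} u f with bit-cases true (head-≢ u)
  ... | inj₁ (e , b<a) = ≡-trans (≡-trans (rank312 {w = w} u f inj₂ b<a)
      (cong suc (correct {w = w} (AllPairs.tail u) (free-tail {a = a} {b ∷ w} f))))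
    (cong (λ t → trues (t ∷ Des (b ∷ w))) (sym e))
  ... | inj₂ (e , a<b) = ≡-trans (≡-trans (rank132 {w = w} u f inj₁ a<b)
      (correct {w = w} (AllPairs.tail u) (free-tail {a = a} {b ∷ w} f)))
    (cong (λ t → trues (t ∷ Des (b ∷ w))) (sym e))

-- After an ascent from a all later entries are above a, so any later ascent continues it. The next
-- three lemmas have the same reason, two of them with the order reversed.
extremal-false : Extends false Extremal
extremal-false {w = w} u f a<b = pair-above {w = w} u f (above231 {w = w} u f inj₂ a<b)

extremal-true : Extends true Extremal
extremal-true {w = w} u f b<a = pair-below {w = w} u f (below213 {w = w} u f inj₁ b<a)

layered-false : Extends false Layered
layered-false {w = w} u f a<b = pair-above {w = w} u f (above231 {w = w} u f inj₁ a<b)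

reverseLayered-true : Extends true ReverseLayered
reverseLayered-true {w = w} u f b<a = pair-below {w = w} u f (below213 {w = w} u f inj₂ b<a)

-- In a word avoiding 132 and 312, every entry is a new maximum or a new minimum.
unimodal-later : ∀ t {n b} (w : Vec ℕ n) → Unique (b ∷ toList w) → Free Unimodal (b ∷ w) →
                 1 ≤ count t (Des (b ∷ w)) → ∃[ y ] y ∈ toList w × b ⊏[ t ] y
unimodal-later true  []      u f ()
unimodal-later false []      u f ()
unimodal-later t {b = b} (c ∷ w) u f h with bit-cases t (head-≢ u)
... | inj₁ (_ , b⊏c) = c , here refl , b⊏c
... | inj₂ (e , c⊏b) rewrite e =
  let y , y∈ , c⊏y = unimodal-later t w (AllPairs.tail u) (free-tail {a = b} {c ∷ w} f)
                       (subst (1 ≤_) (count-not t (Des (c ∷ w))) h)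
  in y , there y∈ , side t c⊏b c⊏y y∈
  where
  side : ∀ t {y} → c ⊏[ t ] b → c ⊏[ t ] y → y ∈ toList w → b ⊏[ t ] y
  side true  b<c y<c y∈ = ≤∧≢⇒< (≮⇒≥ λ b<y → f _ _ _ (first-two {w = w} y∈) (inj₁ (b<y , y<c)))
                            (λ e → All.lookup (AllPairs.head u) (there y∈) (sym e))
  side false c<b c<y y∈ = ≤∧≢⇒< (≮⇒≥ λ y<b → f _ _ _ (first-two {w = w} y∈) (inj₂ (c<y , y<b)))
                            (All.lookup (AllPairs.head u) (there y∈))

-- Here b itself is the middle entry: a later step of the same kind leads to some entry beyond b.
unimodal-extends : ∀ t → Extends t Unimodal
unimodal-extends t {a = a} {b} {w} u f a⊏b h =
  let y , y∈ , b⊏y = unimodal-later t w (AllPairs.tail u) (free-tail {a = a} {b ∷ w} f) h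
  in b , y , refl ∷ ∈-⊑ y∈ , a⊏b , b⊏y

-- Avoidance in terms of descents and ascents

monotone : Bool → Vec ℕ 3
monotone true  = p321
monotone false = p123

module _ {n : ℕ} {σ : Vec ℕ n} where

  monotone⁺ : ∀ t {a b c} → a ∷ b ∷ c ∷ [] ⊑ toList σ → a ⊏[ t ] b → b ⊏[ t ] c → Contains σ (monotone t)
  monotone⁺ true  q p p′ = contains321⁺ q p′ p
  monotone⁺ false q p p′ = contains123⁺ q p p′

  monotone⁻ : ∀ t → Contains σ (monotone t) → ∃₂ λ a b → ∃[ c ] a ∷ b ∷ c ∷ [] ⊑ toList σ × a ⊏[ t ] b × b ⊏[ t ] c
  monotone⁻ true  h = let a , b , c , q , p , p′ = contains321⁻ h in a , b , c , q , p′ , p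
  monotone⁻ false h = contains123⁻ h

  free⇔ : ∀ (π ρ : Vec ℕ 3) {P R : Triple} →
    (∀ {a b c} → a ∷ b ∷ c ∷ [] ⊑ toList σ → P a b c → Contains σ π) →
    (Contains σ π → ∃₂ λ a b → ∃[ c ] a ∷ b ∷ c ∷ [] ⊑ toList σ × P a b c) →
    (∀ {a b c} → a ∷ b ∷ c ∷ [] ⊑ toList σ → R a b c → Contains σ ρ) →
    (Contains σ ρ → ∃₂ λ a b → ∃[ c ] a ∷ b ∷ c ∷ [] ⊑ toList σ × R a b c) →
    (¬ Contains σ π × ¬ Contains σ ρ) ⇔ Free (P ∪ R) σ
  free⇔ π ρ {P} {R} p⁺ p⁻ r⁺ r⁻ = mk⇔ to from
    where
    to : ¬ Contains σ π × ¬ Contains σ ρ → Free (P ∪ R) σ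
    to (h , k) _ _ _ q = [ h ∘ p⁺ q , k ∘ r⁺ q ]′
    from : Free (P ∪ R) σ → ¬ Contains σ π × ¬ Contains σ ρ
    from f = (λ h → let _ , _ , _ , q , p = p⁻ h in f _ _ _ q (inj₁ p))
           , (λ h → let _ , _ , _ , q , p = r⁻ h in f _ _ _ q (inj₂ p))

  extremal⇔ : (¬ Contains σ p213 × ¬ Contains σ p231) ⇔ Free Extremal σ
  extremal⇔ = free⇔ p213 p231 (λ q → uncurry (contains213⁺ q)) contains213⁻ (λ q → uncurry (contains231⁺ q)) contains231⁻

  layered⇔ : (¬ Contains σ p231 × ¬ Contains σ p312) ⇔ Free Layered σ
  layered⇔ = free⇔ p231 p312 (λ q → uncurry (contains231⁺ q)) contains231⁻ (λ q → uncurry (contains312⁺ q)) contains312⁻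

  reverseLayered⇔ : (¬ Contains σ p132 × ¬ Contains σ p213) ⇔ Free ReverseLayered σ
  reverseLayered⇔ = free⇔ p132 p213 (λ q → uncurry (contains132⁺ q)) contains132⁻ (λ q → uncurry (contains213⁺ q)) contains213⁻

  unimodal⇔ : (¬ Contains σ p132 × ¬ Contains σ p312) ⇔ Free Unimodal σ
  unimodal⇔ = free⇔ p132 p312 (λ q → uncurry (contains132⁺ q)) contains132⁻ (λ q → uncurry (contains312⁺ q)) contains312⁻

  monotone⇔ : ∀ t {Bad} → Extends t Bad → Unique (toList σ) → Free Bad σ →
              (¬ Contains σ (monotone t)) ⇔ count t (Des σ) ≤ 1
  monotone⇔ t ext u f = mk⇔
    (λ h → ≤-pred (≰⇒> λ l → let _ , _ , _ , q , p , p′ = count⇒triple t σ ext u f l in h (monotone⁺ t q p p′)))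
    (λ l h → let _ , _ , _ , q , p , p′ = monotone⁻ t h in <⇒≱ (triple⇒count t σ u q p p′) l)

  -- Both 132 and 312 contain a rising and a falling pair. Conversely, the first step decides: after
  -- a descent the first entry is the greatest, so a later ascent completes a 312; after an ascent
  -- it is the least, and a later descent completes a 132.
  mixed⇔ : Unique (toList σ) → Free Extremal σ →
           (¬ Contains σ p132 × ¬ Contains σ p312) ⇔ (count true (Des σ) ≡ 0 ⊎ count false (Des σ) ≡ 0)
  mixed⇔ u f = mk⇔ (λ (h , k) → to σ u f h k) λ z →
      (λ h → let _ , _ , _ , q , p , p′ = contains132⁻ h in
             from z (⊑-take q) (<-trans p p′) (⊑-drop q) p′)
    , (λ h → let _ , _ , _ , q , p , p′ = contains312⁻ h in
             from z (⊑-drop q) p (⊑-take q) (<-trans p p′))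
    where
    ⊑-take : ∀ {a b c : ℕ} {w} → a ∷ b ∷ c ∷ [] ⊑ w → a ∷ b ∷ [] ⊑ w
    ⊑-take q = ⊑-trans (refl ∷ refl ∷ minimum _) q
    ⊑-drop : ∀ {a b c : ℕ} {w} → a ∷ b ∷ c ∷ [] ⊑ w → b ∷ c ∷ [] ⊑ w
    ⊑-drop q = ⊑-trans (_ ∷ʳ refl ∷ refl ∷ []) q
    from : count true (Des σ) ≡ 0 ⊎ count false (Des σ) ≡ 0 → ∀ {x y x′ y′} →
           x ∷ y ∷ [] ⊑ toList σ → x < y → x′ ∷ y′ ∷ [] ⊑ toList σ → y′ < x′ → ⊥
    from (inj₁ z) _ _ q p = n≮0 (subst (1 ≤_) z (pair⇒count true σ u q p))
    from (inj₂ z) q p _ _ = n≮0 (subst (1 ≤_) z (pair⇒count false σ u q p))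
    none : ∀ {k} → ¬ 1 ≤ k → k ≡ 0
    none h = n≤0⇒n≡0 (≤-pred (≰⇒> h))
    to : ∀ {n} (σ : Vec ℕ n) → Unique (toList σ) → Free Extremal σ → ¬ Contains σ p132 → ¬ Contains σ p312 →
         count true (Des σ) ≡ 0 ⊎ count false (Des σ) ≡ 0
    to []          u f h k = inj₁ refl
    to (a ∷ [])    u f h k = inj₁ refl
    to (a ∷ b ∷ w) u f h k with bit-cases true (head-≢ u)
    ... | inj₁ (e , b<a) rewrite e = inj₂ (none λ l →
      let x , y , q , x<y = count⇒pair false (b ∷ w) (AllPairs.tail u) l
      in k (contains312⁺ (refl ∷ q) x<y (All.lookup (below213 {w = w} u f inj₁ b<a) (⊑-∈ q (there (here refl))))))
    ... | inj₂ (e , a<b) rewrite e = inj₁ (none λ l →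
      let x , y , q , y<x = count⇒pair true (b ∷ w) (AllPairs.tail u) l
      in h (contains132⁺ (refl ∷ q) (All.lookup (above231 {w = w} u f inj₂ a<b) (⊑-∈ q (there (here refl)))) y<x))

-- Expresses `count t` by the number of descents, since K may depend on the size of the descent set
-- only.
countOf : ℕ → Bool → ℕ → ℕ
countOf n true  d = d
countOf n false d = (n ∸ 1) ∸ d

countOf-trues : ∀ {n} t (S : Subset (n ∸ 1)) → countOf n t (trues S) ≡ count t S
countOf-trues true  S = refl
countOf-trues false S = sym (count-false S)

-- Hook expansions of the listed sets

module _ {Bad : Triple} (class : RankedClass Bad) {X : ∀ {n} → Vec ℕ n → Set}
         (class⇔ : ∀ {n} {σ : Vec ℕ n} → X σ ⇔ Free Bad σ) where

  expansion-class : ∀ {Π} → (∀ {n} {σ : Vec ℕ n} → Avoids Π σ ⇔ X σ) → ∀ n → SchurExpansion n (Q n Π)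
  expansion-class av n = hookExpansion (λ _ → yes tt) (descentClass class λ _ → mk⇔
    (λ h → Equivalence.to class⇔ (Equivalence.to av h) , tt)
    (λ (f , _) → Equivalence.from av (Equivalence.from class⇔ f)))

  expansion-monotone : ∀ t {Π} → Extends t Bad →
    (∀ {n} {σ : Vec ℕ n} → Avoids Π σ ⇔ (X σ × ¬ Contains σ (monotone t))) → ∀ n → SchurExpansion n (Q n Π)
  expansion-monotone t ext av n = hookExpansion (λ d → countOf n t d ≤? 1) (descentClass class λ {σ} σ∈ →
    let u = proj₂ (∈-𝔖⁻ σ∈) ; e = countOf-trues {n} t (Des σ) in mk⇔
    (λ h → let x , m = Equivalence.to av h ; f = Equivalence.to class⇔ x in
           f , subst (_≤ 1) (sym e) (Equivalence.to (monotone⇔ t ext u f) m))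
    (λ (f , l) → Equivalence.from av (Equivalence.from class⇔ f , Equivalence.from (monotone⇔ t ext u f) (subst (_≤ 1) e l))))

Mixed-free : ∀ {n} → Vec ℕ n → Set
Mixed-free σ = (¬ Contains σ p213 × ¬ Contains σ p231) × (¬ Contains σ p132 × ¬ Contains σ p312)

-- No descent or no ascent, so only one-row and one-column shapes remain.
Pure : ℕ → ℕ → Set
Pure n d = countOf n true d ≡ 0 ⊎ countOf n false d ≡ 0

pure? : ∀ n d → Dec (Pure n d)
pure? n d = (d ≟ 0) ⊎-dec (countOf n false d ≟ 0)

pure⇔ : ∀ {n} {σ : Vec ℕ n} → σ ∈ 𝔖 n → Mixed-free σ ⇔ (Free Extremal σ × Pure n (trues (Des σ)))
pure⇔ {n} {σ} σ∈ = mk⇔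
  (λ (x , y) → let f = Equivalence.to extremal⇔ x in
    f , subst (λ k → trues (Des σ) ≡ 0 ⊎ k ≡ 0) (sym e) (Equivalence.to (mixed⇔ u f) y))
  (λ (f , p) → Equivalence.from extremal⇔ f ,
    Equivalence.from (mixed⇔ u f) (subst (λ k → trues (Des σ) ≡ 0 ⊎ k ≡ 0) e p))
  where
  u = proj₂ (∈-𝔖⁻ σ∈)
  e = countOf-trues {n} false (Des σ)

expansion-mixed : ∀ {Π} → (∀ {n} {σ : Vec ℕ n} → Avoids Π σ ⇔ Mixed-free σ) → ∀ n → SchurExpansion n (Q n Π)
expansion-mixed av n = hookExpansion (pure? n) (descentClass extremal λ σ∈ → mk⇔
  (Equivalence.to (pure⇔ σ∈) ∘ Equivalence.to av) (Equivalence.from av ∘ Equivalence.from (pure⇔ σ∈)))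

-- The bound excludes the monotone permutation of kind t only when it has at least two steps, so
-- small n need no separate treatment.
expansion-mixed-monotone : ∀ t {Π} → Extends t Extremal →
  (∀ {n} {σ : Vec ℕ n} → Avoids Π σ ⇔ (Mixed-free σ × ¬ Contains σ (monotone t))) → ∀ n → SchurExpansion n (Q n Π)
expansion-mixed-monotone t ext av n =
  hookExpansion (λ d → pure? n d ×-dec (countOf n t d ≤? 1)) (descentClass extremal λ {σ} σ∈ →
  let u = proj₂ (∈-𝔖⁻ σ∈) ; e = countOf-trues {n} t (Des σ) in mk⇔
  (λ h → let x , m = Equivalence.to av h ; f , p = Equivalence.to (pure⇔ σ∈) x in
         f , p , subst (_≤ 1) (sym e) (Equivalence.to (monotone⇔ t ext u f) m))
  (λ (f , p , l) → Equivalence.from av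
    (Equivalence.from (pure⇔ σ∈) (f , p) , Equivalence.from (monotone⇔ t ext u f) (subst (_≤ 1) e l))))

listed-expansions : All (λ Π → ∀ n → SchurExpansion n (Q n Π)) listedSets
listed-expansions =
    expansion-∅
  ∷ expansion-123
  ∷ expansion-321
  ∷ expansion-class reverseLayered reverseLayered⇔ pair
  ∷ expansion-class unimodal unimodal⇔ pair
  ∷ expansion-class extremal extremal⇔ pair
  ∷ expansion-class layered layered⇔ pair
  ∷ expansion-monotone unimodal unimodal⇔ false (unimodal-extends false) first
  ∷ expansion-monotone extremal extremal⇔ false extremal-false first
  ∷ expansion-monotone layered layered⇔ false layered-false first
  ∷ expansion-monotone reverseLayered reverseLayered⇔ true reverseLayered-true last
  ∷ expansion-monotone unimodal unimodal⇔ true (unimodal-extends true) last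
  ∷ expansion-monotone extremal extremal⇔ true extremal-true last
  ∷ expansion-mixed (mk⇔ (λ { (a ∷ b ∷ c ∷ d ∷ []) → (b , c) , (a , d) }) (λ ((b , c) , (a , d)) → a ∷ b ∷ c ∷ d ∷ []))
  ∷ expansion-mixed-monotone false extremal-false
      (mk⇔ (λ { (m ∷ a ∷ b ∷ c ∷ d ∷ []) → ((b , c) , (a , d)) , m }) (λ (((b , c) , (a , d)) , m) → m ∷ a ∷ b ∷ c ∷ d ∷ []))
  ∷ expansion-mixed-monotone true extremal-true
      (mk⇔ (λ { (a ∷ b ∷ c ∷ d ∷ m ∷ []) → ((b , c) , (a , d)) , m }) (λ (((b , c) , (a , d)) , m) → a ∷ b ∷ c ∷ d ∷ m ∷ []))
  ∷ []
  where
  pair : ∀ {n} {σ : Vec ℕ n} {π ρ : Vec ℕ 3} → Avoids (π ∷ ρ ∷ []) σ ⇔ (¬ Contains σ π × ¬ Contains σ ρ)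
  pair = mk⇔ (λ { (a ∷ b ∷ []) → a , b }) (λ (a , b) → a ∷ b ∷ [])
  first : ∀ {n} {σ : Vec ℕ n} {m π ρ : Vec ℕ 3} →
          Avoids (m ∷ π ∷ ρ ∷ []) σ ⇔ ((¬ Contains σ π × ¬ Contains σ ρ) × ¬ Contains σ m)
  first = mk⇔ (λ { (m ∷ a ∷ b ∷ []) → (a , b) , m }) (λ ((a , b) , m) → m ∷ a ∷ b ∷ [])
  last : ∀ {n} {σ : Vec ℕ n} {m π ρ : Vec ℕ 3} →
         Avoids (π ∷ ρ ∷ m ∷ []) σ ⇔ ((¬ Contains σ π × ¬ Contains σ ρ) × ¬ Contains σ m)
  last = mk⇔ (λ { (a ∷ b ∷ m ∷ []) → (a , b) , m }) (λ ((a , b) , m) → a ∷ b ∷ m ∷ [])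

-- The sets that are not listed

sublists : List A → List (List A)
sublists []       = [ [] ]
sublists (x ∷ xs) = map (x ∷_) (sublists xs) ++ sublists xs

filter-∈-sublists : {P : A → Set} (P? : ∀ x → Dec (P x)) (xs : List A) → filter P? xs ∈ sublists xs
filter-∈-sublists P? []       = here refl
filter-∈-sublists P? (x ∷ xs) with does (P? x)
... | true  = ∈-++⁺ˡ (∈-map⁺ (x ∷_) (filter-∈-sublists P? xs))
... | false = ∈-++⁺ʳ (map (x ∷_) (sublists xs)) (filter-∈-sublists P? xs)

_≟ᵖ_ : ∀ (π ρ : Vec ℕ 3) → Dec (π ≡ ρ)
_≟ᵖ_ = Vec.≡-dec _≟_

open import Data.List.Membership.DecPropositional _≟ᵖ_ using (_∈?_)

Asymmetric : ℕ → Monomial → List (Vec ℕ 3) → Set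
Asymmetric n m Π = Q n Π (map (transpose 0 1) m) ≢ Q n Π m

asymmetric? : ∀ n m Π → Dec (Asymmetric n m Π)
asymmetric? n m Π = ¬? (Q n Π (map (transpose 0 1) m) ℤ.≟ Q n Π m)

-- The monomials x₀²x₁ and x₀²x₁x₂ are the certificates: exchanging x₀ and x₁ in one of them already
-- refutes symmetry for every unlisted set without both 123 and 321.
Classified : List (Vec ℕ 3) → Set
Classified Π = Any (Π ≡_) listedSets ⊎ (p123 ∈ Π × p321 ∈ Π) ⊎
               Asymmetric 3 (0 ∷ 0 ∷ 1 ∷ []) Π ⊎ Asymmetric 4 (0 ∷ 0 ∷ 1 ∷ 2 ∷ []) Π

classified? : ∀ Π → Dec (Classified Π)
classified? Π = Any.any? (List.≡-dec _≟ᵖ_ Π) listedSets ⊎-dec (p123 ∈? Π ×-dec p321 ∈? Π) ⊎-dec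
                asymmetric? 3 (0 ∷ 0 ∷ 1 ∷ []) Π ⊎-dec asymmetric? 4 (0 ∷ 0 ∷ 1 ∷ 2 ∷ []) Π

-- Decided by evaluation on the 64 subsets of `𝔖 3`.
all-classified : All Classified (sublists (𝔖 3))
all-classified = from-yes (All.all? classified? (sublists (𝔖 3)))

-- A set of patterns is given as a list in any order and with possible repetitions; avoidance
-- depends on its members only.
avoiding-cong : ∀ n {Π Π′ : List (Vec ℕ 3)} → Π ∼[ set ] Π′ → 𝔖-avoiding n Π ≡ 𝔖-avoiding n Π′
avoiding-cong n {Π} {Π′} e = List.filter-≐ (avoids? Π) (avoids? Π′)
  ( (λ av → All.tabulate λ p → All.lookup av (Equivalence.from e p))
  , (λ av → All.tabulate λ p → All.lookup av (Equivalence.to e p))) (𝔖 n)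

Q-cong : ∀ n {Π Π′ : List (Vec ℕ 3)} → Π ∼[ set ] Π′ → ∀ m → Q n Π m ≡ Q n Π′ m
Q-cong n e m = cong (λ σs → Σ[ σs ] (λ σ → F n (Des σ)) m) (avoiding-cong n e)

transposition : ℕ ↔ ℕ
transposition = mk↔ₛ′ (transpose 0 1) (transpose 0 1) (transpose-involutive 0 1) (transpose-involutive 0 1)

classified⇒listed : ∀ {Π Π₀} → Π ∼[ set ] Π₀ → ¬ ((p123 ∷ p321 ∷ []) ⊆ Π) → (∀ n → Symmetric (Q n Π)) →
                    Classified Π₀ → Any (λ Π₀ → Π ∼[ set ] Π₀) listedSets
classified⇒listed {Π} {Π₀} e not-both symm = λ
  { (inj₁ listed)               → Any.map listed-∼ listed
  ; (inj₂ (inj₁ (p , q)))       → ⊥-elim (not-both λ { (here refl) → Equivalence.from e p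
                                                      ; (there (here refl)) → Equivalence.from e q })
  ; (inj₂ (inj₂ (inj₁ asym)))   → ⊥-elim (asym (symmetric₀ 3 (0 ∷ 0 ∷ 1 ∷ [])))
  ; (inj₂ (inj₂ (inj₂ asym)))   → ⊥-elim (asym (symmetric₀ 4 (0 ∷ 0 ∷ 1 ∷ 2 ∷ [])))
  }
  where
  listed-∼ : ∀ {Π₁} → Π₀ ≡ Π₁ → Π ∼[ set ] Π₁
  listed-∼ refl = e
  symmetric₀ : ∀ n m → Q n Π₀ (map (transpose 0 1) m) ≡ Q n Π₀ m
  symmetric₀ n m = ≡-trans (sym (Q-cong n e (map (transpose 0 1) m))) (≡-trans (symm n transposition m) (Q-cong n e m))

-- Π is replaced by the list of its members in the order of `𝔖 3`, which is one of the 64 classified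
-- lists.
symmetric⇒listed : ∀ Π → Π ⊆ 𝔖 3 → ¬ ((p123 ∷ p321 ∷ []) ⊆ Π) → (∀ n → Symmetric (Q n Π)) →
                   Any (λ Π₀ → Π ∼[ set ] Π₀) listedSets
symmetric⇒listed Π Π⊆𝔖 not-both symm = classified⇒listed Π∼Π₀ not-both symm
  (All.lookup all-classified (filter-∈-sublists (_∈? Π) (𝔖 3)))
  where
  Π∼Π₀ : Π ∼[ set ] filter (_∈? Π) (𝔖 3)
  Π∼Π₀ = mk⇔ (λ p → ∈-filter⁺ (_∈? Π) (Π⊆𝔖 p) p) (λ p → proj₂ (∈-filter⁻ (_∈? Π) {xs = 𝔖 3} p))

schurExpansion-cong : ∀ {n f g} → (∀ m → f m ≡ g m) → SchurExpansion n g → SchurExpansion n f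
schurExpansion-cong e (schur c c≥0 expands) = schur c c≥0 (λ m → ≡-trans (e m) (expands m))

listed⇒nonnegative : ∀ {Π} → Any (λ Π₀ → Π ∼[ set ] Π₀) listedSets → ∀ n → SchurNonnegative n (Q n Π)
listed⇒nonnegative listed n =
  let expands , e = All.lookupAny listed-expansions listed
  in schurExpansion⇒nonnegative {n} (schurExpansion-cong (Q-cong n e) (expands n))

theorem1p2 : (Π : List (Vec ℕ 3)) → Π ⊆ 𝔖 3 → ¬ ((p123 ∷ p321 ∷ []) ⊆ Π) →
    ((∀ n → Symmetric (Q n Π)) ⇔ (∀ n → SchurNonnegative n (Q n Π))) ×
    ((∀ n → SchurNonnegative n (Q n Π)) ⇔ Any (λ Π₀ → Π ∼[ set ] Π₀) listedSets)
theorem1p2 Π Π⊆𝔖 not-both =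
    -- Schur nonnegativity includes symmetry, so it is enough that symmetry implies being listed and
    -- that listed sets are Schur nonnegative.
    mk⇔ (λ symm → listed⇒nonnegative (to-listed symm)) (λ nonneg n → proj₁ (nonneg n))
  , mk⇔ (λ nonneg → to-listed (λ n → proj₁ (nonneg n))) listed⇒nonnegative
  where
  to-listed = symmetric⇒listed Π Π⊆𝔖 not-both
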